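{- Let $q$ be a fixed odd prime power, let $2\le s\le t$ and $k\ge 5$ be integers, and let $a_1,\dots,a_k\in\mathbb{F}_q^\times$ satisfy $a_1+\cdots+a_k=0$. There exist constants $c=c(q,k,s,t)>0$ and $C>0$ (depending only on $q,k,s,t,a_1,\dots,a_k$) such that for every integer $n\ge 1$, writing $N=q^n$: if $A\subseteq\mathbb{F}_q^n$ is $K_{s,t}$-free and contains no nontrivial solution to $a_1x_1+\cdots+a_kx_k=0$, then \[ |A|\le C\,N^{1-1/s}(\log N)^{ -c}. \]
   Context: A set $A\subseteq\mathbb{F}_q^n$ is $K_{s,t}$-free if there do not exist pairwise distinct $x_1,\dots,x_s\in\mathbb{F}_q^n$ and pairwise distinct $y_1,\dots,y_t\in\mathbb{F}_q^n$ with $x_i+y_j\in A$ for all $1\le i\le s$, $1\le j\le t$. A solution $(x_1,\dots,x_k)\in A^k$ of $a_1x_1+\cdots+a_kx_k=0$ is trivial if $x_1=\cdots=x_k$, and nontrivial otherwise. -}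

module Defs where

open import Data.Nat using (ℕ; zero; suc)
open import Data.Fin using (Fin) renaming (zero to fzero; suc to fsuc)
open import Data.Vec using (Vec; zipWith; map; replicate)
open import Data.List using (List)
open import Data.List.Membership.Propositional using (_∈_)
open import Data.Product using (Σ; ∃; ∃₂; _×_)
open import Relation.Binary.PropositionalEquality using (_≡_; _≢_)
open import Relation.Nullary using (¬_)
open import Algebra.Structures using (IsCommutativeRing)
open import Function.Definitions using (Injective)

record FiniteField (q : ℕ) : Set where
  infixl 6 _+_
  infixl 7 _*_
  field
    _+_ _*_ : Fin q → Fin q → Fin q
    -_ : Fin q → Fin q
    0# 1# : Fin q
    isCommutativeRing : IsCommutativeRing _≡_ _+_ _*_ -_ 0# 1#
    0≢1 : 0# ≢ 1#
    inverse : ∀ x → x ≢ 0# → ∃ λ y → x * y ≡ 1#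

module _ {q : ℕ} (F : FiniteField q) where
  open FiniteField F

  Pt : ℕ → Set
  Pt n = Vec (Fin q) n

  _⊕_ : ∀ {n} → Pt n → Pt n → Pt n
  _⊕_ = zipWith _+_

  _⊙_ : ∀ {n} → Fin q → Pt n → Pt n
  a ⊙ v = map (a *_) v

  zeroV : ∀ n → Pt n
  zeroV n = replicate n 0#

  fsum : ∀ k → (Fin k → Fin q) → Fin q
  fsum zero a = 0#
  fsum (suc k) a = a fzero + fsum k (λ i → a (fsuc i))

  lincomb : ∀ {n} k → (Fin k → Fin q) → (Fin k → Pt n) → Pt n
  lincomb {n} zero a x = zeroV n
  lincomb (suc k) a x = (a fzero ⊙ x fzero) ⊕ lincomb k (λ i → a (fsuc i)) (λ i → x (fsuc i))

  KstFree : ∀ {n} → ℕ → ℕ → List (Pt n) → Set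
  KstFree {n} s t A =
    ¬ (Σ (Fin s → Pt n) λ x → Σ (Fin t → Pt n) λ y →
         Injective _≡_ _≡_ x × Injective _≡_ _≡_ y × (∀ i j → (x i ⊕ y j) ∈ A))

  HasNontrivialSolution : ∀ {n} k → (Fin k → Fin q) → List (Pt n) → Set
  HasNontrivialSolution {n} k a A =
    Σ (Fin k → Pt n) λ x → (∀ i → x i ∈ A) × lincomb k a x ≡ zeroV n
      × ∃₂ λ i j → x i ≢ x j

{-# OPTIONS --safe #-}
-- Compare A with its averages over the cosets of a subspace H. Writing [ℓ·x = 0] through the sums of
-- nontrivial characters on lines keeps all Fourier analysis inside the integers: the number of solutions
-- in A is a sum over functionals ℓ of the discrepancy of A along ℓ. K_{s,t}-freeness bounds the
-- additive energy of A, hence the fourth moment of the discrepancies, so only boundedly many ℓ have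
-- large bias; H is their common kernel. Since k ≥ 5, the other functionals contribute little, and the
-- number of solutions in A is governed by the number of x ∈ Aᵏ with a₁x₁ + ⋯ + aₖxₖ ∈ H. The same
-- K_{s,t} count bounds the second moment of the coset averages, so these are large on a dense set B of
-- points. The slice rank method gives a polynomial lower bound for the number of solutions in B: the
-- three-variable case follows by averaging over affine maps from a small space, and a variable is
-- split into two by applying that case to the set of its admissible values. Hence A contains far more
-- solutions than trivial ones unless its density is below a power of log N.
-- All densities are measured in powers of 1/2.

module Submission where

open import Level using (0ℓ)
open import Data.Nat
open import Data.Nat.Properties
open import Data.Nat.Tactic.RingSolver using (solve-∀)
open import Data.Fin using (Fin; fromℕ<; toℕ; opposite; inject≤) renaming (zero to fzero; suc to fsuc)
open import Data.Vec using (Vec; []; _∷_)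
open import Data.List using (List; []; _∷_; _++_; map; length; allFin; cartesianProductWith; tabulate; filter; _ʳ++_; lookup; foldr)
open import Data.List.Properties using (length-tabulate; filter-notAll)
open import Data.List.Membership.Propositional using (_∈_; lose; find)
open import Data.List.Membership.Propositional.Properties using (∈-allFin; ∈-cartesianProductWith⁺; ∈-filter⁺; ∈-filter⁻; ∈-lookup)
open import Data.List.Relation.Unary.All as All using (All; []; _∷_; all?)
open import Data.List.Relation.Unary.Any using (here; there; Any; any?; index)
open import Data.List.Relation.Unary.Unique.Propositional using (Unique; []; _∷_)
open import Data.Product using (∃; _×_; _,_; proj₁; proj₂; Σ; ∃-syntax)
open import Data.Sum using (_⊎_; inj₁; inj₂) renaming (map to ⊎-map)
open import Data.Empty using (⊥)
open import Function using (_∘_; id)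
open import Relation.Nullary using (¬_; Dec; yes; no; contradiction)
open import Relation.Nullary.Decidable using (_×-dec_; ¬?)
open import Relation.Binary.Definitions using (DecidableEquality; tri<; tri≈; tri>)
open import Relation.Binary.PropositionalEquality
open import Algebra.Structures using (IsCommutativeSemiring)
open import Defs
open import Data.Maybe using (Maybe; just; nothing)
open import Algebra.Bundles using (CommutativeRing; RawRing)
open import Data.List.Relation.Unary.Any.Properties using (lookup-index)
open import Function.Definitions using (Injective)
open import Data.List.Relation.Unary.All.Properties using (¬All⇒Any¬)
open import Data.Nat.DivMod using (m/n*n≤m; m≡m%n+[m/n]*n; m%n<n)
open import Data.Nat.Divisibility using (_∣_; divides)
import Data.Fin.Properties as Fin
import Data.Vec.Properties as Vec
import Data.List.Relation.Unary.Unique.Propositional.Properties as Unique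
import Data.Vec as Vec
import Algebra.Solver.Ring
import Algebra.Solver.Ring.AlmostCommutativeRing as ACR
import Algebra.Properties.Semiring.Mult
import Algebra.Properties.Ring
import Data.Integer as ℤ
import Data.Integer.Properties as ℤ
import Data.Integer.Tactic.RingSolver as ℤ-RingSolver
import Data.List.Relation.Unary.All.Properties as All

-- Sums over finite types

-- The set A has at most about N^(1-1/s) elements, so results on dense sets say nothing about it
-- directly; its coset averages make the passage to a dense set. With M = `q ^ (n / s)` in place of
-- N^(1/s), and A of size about N/M, the count of K_{s,t} configurations makes the additive energy
-- at most a constant times that of a random set of this size. If |A| is at least N / (2^l M), every
-- later loss has to be a power of 2^l. A cutoff 1/E for the relative bias leaves about E^4
-- exceptional functionals, which is also a bound for the codimension of H, and H must keep at least
-- q^(n/2) elements. As E is a power of 2^l, this allows 2^l to be a small fixed power of n, and n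
-- is log N up to a constant: this is where the power of the logarithm comes from. It also requires
-- supersaturation with polynomial dependence on the density, since E has to exceed the inverse of
-- the proportion of solutions found in B. The final contradiction compares a^k / N, up to powers of
-- 2^l, with the at most a trivial solutions.

record Enum (A : Set) : Set where
  field
    elems : List A
    _≟ᴱ_ : DecidableEquality A
    complete : ∀ a → a ∈ elems
    unique : Unique elems
open Enum public using (elems)

finEnum : ∀ n → Enum (Fin n)
finEnum n = record
  { elems = allFin n ; _≟ᴱ_ = Fin._≟_ ; complete = ∈-allFin ; unique = Unique.allFin⁺ n }

vecEnum : ∀ {A : Set} → Enum A → ∀ n → Enum (Vec A n)
vecEnum E zero = record
  { elems = [] ∷ []
  ; _≟ᴱ_ = Vec.≡-dec (Enum._≟ᴱ_ E)
  ; complete = λ { [] → here refl }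
  ; unique = [] ∷ [] }
vecEnum E (suc n) = record
  { elems = cartesianProductWith _∷_ (elems E) (elems (vecEnum E n))
  ; _≟ᴱ_ = Vec.≡-dec (Enum._≟ᴱ_ E)
  ; complete = λ { (x ∷ v) → ∈-cartesianProductWith⁺ _∷_ (Enum.complete E x) (Enum.complete (vecEnum E n) v) }
  ; unique = Unique.cartesianProductWith⁺ _∷_ Vec.∷-injective (Enum.unique E) (Enum.unique (vecEnum E n)) }

-- Parametrised by the semiring because the same sums occur over the naturals (counts), the integers
-- (character sums) and the field (functionals on functions).
module Sum {R : Set} {_+'_ _*'_ : R → R → R} {0# 1# : R}
           (S : IsCommutativeSemiring _≡_ _+'_ _*'_ 0# 1#) where
  private
    module S = IsCommutativeSemiring S
    infixl 6 _⊹_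
    infixl 7 _·_
    _⊹_ _·_ : R → R → R
    _⊹_ = _+'_
    _·_ = _*'_

  ∑ : {A : Set} → List A → (A → R) → R
  ∑ [] f = 0#
  ∑ (x ∷ xs) f = f x ⊹ ∑ xs f

  iv : {P : Set} → Dec P → R
  iv (yes _) = 1#
  iv (no _) = 0#

  iv-yes : {P : Set} (d : Dec P) → P → iv d ≡ 1#
  iv-yes (yes _) p = refl
  iv-yes (no ¬p) p = contradiction p ¬p

  iv-no : {P : Set} (d : Dec P) → ¬ P → iv d ≡ 0#
  iv-no (yes p) ¬p = contradiction p ¬p
  iv-no (no _) ¬p = refl

  iv-cong : {P Q : Set} (d : Dec P) (e : Dec Q) → (P → Q) → (Q → P) → iv d ≡ iv e
  iv-cong (yes p) e f g = sym (iv-yes e (f p))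
  iv-cong (no ¬p) e f g = sym (iv-no e (¬p ∘ g))

  module _ {A : Set} where
    ∑-cong∈ : ∀ (xs : List A) {f g : A → R} → (∀ x → x ∈ xs → f x ≡ g x) → ∑ xs f ≡ ∑ xs g
    ∑-cong∈ [] h = refl
    ∑-cong∈ (x ∷ xs) h = cong₂ _⊹_ (h x (here refl)) (∑-cong∈ xs (λ y y∈ → h y (there y∈)))

    ∑-cong : ∀ (xs : List A) {f g : A → R} → (∀ x → f x ≡ g x) → ∑ xs f ≡ ∑ xs g
    ∑-cong xs h = ∑-cong∈ xs (λ x _ → h x)

    ∑-0 : ∀ (xs : List A) → ∑ xs (λ _ → 0#) ≡ 0#
    ∑-0 [] = refl
    ∑-0 (x ∷ xs) = trans (S.+-identityˡ _) (∑-0 xs)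

    ∑-+ : ∀ (xs : List A) (f g : A → R) → ∑ xs (λ x → f x ⊹ g x) ≡ ∑ xs f ⊹ ∑ xs g
    ∑-+ [] f g = sym (S.+-identityˡ _)
    ∑-+ (x ∷ xs) f g = trans (cong ((f x ⊹ g x) ⊹_) (∑-+ xs f g)) (interchange (f x) (g x) (∑ xs f) (∑ xs g))
      where
      interchange : ∀ a b c d → (a ⊹ b) ⊹ (c ⊹ d) ≡ (a ⊹ c) ⊹ (b ⊹ d)
      interchange a b c d = trans (S.+-assoc a b _) (trans (cong (a ⊹_)
        (trans (sym (S.+-assoc b c d)) (trans (cong (_⊹ d) (S.+-comm b c)) (S.+-assoc c b d))))
        (sym (S.+-assoc a c _)))

    ∑-*ˡ : ∀ (xs : List A) (c : R) (f : A → R) → ∑ xs (λ x → c · f x) ≡ c · ∑ xs f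
    ∑-*ˡ [] c f = sym (S.zeroʳ c)
    ∑-*ˡ (x ∷ xs) c f = trans (cong (c · f x ⊹_) (∑-*ˡ xs c f)) (sym (S.distribˡ c _ _))

    ∑-*ʳ : ∀ (xs : List A) (c : R) (f : A → R) → ∑ xs (λ x → f x · c) ≡ ∑ xs f · c
    ∑-*ʳ xs c f = trans (∑-cong xs (λ x → S.*-comm (f x) c)) (trans (∑-*ˡ xs c f) (S.*-comm c _))

    ∑-++ : ∀ (xs ys : List A) (f : A → R) → ∑ (xs ++ ys) f ≡ ∑ xs f ⊹ ∑ ys f
    ∑-++ [] ys f = sym (S.+-identityˡ _)
    ∑-++ (x ∷ xs) ys f = trans (cong (f x ⊹_) (∑-++ xs ys f)) (sym (S.+-assoc _ _ _))

  module _ {A B : Set} where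
    ∑-map : ∀ (h : A → B) (xs : List A) (f : B → R) → ∑ (map h xs) f ≡ ∑ xs (f ∘ h)
    ∑-map h [] f = refl
    ∑-map h (x ∷ xs) f = cong (f (h x) ⊹_) (∑-map h xs f)

    ∑-swap : ∀ (xs : List A) (ys : List B) (f : A → B → R) →
             ∑ xs (λ x → ∑ ys (f x)) ≡ ∑ ys (λ y → ∑ xs (λ x → f x y))
    ∑-swap [] ys f = sym (∑-0 ys)
    ∑-swap (x ∷ xs) ys f = trans (cong (∑ ys (f x) ⊹_) (∑-swap xs ys f)) (sym (∑-+ ys (f x) _))

  ∑-vec : ∀ {A : Set} (E : Enum A) n (f : Vec A (suc n) → R) →
          ∑ (elems (vecEnum E (suc n))) f ≡ ∑ (elems E) (λ x → ∑ (elems (vecEnum E n)) (λ v → f (x ∷ v)))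
  ∑-vec E n f = go (elems E)
    where
    go : ∀ xs → ∑ (cartesianProductWith _∷_ xs (elems (vecEnum E n))) f ≡
                ∑ xs (λ x → ∑ (elems (vecEnum E n)) (λ v → f (x ∷ v)))
    go [] = refl
    go (x ∷ xs) = trans (∑-++ (map (x ∷_) (elems (vecEnum E n))) _ f)
      (cong₂ _⊹_ (∑-map (x ∷_) (elems (vecEnum E n)) f) (go xs))

  module _ {A : Set} (E : Enum A) where
    open Enum E using (_≟ᴱ_)
    ∑-point : ∀ a (f : A → R) → ∑ (elems E) (λ x → iv (x ≟ᴱ a) · f x) ≡ f a
    ∑-point a f = go (elems E) (Enum.unique E) (Enum.complete E a)
      where
      off : ∀ x → ¬ (x ≡ a) → iv (x ≟ᴱ a) · f x ≡ 0#
      off x x≢a = trans (cong (_· f x) (iv-no (x ≟ᴱ a) x≢a)) (S.zeroˡ _)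
      go : ∀ xs → Unique xs → a ∈ xs → ∑ xs (λ x → iv (x ≟ᴱ a) · f x) ≡ f a
      go (x ∷ xs) (x∉ ∷ u) (here refl) =
        trans (cong₂ _⊹_ (trans (cong (_· f a) (iv-yes (a ≟ᴱ a) refl)) (S.*-identityˡ _))
                (trans (∑-cong∈ xs (λ y y∈ → off y (λ y≡a → All.lookup x∉ y∈ (sym y≡a)))) (∑-0 xs)))
              (S.+-identityʳ _)
      go (x ∷ xs) (x∉ ∷ u) (there a∈) =
        trans (cong₂ _⊹_ (off x (All.lookup x∉ a∈)) (go xs u a∈)) (S.+-identityˡ _)

    ∑-point1 : ∀ a → ∑ (elems E) (λ x → iv (x ≟ᴱ a)) ≡ 1#
    ∑-point1 a = trans (∑-cong (elems E) (λ x → sym (S.*-identityʳ _))) (∑-point a (λ _ → 1#))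

    ∑-fibre : ∀ {B : Set} (xs : List B) (g : B → A) (f : B → R) →
              ∑ xs f ≡ ∑ (elems E) (λ a → ∑ xs (λ x → iv (a ≟ᴱ g x) · f x))
    ∑-fibre xs g f = trans (∑-cong xs (λ x → sym (∑-point (g x) (λ _ → f x)))) (∑-swap xs (elems E) _)

    ∑-reindex : (σ τ : A → A) → (∀ x → σ (τ x) ≡ x) → (∀ x → τ (σ x) ≡ x) → (f : A → R) →
                ∑ (elems E) (f ∘ σ) ≡ ∑ (elems E) f
    ∑-reindex σ τ στ τσ f = begin
      ∑ xs (λ x → f (σ x)) ≡⟨ ∑-cong xs (λ x → sym (∑-point (σ x) f)) ⟩
      ∑ xs (λ x → ∑ xs (λ y → iv (y ≟ᴱ σ x) · f y)) ≡⟨ ∑-swap xs xs _ ⟩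
      ∑ xs (λ y → ∑ xs (λ x → iv (y ≟ᴱ σ x) · f y))
        ≡⟨ ∑-cong xs (λ y → trans (∑-cong xs (λ x → cong (_· f y)
             (iv-cong (y ≟ᴱ σ x) (x ≟ᴱ τ y) (λ e → sym (trans (cong τ e) (τσ x))) (λ e → sym (trans (cong σ e) (στ y))))))
             (∑-point (τ y) (λ _ → f y))) ⟩
      ∑ xs f ∎
      where open ≡-Reasoning
            xs = elems E

open Sum +-*-isCommutativeSemiring public

card : {A : Set} → Enum A → ℕ
card E = ∑ (elems E) (λ _ → 1)

∑-const : ∀ {A : Set} (xs : List A) c → ∑ xs (λ _ → c) ≡ ∑ xs (λ _ → 1) * c
∑-const xs c = trans (∑-cong xs (λ _ → sym (*-identityˡ c))) (∑-*ʳ xs c (λ _ → 1))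

card-vec : ∀ {A : Set} (E : Enum A) n → card (vecEnum E n) ≡ card E ^ n
card-vec E zero = refl
card-vec E (suc n) = trans (∑-vec E n _) (trans (∑-const (elems E) _) (cong (card E *_) (card-vec E n)))

∑-1-length : ∀ {A : Set} (xs : List A) → ∑ xs (λ _ → 1) ≡ length xs
∑-1-length [] = refl
∑-1-length (x ∷ xs) = cong suc (∑-1-length xs)

card-fin : ∀ n → card (finEnum n) ≡ n
card-fin n = trans (∑-1-length (allFin n)) (length-tabulate {n = n} id)

iv≤1 : {P : Set} (d : Dec P) → iv d ≤ 1
iv≤1 (yes _) = ≤-refl
iv≤1 (no _) = z≤n

iv-× : {P Q : Set} (d : Dec P) (e : Dec Q) → iv (d ×-dec e) ≡ iv d * iv e
iv-× (yes p) (yes q) = refl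
iv-× (yes p) (no q) = refl
iv-× (no p) e = refl

module _ {A : Set} where
  ∑-mono∈ : ∀ (xs : List A) {f g : A → ℕ} → (∀ x → x ∈ xs → f x ≤ g x) → ∑ xs f ≤ ∑ xs g
  ∑-mono∈ [] h = z≤n
  ∑-mono∈ (x ∷ xs) h = +-mono-≤ (h x (here refl)) (∑-mono∈ xs (λ y y∈ → h y (there y∈)))

  ∑-mono : ∀ (xs : List A) {f g : A → ℕ} → (∀ x → f x ≤ g x) → ∑ xs f ≤ ∑ xs g
  ∑-mono xs h = ∑-mono∈ xs (λ x _ → h x)

  ∑-term : ∀ {xs : List A} (f : A → ℕ) {x} → x ∈ xs → f x ≤ ∑ xs f
  ∑-term f (here refl) = m≤m+n _ _
  ∑-term {y ∷ xs} f (there x∈) = ≤-trans (∑-term f x∈) (m≤n+m _ (f y))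

  ∑-positive : ∀ (xs : List A) (f : A → ℕ) → 1 ≤ ∑ xs f → ∃ λ x → x ∈ xs × 1 ≤ f x
  ∑-positive (x ∷ xs) f p with f x in e
  ... | suc m = x , here refl , subst (1 ≤_) (sym e) (s≤s z≤n)
  ... | zero with ∑-positive xs f p
  ...   | y , y∈ , q = y , there y∈ , q

  ∑-iv≤1 : ∀ {P : A → Set} (P? : ∀ x → Dec (P x)) xs → Unique xs →
           (∀ {x y} → P x → P y → x ≡ y) → ∑ xs (λ x → iv (P? x)) ≤ 1
  ∑-iv≤1 P? [] u h = z≤n
  ∑-iv≤1 P? (x ∷ xs) (x∉ ∷ u) h with P? x
  ... | no _ = ∑-iv≤1 P? xs u h
  ... | yes p = ≤-reflexive (cong suc (trans
        (∑-cong∈ xs (λ y y∈ → iv-no (P? y) (λ q → All.lookup x∉ y∈ (h p q)))) (∑-0 xs)))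

  -- Induction on the list; the cross term `2 * (a * b * P)` is bounded termwise by the inequality
  -- of arithmetic and geometric means.
  cauchy-schwarz : ∀ (xs : List A) (f g : A → ℕ) →
    ∑ xs (λ x → f x * g x) * ∑ xs (λ x → f x * g x) ≤ ∑ xs (λ x → f x * f x) * ∑ xs (λ x → g x * g x)
  cauchy-schwarz [] f g = z≤n
  cauchy-schwarz (x ∷ xs) f g = begin
    (a * b + P) * (a * b + P) ≡⟨ expand a b P ⟩
    a * b * (a * b) + 2 * (a * b * P) + P * P ≤⟨ +-mono-≤ (+-monoʳ-≤ (a * b * (a * b)) cross) ih ⟩
    a * b * (a * b) + (a * a * V + b * b * U) + U * V ≡⟨ collect a b U V ⟩
    (a * a + U) * (b * b + V) ∎
    where
    open ≤-Reasoning
    a = f x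
    b = g x
    P = ∑ xs (λ x → f x * g x)
    U = ∑ xs (λ x → f x * f x)
    V = ∑ xs (λ x → g x * g x)
    ih = cauchy-schwarz xs f g
    expand : ∀ a b P → (a * b + P) * (a * b + P) ≡ a * b * (a * b) + 2 * (a * b * P) + P * P
    expand = solve-∀
    collect : ∀ a b U V → a * b * (a * b) + (a * a * V + b * b * U) + U * V ≡ (a * a + U) * (b * b + V)
    collect = solve-∀
    am-gm : ∀ u v → 2 * (u * v) ≤ u * u + v * v
    am-gm u v with ≤-total u v
    ... | inj₁ u≤v = subst (λ v → 2 * (u * v) ≤ u * u + v * v) (m+[n∸m]≡n u≤v)
                       (≤-trans (m≤m+n _ ((v ∸ u) * (v ∸ u))) (≤-reflexive (lem u (v ∸ u))))
      where lem : ∀ u d → 2 * (u * (u + d)) + d * d ≡ u * u + (u + d) * (u + d)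
            lem = solve-∀
    ... | inj₂ v≤u = subst (λ u → 2 * (u * v) ≤ u * u + v * v) (m+[n∸m]≡n v≤u)
                       (≤-trans (m≤m+n _ ((u ∸ v) * (u ∸ v))) (≤-reflexive (lem v (u ∸ v))))
      where lem : ∀ v d → 2 * ((v + d) * v) + d * d ≡ (v + d) * (v + d) + v * v
            lem = solve-∀
    cross : 2 * (a * b * P) ≤ a * a * V + b * b * U
    cross = begin
      2 * (a * b * P) ≡⟨ cong (2 *_) (sym (∑-*ˡ xs (a * b) _)) ⟩
      2 * ∑ xs (λ y → a * b * (f y * g y)) ≡⟨ sym (∑-*ˡ xs 2 _) ⟩
      ∑ xs (λ y → 2 * (a * b * (f y * g y))) ≤⟨ ∑-mono xs (λ y → begin
          2 * (a * b * (f y * g y)) ≡⟨ r1 a b (f y) (g y) ⟩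
          2 * ((a * g y) * (b * f y)) ≤⟨ am-gm (a * g y) (b * f y) ⟩
          (a * g y) * (a * g y) + (b * f y) * (b * f y) ≡⟨ r2 a b (f y) (g y) ⟩
          a * a * (g y * g y) + b * b * (f y * f y) ∎) ⟩
      ∑ xs (λ y → a * a * (g y * g y) + b * b * (f y * f y)) ≡⟨ ∑-+ xs _ _ ⟩
      ∑ xs (λ y → a * a * (g y * g y)) + ∑ xs (λ y → b * b * (f y * f y))
        ≡⟨ cong₂ _+_ (∑-*ˡ xs (a * a) _) (∑-*ˡ xs (b * b) _) ⟩
      a * a * V + b * b * U ∎
      where
      r1 : ∀ a b s t → 2 * (a * b * (s * t)) ≡ 2 * ((a * t) * (b * s))
      r1 = solve-∀
      r2 : ∀ a b s t → (a * t) * (a * t) + (b * s) * (b * s) ≡ a * a * (t * t) + b * b * (s * s)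
      r2 = solve-∀

∑-injective : ∀ {A B : Set} (E : Enum A) (E' : Enum B) (φ : A → B) → (∀ {x y} → φ x ≡ φ y → x ≡ y) →
              (g : B → ℕ) → ∑ (elems E) (g ∘ φ) ≤ ∑ (elems E') g
∑-injective E E' φ inj g = begin
  ∑ (elems E) (g ∘ φ) ≡⟨ ∑-cong (elems E) (λ a → sym (∑-point E' (φ a) g)) ⟩
  ∑ (elems E) (λ a → ∑ (elems E') (λ b → iv (b ≟ᴱ φ a) * g b)) ≡⟨ ∑-swap (elems E) (elems E') _ ⟩
  ∑ (elems E') (λ b → ∑ (elems E) (λ a → iv (b ≟ᴱ φ a) * g b)) ≡⟨ ∑-cong (elems E') (λ b → ∑-*ʳ (elems E) (g b) _) ⟩
  ∑ (elems E') (λ b → ∑ (elems E) (λ a → iv (b ≟ᴱ φ a)) * g b) ≤⟨ ∑-mono (elems E') (λ b →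
     *-monoˡ-≤ (g b) (∑-iv≤1 (λ a → b ≟ᴱ φ a) (elems E) (Enum.unique E) (λ p q → inj (trans (sym p) q)))) ⟩
  ∑ (elems E') (λ b → 1 * g b) ≡⟨ ∑-cong (elems E') (λ b → *-identityˡ (g b)) ⟩
  ∑ (elems E') g ∎
  where open ≤-Reasoning
        open Enum E' using (_≟ᴱ_)

card-injective : ∀ {A B : Set} (E : Enum A) (E' : Enum B) (φ : A → B) → (∀ {x y} → φ x ≡ φ y → x ≡ y) → card E ≤ card E'
card-injective E E' φ inj = ∑-injective E E' φ inj (λ _ → 1)

-- Vector spaces over a finite field

-- A ring solver with integer coefficients; the pair (a , b) stands for the coefficient a - b.
module FieldSolver {q : ℕ} (F : FiniteField q) where
  ring : CommutativeRing 0ℓ 0ℓ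
  ring = record { isCommutativeRing = FiniteField.isCommutativeRing F }
  private
    module R = CommutativeRing ring
    open R using () renaming (_+_ to _⊹_; _*_ to _·_; -_ to ⊖_)
    open Algebra.Properties.Semiring.Mult R.semiring using (×-homo-+; ×1-homo-*) renaming (_×_ to _×ʳ_)
    open Algebra.Properties.Ring R.ring using (-‿distribˡ-*; -‿distribʳ-*; -‿+-comm; -‿involutive; -0#≈0#)

    coefficients : RawRing 0ℓ 0ℓ
    coefficients = record
      { Carrier = ℕ × ℕ ; _≈_ = _≡_
      ; _+_ = λ { (a , b) (c , d) → a + c , b + d }
      ; _*_ = λ { (a , b) (c , d) → a * c + b * d , a * d + b * c }
      ; -_ = λ { (a , b) → b , a }
      ; 0# = 0 , 0 ; 1# = 1 , 0 }

    ⟦_⟧ᶜ : ℕ × ℕ → Fin q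
    ⟦ a , b ⟧ᶜ = (a ×ʳ R.1#) ⊹ (⊖ (b ×ʳ R.1#))

    -- Agrees with ⟦_⟧ᶜ, but the constants 0 and 1 compute to 0# and 1#.
    ⟦_⟧ : ℕ × ℕ → Fin q
    ⟦ 0 , 0 ⟧ = R.0#
    ⟦ 1 , 0 ⟧ = R.1#
    ⟦ x ⟧ = ⟦ x ⟧ᶜ

    ⟦⟧≡ : ∀ x → ⟦ x ⟧ ≡ ⟦ x ⟧ᶜ
    ⟦⟧≡ (0 , 0) = sym (R.-‿inverseʳ _)
    ⟦⟧≡ (1 , 0) = sym (trans (cong₂ _⊹_ (R.+-identityʳ _) -0#≈0#) (R.+-identityʳ _))
    ⟦⟧≡ (0 , suc b) = refl
    ⟦⟧≡ (1 , suc b) = refl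
    ⟦⟧≡ (suc (suc a) , b) = refl

    interchange : ∀ a b c d → (a ⊹ b) ⊹ (c ⊹ d) ≡ (a ⊹ c) ⊹ (b ⊹ d)
    interchange a b c d = trans (R.+-assoc a b _) (trans (cong (a ⊹_)
        (trans (sym (R.+-assoc b c d)) (trans (cong (_⊹ d) (R.+-comm b c)) (R.+-assoc c b d))))
        (sym (R.+-assoc a c _)))

    ⟦⟧-+ : ∀ x y → ⟦ RawRing._+_ coefficients x y ⟧ᶜ ≡ ⟦ x ⟧ᶜ ⊹ ⟦ y ⟧ᶜ
    ⟦⟧-+ (a , b) (c , d) = trans (cong₂ _⊹_ (×-homo-+ R.1# a c)
      (trans (cong ⊖_ (×-homo-+ R.1# b d)) (sym (-‿+-comm _ _)))) (interchange _ _ _ _)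

    difference-* : ∀ a b c d → (a · c ⊹ b · d) ⊹ (⊖ (a · d ⊹ b · c)) ≡ (a ⊹ ⊖ b) · (c ⊹ ⊖ d)
    difference-* a b c d = begin
      (a · c ⊹ b · d) ⊹ (⊖ (a · d ⊹ b · c)) ≡⟨ cong ((a · c ⊹ b · d) ⊹_) (sym (-‿+-comm _ _)) ⟩
      (a · c ⊹ b · d) ⊹ (⊖ (a · d) ⊹ ⊖ (b · c)) ≡⟨ interchange _ _ _ _ ⟩
      (a · c ⊹ ⊖ (a · d)) ⊹ (b · d ⊹ ⊖ (b · c)) ≡⟨ cong₂ _⊹_ (cong (a · c ⊹_) (-‿distribʳ-* a d))
          (trans (R.+-comm _ _) (cong₂ _⊹_ (-‿distribˡ-* b c)
             (trans (sym (-‿involutive (b · d))) (trans (cong ⊖_ (-‿distribˡ-* b d)) (-‿distribʳ-* (⊖ b) d))))) ⟩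
      (a · c ⊹ a · ⊖ d) ⊹ ((⊖ b) · c ⊹ (⊖ b) · ⊖ d) ≡⟨ sym (cong₂ _⊹_ (R.distribˡ a c (⊖ d)) (R.distribˡ (⊖ b) c (⊖ d))) ⟩
      a · (c ⊹ ⊖ d) ⊹ (⊖ b) · (c ⊹ ⊖ d) ≡⟨ sym (R.distribʳ (c ⊹ ⊖ d) a (⊖ b)) ⟩
      (a ⊹ ⊖ b) · (c ⊹ ⊖ d) ∎
      where open ≡-Reasoning

    ⟦⟧-* : ∀ x y → ⟦ RawRing._*_ coefficients x y ⟧ᶜ ≡ ⟦ x ⟧ᶜ · ⟦ y ⟧ᶜ
    ⟦⟧-* (a , b) (c , d) = trans
      (cong₂ (λ u v → u ⊹ ⊖ v)
        (trans (×-homo-+ R.1# (a * c) (b * d)) (cong₂ _⊹_ (×1-homo-* a c) (×1-homo-* b d)))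
        (trans (×-homo-+ R.1# (a * d) (b * c)) (cong₂ _⊹_ (×1-homo-* a d) (×1-homo-* b c))))
      (difference-* _ _ _ _)

    ⟦⟧-neg : ∀ x → ⟦ RawRing.-_ coefficients x ⟧ᶜ ≡ ⊖ ⟦ x ⟧ᶜ
    ⟦⟧-neg (a , b) = trans (R.+-comm _ _)
      (trans (cong (⊖ (a ×ʳ R.1#) ⊹_) (sym (-‿involutive _))) (-‿+-comm _ _))

    target : ACR.AlmostCommutativeRing 0ℓ 0ℓ
    target = ACR.fromCommutativeRing ring

    morphism : coefficients ACR.-Raw-AlmostCommutative⟶ target
    morphism = record
      { ⟦_⟧ = ⟦_⟧
      ; +-homo = λ x y → trans (⟦⟧≡ (RawRing._+_ coefficients x y)) (trans (⟦⟧-+ x y) (sym (cong₂ _⊹_ (⟦⟧≡ x) (⟦⟧≡ y))))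
      ; *-homo = λ x y → trans (⟦⟧≡ (RawRing._*_ coefficients x y)) (trans (⟦⟧-* x y) (sym (cong₂ _·_ (⟦⟧≡ x) (⟦⟧≡ y))))
      ; -‿homo = λ x → trans (⟦⟧≡ (RawRing.-_ coefficients x)) (trans (⟦⟧-neg x) (sym (cong ⊖_ (⟦⟧≡ x))))
      ; 0-homo = refl
      ; 1-homo = refl }

    same-difference : ∀ x y → Maybe (⟦ x ⟧ ≡ ⟦ y ⟧)
    same-difference (a , b) (c , d) with a + d ≟ c + b
    ... | no _ = nothing
    ... | yes e = just (begin
      ⟦ a , b ⟧ ≡⟨ ⟦⟧≡ (a , b) ⟩
      A ⊹ ⊖ B ≡⟨ cong (_⊹ ⊖ B) (sym (R.+-identityʳ A)) ⟩
      (A ⊹ R.0#) ⊹ ⊖ B ≡⟨ cong (λ z → (A ⊹ z) ⊹ ⊖ B) (sym (R.-‿inverseʳ D)) ⟩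
      (A ⊹ (D ⊹ ⊖ D)) ⊹ ⊖ B ≡⟨ cong (_⊹ ⊖ B) (sym (R.+-assoc A D (⊖ D))) ⟩
      ((A ⊹ D) ⊹ ⊖ D) ⊹ ⊖ B ≡⟨ cong (λ z → (z ⊹ ⊖ D) ⊹ ⊖ B)
          (trans (sym (×-homo-+ R.1# a d)) (trans (cong (_×ʳ R.1#) e) (×-homo-+ R.1# c b))) ⟩
      ((C ⊹ B) ⊹ ⊖ D) ⊹ ⊖ B ≡⟨ cong (_⊹ ⊖ B) (trans (R.+-assoc C B (⊖ D)) (trans (cong (C ⊹_) (R.+-comm B (⊖ D))) (sym (R.+-assoc C (⊖ D) B)))) ⟩
      ((C ⊹ ⊖ D) ⊹ B) ⊹ ⊖ B ≡⟨ R.+-assoc _ B (⊖ B) ⟩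
      (C ⊹ ⊖ D) ⊹ (B ⊹ ⊖ B) ≡⟨ cong ((C ⊹ ⊖ D) ⊹_) (R.-‿inverseʳ B) ⟩
      (C ⊹ ⊖ D) ⊹ R.0# ≡⟨ R.+-identityʳ _ ⟩
      C ⊹ ⊖ D ≡⟨ sym (⟦⟧≡ (c , d)) ⟩
      ⟦ c , d ⟧ ∎)
      where
      open ≡-Reasoning
      A = a ×ʳ R.1#
      B = b ×ʳ R.1#
      C = c ×ʳ R.1#
      D = d ×ʳ R.1#
  open Algebra.Solver.Ring coefficients target morphism same-difference public
    using (solve; _:=_; _:+_; _:*_; :-_; Polynomial; con)

  :0 :1 : ∀ {n} → Polynomial n
  :0 = con (0 , 0)
  :1 = con (1 , 0)

module Geometry {q : ℕ} (F : FiniteField q) where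
  open FiniteField F public using () renaming (_+_ to _+ᶠ_; _*_ to _*ᶠ_; -_ to -ᶠ_; 0# to 0ᶠ; 1# to 1ᶠ; 0≢1 to 0≢1ᶠ; inverse to inverseᶠ)
  open FieldSolver F public
  module R = CommutativeRing ring

  infixl 6 _⊞_
  infixl 7 _⊡_
  _⊞_ : ∀ {n} → Pt F n → Pt F n → Pt F n
  _⊞_ = _⊕_ F
  _⊡_ : ∀ {n} → Fin q → Pt F n → Pt F n
  _⊡_ = _⊙_ F
  𝟎 : ∀ {n} → Pt F n
  𝟎 {n} = zeroV F n

  _≟ᶠ_ = Fin._≟_ {q}

  Fs : Enum (Fin q)
  Fs = finEnum q
  Gs : ∀ n → Enum (Pt F n)
  Gs = vecEnum Fs

  _≟ᵛ_ : ∀ {n} (x y : Pt F n) → Dec (x ≡ y)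
  _≟ᵛ_ {n} = Enum._≟ᴱ_ (Gs n)

  ΣF : (Fin q → ℕ) → ℕ
  ΣF = ∑ (elems Fs)
  ΣG : ∀ {n} → (Pt F n → ℕ) → ℕ
  ΣG {n} = ∑ (elems (Gs n))

  card-F : card Fs ≡ q
  card-F = card-fin q
  card-G : ∀ n → card (Gs n) ≡ q ^ n
  card-G n = trans (card-vec Fs n) (cong (_^ n) card-F)

  2≤q : 2 ≤ q
  2≤q = go q 0ᶠ 1ᶠ 0≢1ᶠ
    where
    go : ∀ q (x y : Fin q) → x ≢ y → 2 ≤ q
    go (suc zero) fzero fzero h = contradiction refl h
    go (suc (suc q)) _ _ _ = s≤s (s≤s z≤n)

  *-≢0 : ∀ {a b} → a ≢ 0ᶠ → b ≢ 0ᶠ → a *ᶠ b ≢ 0ᶠ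
  *-≢0 {a} {b} a≢0 b≢0 ab≡0 with inverseᶠ a a≢0
  ... | a' , aa'≡1 = b≢0 (begin
    b ≡⟨ sym (R.*-identityˡ b) ⟩
    1ᶠ *ᶠ b ≡⟨ cong (_*ᶠ b) (sym aa'≡1) ⟩
    (a *ᶠ a') *ᶠ b ≡⟨ solve 3 (λ a a' b → (a :* a') :* b := a' :* (a :* b)) refl a a' b ⟩
    a' *ᶠ (a *ᶠ b) ≡⟨ cong (a' *ᶠ_) ab≡0 ⟩
    a' *ᶠ 0ᶠ ≡⟨ R.zeroʳ a' ⟩
    0ᶠ ∎)
    where open ≡-Reasoning

  -≢0 : ∀ {a} → a ≢ 0ᶠ → -ᶠ a ≢ 0ᶠ
  -≢0 {a} a≢0 e = a≢0 (trans (solve 1 (λ a → a := :- (:- a)) refl a)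
    (trans (cong -ᶠ_ e) (solve 0 (:- :0 := :0) refl)))

  inv : ∀ a → a ≢ 0ᶠ → Fin q
  inv a h = proj₁ (inverseᶠ a h)
  inv-l : ∀ a (h : a ≢ 0ᶠ) → inv a h *ᶠ a ≡ 1ᶠ
  inv-l a h = trans (R.*-comm _ a) (proj₂ (inverseᶠ a h))
  inv-r : ∀ a (h : a ≢ 0ᶠ) → a *ᶠ inv a h ≡ 1ᶠ
  inv-r a h = proj₂ (inverseᶠ a h)

  ⊞-comm : ∀ {n} (x y : Pt F n) → x ⊞ y ≡ y ⊞ x
  ⊞-comm = Vec.zipWith-comm R.+-comm
  ⊞-assoc : ∀ {n} (x y z : Pt F n) → (x ⊞ y) ⊞ z ≡ x ⊞ (y ⊞ z)
  ⊞-assoc = Vec.zipWith-assoc R.+-assoc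
  ⊞-identityˡ : ∀ {n} (x : Pt F n) → 𝟎 ⊞ x ≡ x
  ⊞-identityˡ = Vec.zipWith-identityˡ R.+-identityˡ
  ⊞-identityʳ : ∀ {n} (x : Pt F n) → x ⊞ 𝟎 ≡ x
  ⊞-identityʳ = Vec.zipWith-identityʳ R.+-identityʳ
  ⊡-distribˡ : ∀ {n} c (x y : Pt F n) → c ⊡ (x ⊞ y) ≡ c ⊡ x ⊞ c ⊡ y
  ⊡-distribˡ c [] [] = refl
  ⊡-distribˡ c (a ∷ x) (b ∷ y) = cong₂ _∷_ (R.distribˡ c a b) (⊡-distribˡ c x y)
  ⊡-distribʳ : ∀ {n} c d (x : Pt F n) → (c +ᶠ d) ⊡ x ≡ c ⊡ x ⊞ d ⊡ x
  ⊡-distribʳ c d [] = refl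
  ⊡-distribʳ c d (a ∷ x) = cong₂ _∷_ (R.distribʳ a c d) (⊡-distribʳ c d x)
  ⊡-assoc : ∀ {n} c d (x : Pt F n) → (c *ᶠ d) ⊡ x ≡ c ⊡ (d ⊡ x)
  ⊡-assoc c d [] = refl
  ⊡-assoc c d (a ∷ x) = cong₂ _∷_ (R.*-assoc c d a) (⊡-assoc c d x)
  ⊡-identity : ∀ {n} (x : Pt F n) → 1ᶠ ⊡ x ≡ x
  ⊡-identity [] = refl
  ⊡-identity (a ∷ x) = cong₂ _∷_ (R.*-identityˡ a) (⊡-identity x)
  ⊡-zeroˡ : ∀ {n} (x : Pt F n) → 0ᶠ ⊡ x ≡ 𝟎
  ⊡-zeroˡ [] = refl
  ⊡-zeroˡ (a ∷ x) = cong₂ _∷_ (R.zeroˡ a) (⊡-zeroˡ x)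
  ⊡-zeroʳ : ∀ {n} c → c ⊡ 𝟎 {n} ≡ 𝟎
  ⊡-zeroʳ {zero} c = refl
  ⊡-zeroʳ {suc n} c = cong₂ _∷_ (R.zeroʳ c) (⊡-zeroʳ c)

  ⊟_ : ∀ {n} → Pt F n → Pt F n
  ⊟ x = (-ᶠ 1ᶠ) ⊡ x
  ⊞-inverseʳ : ∀ {n} (x : Pt F n) → x ⊞ ⊟ x ≡ 𝟎
  ⊞-inverseʳ [] = refl
  ⊞-inverseʳ (a ∷ x) = cong₂ _∷_ (solve 1 (λ a → a :+ (:- :1) :* a := :0) refl a) (⊞-inverseʳ x)

any-elem : ∀ {A : Set} (E : Enum A) {P : A → Set} → (∀ x → Dec (P x)) → Dec (∃ P)
any-elem E P? with any? P? (elems E)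
... | yes p = let (x , _ , px) = find p in yes (x , px)
... | no ¬p = no (λ { (x , px) → ¬p (lose (Enum.complete E x) px) })

module _ {A : Set} where
  ∈-ʳ++⁺ʳ : ∀ pre {post : List A} {x} → x ∈ post → x ∈ pre ʳ++ post
  ∈-ʳ++⁺ʳ [] h = h
  ∈-ʳ++⁺ʳ (p ∷ pre) h = ∈-ʳ++⁺ʳ pre (there h)

  ∈-ʳ++⁺ˡ : ∀ pre {post : List A} {x} → x ∈ pre → x ∈ pre ʳ++ post
  ∈-ʳ++⁺ˡ (p ∷ pre) (here refl) = ∈-ʳ++⁺ʳ pre (here refl)
  ∈-ʳ++⁺ˡ (p ∷ pre) (there h) = ∈-ʳ++⁺ˡ pre h

  unique-ʳ++⁻ : ∀ pre {post : List A} → Unique (pre ʳ++ post) →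
                Unique post × (∀ {x y} → x ∈ pre → y ∈ post → x ≢ y)
  unique-ʳ++⁻ [] u = u , (λ ())
  unique-ʳ++⁻ (p ∷ pre) u with unique-ʳ++⁻ pre u
  ... | (p∉ ∷ u') , h = u' , λ { (here refl) y∈ → All.lookup p∉ y∈ ; (there x∈) y∈ → h x∈ (there y∈) }

module LinearAlgebra {q : ℕ} (F : FiniteField q) where
  open Geometry F

  module FS = Sum R.isCommutativeSemiring

  -- In the application `X` consists of points and `col` sends a point to its vector of low-degree
  -- monomial values, so a linear dependency can be read back as a functional supported on points.
  module Span {X : Set} {r : ℕ} (col : X → Pt F r) where
    comb : (ps : List X) → Pt F (length ps) → Pt F r
    comb [] [] = 𝟎
    comb (p ∷ ps) (k ∷ ks) = k ⊡ col p ⊞ comb ps ks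

    InSpan : List X → Pt F r → Set
    InSpan ps v = ∃ λ ks → comb ps ks ≡ v

    inSpan? : ∀ ps v → Dec (InSpan ps v)
    inSpan? ps v = any-elem (Gs (length ps)) (λ ks → comb ps ks ≟ᵛ v)

    Independent : List X → Set
    Independent ps = ∀ ks → comb ps ks ≡ 𝟎 → ks ≡ 𝟎

    _⊑_ : List X → List X → Set
    ps ⊑ qs = ∀ ks → InSpan qs (comb ps ks)

    comb-+ : ∀ ps ks ls → comb ps (ks ⊞ ls) ≡ comb ps ks ⊞ comb ps ls
    comb-+ [] [] [] = sym (⊞-identityˡ 𝟎)
    comb-+ (p ∷ ps) (k ∷ ks) (l ∷ ls) = trans (cong ((k +ᶠ l) ⊡ col p ⊞_) (comb-+ ps ks ls)) (lem k l (col p) _ _)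
      where
      lem : ∀ {n} k l (a b c : Pt F n) → (k +ᶠ l) ⊡ a ⊞ (b ⊞ c) ≡ (k ⊡ a ⊞ b) ⊞ (l ⊡ a ⊞ c)
      lem k l [] [] [] = refl
      lem k l (a ∷ as) (b ∷ bs) (c ∷ cs) = cong₂ _∷_
        (solve 5 (λ k l a b c → (k :+ l) :* a :+ (b :+ c) := (k :* a :+ b) :+ (l :* a :+ c)) refl k l a b c)
        (lem k l as bs cs)

    comb-⊡ : ∀ ps c ks → comb ps (c ⊡ ks) ≡ c ⊡ comb ps ks
    comb-⊡ [] c [] = sym (⊡-zeroʳ c)
    comb-⊡ (p ∷ ps) c (k ∷ ks) = trans (cong₂ _⊞_ (⊡-assoc c k (col p)) (comb-⊡ ps c ks)) (sym (⊡-distribˡ c _ _))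

    comb-injective : ∀ ps → Independent ps → ∀ {ks ls} → comb ps ks ≡ comb ps ls → ks ≡ ls
    comb-injective ps ind {ks} {ls} e = begin
      ks ≡⟨ sym (⊞-identityˡ ks) ⟩
      𝟎 ⊞ ks ≡⟨ cong (_⊞ ks) (sym (ind (ls ⊞ ⊟ ks) zero-comb)) ⟩
      (ls ⊞ ⊟ ks) ⊞ ks ≡⟨ lem ls ks ⟩
      ls ∎
      where
      open ≡-Reasoning
      lem : ∀ {n} (a b : Pt F n) → (a ⊞ ⊟ b) ⊞ b ≡ a
      lem [] [] = refl
      lem (a ∷ as) (b ∷ bs) = cong₂ _∷_ (solve 2 (λ a b → (a :+ (:- :1) :* b) :+ b := a) refl a b) (lem as bs)
      zero-comb : comb ps (ls ⊞ ⊟ ks) ≡ 𝟎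
      zero-comb = trans (comb-+ ps ls (⊟ ks)) (trans (cong₂ _⊞_ (sym e) (comb-⊡ ps _ ks)) (⊞-inverseʳ _))

    -- The combinations of an independent list are `q ^ length ps` distinct vectors among `q ^ r`;
    -- dimensions are compared by counting, without elimination.
    independent-length : ∀ ps → Independent ps → length ps ≤ r
    independent-length ps ind = ≮⇒≥ λ r< → <⇒≱ (^-monoʳ-< q 2≤q r<)
      (subst₂ _≤_ (card-G (length ps)) (card-G r) (card-injective (Gs (length ps)) (Gs r) (comb ps) (comb-injective ps ind)))

    extend-independent : ∀ c ps qs → ¬ InSpan qs (col c) → ps ⊑ qs → Independent ps → Independent (c ∷ ps)
    extend-independent c ps qs c∉ ps⊑qs ind (k ∷ ks) e with k ≟ᶠ 0ᶠ
    ... | yes refl = cong (0ᶠ ∷_) (ind ks (trans (sym (trans (cong (_⊞ comb ps ks) (⊡-zeroˡ (col c))) (⊞-identityˡ _))) e))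
    ... | no k≢0 = contradiction
            (subst (InSpan qs) (trans (comb-⊡ ps _ ks) (lem (inv k k≢0) k (col c) (comb ps ks) (inv-l k k≢0) e))
              (ps⊑qs ((-ᶠ inv k k≢0) ⊡ ks))) c∉
      where
      lem : ∀ {n} k' k (a b : Pt F n) → k' *ᶠ k ≡ 1ᶠ → k ⊡ a ⊞ b ≡ 𝟎 → (-ᶠ k') ⊡ b ≡ a
      lem k' k [] [] h e = refl
      lem k' k (a ∷ as) (b ∷ bs) h e = cong₂ _∷_
        (begin
          (-ᶠ k') *ᶠ b ≡⟨ solve 4 (λ k' k a b → (:- k') :* b := (k' :* k) :* a :+ (:- k') :* (k :* a :+ b)) refl k' k a b ⟩
          (k' *ᶠ k) *ᶠ a +ᶠ (-ᶠ k') *ᶠ (k *ᶠ a +ᶠ b) ≡⟨ cong₂ (λ u v → u *ᶠ a +ᶠ (-ᶠ k') *ᶠ v) h (Vec.∷-injectiveˡ e) ⟩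
          1ᶠ *ᶠ a +ᶠ (-ᶠ k') *ᶠ 0ᶠ ≡⟨ solve 2 (λ a k' → :1 :* a :+ (:- k') :* :0 := a) refl a k' ⟩
          a ∎)
        (lem k' k as bs h (Vec.∷-injectiveʳ e))
        where open ≡-Reasoning

    ⊑-extend : ∀ c ps qs → ps ⊑ qs → ps ⊑ (c ∷ qs)
    ⊑-extend c ps qs h ks with h ks
    ... | ls , e = 0ᶠ ∷ ls , trans (cong (_⊞ comb qs ls) (⊡-zeroˡ (col c))) (trans (⊞-identityˡ _) e)

    ⊑-cons : ∀ c ps qs → ps ⊑ qs → (c ∷ ps) ⊑ (c ∷ qs)
    ⊑-cons c ps qs h (k ∷ ks) with h ks
    ... | ls , e = k ∷ ls , cong (k ⊡ col c ⊞_) e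

    Pivot : List X → Set
    Pivot whole = ∃ λ pre → ∃ λ c → ∃ λ post →
      whole ≡ pre ʳ++ (c ∷ post) × InSpan pre (col c) × InSpan post (col c)

    private
      -- Elements outside the span of their predecessors are collected in I₂, those outside the
      -- span of their successors in I₁; both lists are independent.
      scan : ∀ pre post I₂ → Independent I₂ → I₂ ⊑ pre →
             Pivot (pre ʳ++ post) ⊎ (∃ λ I₁ → ∃ λ I₂' → Independent I₁ × I₁ ⊑ post × Independent I₂' ×
               length post + length I₂ ≤ length I₁ + length I₂')
      scan pre [] I₂ ind sub = inj₂ ([] , I₂ , (λ { [] _ → refl }) , (λ { [] → [] , refl }) , ind , ≤-refl)
      scan pre (c ∷ post) I₂ ind sub with inSpan? pre (col c)
      ... | no c∉ with scan (c ∷ pre) post (c ∷ I₂) (extend-independent c I₂ pre c∉ sub ind) (⊑-cons c I₂ pre sub)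
      ...   | inj₁ p = inj₁ p
      ...   | inj₂ (I₁ , I₂' , i₁ , s₁ , i₂ , le) =
                inj₂ (I₁ , I₂' , i₁ , ⊑-extend c I₁ post s₁ , i₂ , ≤-trans (≤-reflexive (sym (+-suc _ _))) le)
      scan pre (c ∷ post) I₂ ind sub | yes c∈ with inSpan? post (col c)
      ...   | yes c∈' = inj₁ (pre , c , post , refl , c∈ , c∈')
      ...   | no c∉' with scan (c ∷ pre) post I₂ ind (⊑-extend c I₂ pre sub)
      ...     | inj₁ p = inj₁ p
      ...     | inj₂ (I₁ , I₂' , i₁ , s₁ , i₂ , le) =
                  inj₂ (c ∷ I₁ , I₂' , extend-independent c I₁ post c∉' s₁ i₁ , ⊑-cons c I₁ post s₁ , i₂ , s≤s le)

    -- Without a pivot, every element enters one of two independent lists, each of length at most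
    -- `r`.
    pivot : ∀ ps → 2 * r < length ps → Pivot ps
    pivot ps 2r< with scan [] ps [] (λ { [] _ → refl }) (λ { [] → [] , refl })
    ... | inj₁ p = p
    ... | inj₂ (I₁ , I₂ , i₁ , _ , i₂ , le) = contradiction 2r<
            (≤⇒≯ (≤-trans (≤-trans (≤-reflexive (sym (+-identityʳ _))) le)
              (≤-trans (+-mono-≤ (independent-length I₁ i₁) (independent-length I₂ i₂)) (≤-reflexive (cong (r +_) (sym (+-identityʳ r)))))))

  -- The field `ext` is part of the notion because functions that agree pointwise are not provably
  -- equal.
  record Linear {X : Set} (Λ : (X → Fin q) → Fin q) : Set where
    field
      ext : ∀ {f g} → (∀ x → f x ≡ g x) → Λ f ≡ Λ g
      add : ∀ f g → Λ (λ x → f x +ᶠ g x) ≡ Λ f +ᶠ Λ g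
      scale : ∀ c f → Λ (λ x → c *ᶠ f x) ≡ c *ᶠ Λ f

  eval : ∀ {X : Set} → List (Fin q × X) → (X → Fin q) → Fin q
  eval ws f = FS.∑ ws (λ { (c , x) → c *ᶠ f x })

  eval-linear : ∀ {X : Set} (ws : List (Fin q × X)) → Linear (eval ws)
  eval-linear ws = record
    { ext = λ h → FS.∑-cong ws (λ { (c , x) → cong (c *ᶠ_) (h x) })
    ; add = λ f g → trans (FS.∑-cong ws (λ { (c , x) → R.distribˡ c (f x) (g x) })) (FS.∑-+ ws _ _)
    ; scale = λ c f → trans (FS.∑-cong ws (λ { (d , x) → solve 3 (λ d c y → d :* (c :* y) := c :* (d :* y)) refl d c (f x) }))
                            (FS.∑-*ˡ ws c _) }

  compose-linear : ∀ {X Y : Set} {Λ : (X → Fin q) → Fin q} {M : (Y → Fin q) → Fin q} → Linear Λ → Linear M →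
                   Linear {X × Y} (λ f → Λ (λ x → M (λ y → f (x , y))))
  compose-linear L M = record
    { ext = λ h → L.ext (λ x → M.ext (λ y → h (x , y)))
    ; add = λ f g → trans (L.ext (λ x → M.add _ _)) (L.add _ _)
    ; scale = λ c f → trans (L.ext (λ x → M.scale _ _)) (L.scale _ _) }
    where module L = Linear L
          module M = Linear M

-- The polynomial method

module PolynomialMethod {q : ℕ} (F : FiniteField q) where
  open Geometry F
  open LinearAlgebra F

  nonzero : List (Fin q)
  nonzero = filter (λ a → ¬? (a ≟ᶠ 0ᶠ)) (allFin q)

  nonzero-length : length nonzero ≤ pred q
  nonzero-length = pred-mono-≤ (subst (length nonzero <_) (length-tabulate {n = q} id)
    (filter-notAll (λ a → ¬? (a ≟ᶠ 0ᶠ)) (allFin q) (lose (∈-allFin 0ᶠ) (λ h → h refl))))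

  _^ᶠ_ : Fin q → ℕ → Fin q
  x ^ᶠ zero = 1ᶠ
  x ^ᶠ suc e = x *ᶠ x ^ᶠ e

  monomial : ∀ {m} → Vec ℕ m → Pt F m → Fin q
  monomial [] [] = 1ᶠ
  monomial (e ∷ es) (x ∷ xs) = (x ^ᶠ e) *ᶠ monomial es xs

  -- The polynomial with roots `as`. For the list of all nonzero elements it vanishes exactly where
  -- 1 - c^(q-1) does, and it comes as a product of linear factors that can be expanded one at a
  -- time.
  roots : List (Fin q) → Fin q → Fin q
  roots [] c = 1ᶠ
  roots (a ∷ as) c = (c +ᶠ -ᶠ a) *ᶠ roots as c

  roots-zero : ∀ as {c} → c ∈ as → roots as c ≡ 0ᶠ
  roots-zero (a ∷ as) (here refl) = trans (cong (_*ᶠ roots as a) (R.-‿inverseʳ a)) (R.zeroˡ _)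
  roots-zero (a ∷ as) (there h) = trans (cong (_ *ᶠ_) (roots-zero as h)) (R.zeroʳ _)

  roots-nonzero : ∀ as → All (_≢ 0ᶠ) as → roots as 0ᶠ ≢ 0ᶠ
  roots-nonzero [] [] e = 0≢1ᶠ (sym e)
  roots-nonzero (a ∷ as) (a≢0 ∷ h) = *-≢0 (λ e → -≢0 a≢0 (trans (sym (R.+-identityˡ _)) e)) (roots-nonzero as h)

  nonzero-≢0 : All (_≢ 0ᶠ) nonzero
  nonzero-≢0 = All.tabulate (λ a∈ → proj₂ (∈-filter⁻ (λ a → ¬? (a ≟ᶠ 0ᶠ)) {xs = allFin q} a∈))

  -- The exponents of x, y and z in a single coordinate of a monomial of `tensor`; the bound is the
  -- number of linear factors of `roots nonzero`.
  record Exponents : Set where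
    constructor exponents
    field
      e f g : ℕ
      bound : e + f + g ≤ pred q
  open Exponents

  module _ (α β γ : Fin q) where
    form : Fin q → Fin q → Fin q → Fin q
    form x y z = (α *ᶠ x +ᶠ β *ᶠ y) +ᶠ γ *ᶠ z

    -- A nonzero constant times the indicator function of α x + β y + γ z = 0.
    tensor : ∀ {m} → Pt F m × Pt F m × Pt F m → Fin q
    tensor ([] , [] , []) = 1ᶠ
    tensor (x ∷ xs , y ∷ ys , z ∷ zs) = roots nonzero (form x y z) *ᶠ tensor (xs , ys , zs)

    monomial₃ : ∀ {m} → Vec Exponents m → Pt F m × Pt F m × Pt F m → Fin q
    monomial₃ es (x , y , z) =
      (monomial (Vec.map e es) x *ᶠ monomial (Vec.map f es) y) *ᶠ monomial (Vec.map g es) z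

    tensor-zero : ∀ {m} (x y z : Pt F m) → α ⊡ x ⊞ β ⊡ y ⊞ γ ⊡ z ≢ 𝟎 → tensor (x , y , z) ≡ 0ᶠ
    tensor-zero [] [] [] h = contradiction refl h
    tensor-zero (x ∷ xs) (y ∷ ys) (z ∷ zs) h with form x y z ≟ᶠ 0ᶠ
    ... | yes e = trans (cong (_ *ᶠ_) (tensor-zero xs ys zs (λ e' → h (cong₂ _∷_ e e')))) (R.zeroʳ _)
    ... | no ne = trans (cong (_*ᶠ _) (roots-zero nonzero
                    (∈-filter⁺ (λ a → ¬? (a ≟ᶠ 0ᶠ)) (∈-allFin (form x y z)) ne))) (R.zeroˡ _)

    tensor-nonzero : ∀ {m} (x y z : Pt F m) → α ⊡ x ⊞ β ⊡ y ⊞ γ ⊡ z ≡ 𝟎 → tensor (x , y , z) ≢ 0ᶠ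
    tensor-nonzero [] [] [] h e = 0≢1ᶠ (sym e)
    tensor-nonzero (x ∷ xs) (y ∷ ys) (z ∷ zs) h =
      *-≢0 (λ e → roots-nonzero nonzero nonzero-≢0 (trans (cong (roots nonzero) (sym (Vec.∷-injectiveˡ h))) e))
           (tensor-nonzero xs ys zs (Vec.∷-injectiveʳ h))

    -- The polynomial is never written as a sum of monomials. Instead linearity of Λ removes the
    -- linear factors one at a time in `block`, each either raising one exponent by one or
    -- contributing a constant, so that exponents plus remaining factors never exceed `pred q`; then
    -- the next coordinate follows.
    tensor-vanishes : ∀ m (Λ : (Pt F m × Pt F m × Pt F m → Fin q) → Fin q) → Linear Λ →
                      (∀ es → Λ (monomial₃ es) ≡ 0ᶠ) → Λ tensor ≡ 0ᶠ
    tensor-vanishes zero Λ L h = trans (ext (λ { ([] , [] , []) → sym (trans (R.*-identityʳ _) (R.*-identityʳ _)) })) (h [])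
      where open Linear L
    tensor-vanishes (suc m) Λ L h =
      trans (ext (λ { (x ∷ xs , y ∷ ys , z ∷ zs) →
        solve 2 (λ t T → t :* T := ((:1 :* :1) :* :1) :* (t :* T)) refl (roots nonzero (form x y z)) (tensor (xs , ys , zs)) }))
        (block nonzero 0 0 0 nonzero-length)
      where
      open Linear L
      times : ℕ → ℕ → ℕ → (Fin q → Fin q) → (Pt F m × Pt F m × Pt F m → Fin q) →
              Pt F (suc m) × Pt F (suc m) × Pt F (suc m) → Fin q
      times e f g t p (x ∷ xs , y ∷ ys , z ∷ zs) =
        ((x ^ᶠ e *ᶠ y ^ᶠ f) *ᶠ z ^ᶠ g) *ᶠ (t (form x y z) *ᶠ p (xs , ys , zs))
      block : ∀ as e f g → e + f + g + length as ≤ pred q → Λ (times e f g (roots as) tensor) ≡ 0ᶠ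
      block [] e f g le = tensor-vanishes m (λ p → Λ (times e f g (λ _ → 1ᶠ) p)) record
          { ext = λ k → ext (λ { (x ∷ xs , y ∷ ys , z ∷ zs) → cong (λ v → _ *ᶠ (1ᶠ *ᶠ v)) (k (xs , ys , zs)) })
          ; add = λ u v → trans (ext (λ { (x ∷ xs , y ∷ ys , z ∷ zs) →
              solve 3 (λ c u v → c :* (:1 :* (u :+ v)) := c :* (:1 :* u) :+ c :* (:1 :* v)) refl ((x ^ᶠ e *ᶠ y ^ᶠ f) *ᶠ z ^ᶠ g) (u (xs , ys , zs)) (v (xs , ys , zs)) })) (add _ _)
          ; scale = λ c u → trans (ext (λ { (x ∷ xs , y ∷ ys , z ∷ zs) →
              solve 3 (λ d c u → d :* (:1 :* (c :* u)) := c :* (d :* (:1 :* u))) refl ((x ^ᶠ e *ᶠ y ^ᶠ f) *ᶠ z ^ᶠ g) c (u (xs , ys , zs)) })) (scale _ _)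
          }
        (λ es → trans (ext (λ { (x ∷ xs , y ∷ ys , z ∷ zs) →
             solve 6 (λ a b c u v w → ((a :* b) :* c) :* (:1 :* ((u :* v) :* w)) := ((a :* u) :* (b :* v)) :* (c :* w)) refl
               (x ^ᶠ e) (y ^ᶠ f) (z ^ᶠ g) (monomial (Vec.map Exponents.e es) xs) (monomial (Vec.map Exponents.f es) ys) (monomial (Vec.map Exponents.g es) zs) }))
             (h (exponents e f g (≤-trans (≤-reflexive (sym (+-identityʳ _))) le) ∷ es)))
      block (a ∷ as) e f g le = begin
        Λ (times e f g (roots (a ∷ as)) tensor)
          ≡⟨ ext (λ { (x ∷ xs , y ∷ ys , z ∷ zs) → solve 12
               (λ α β γ a x y z X Y Z P Q → ((X :* Y) :* Z) :* (((((α :* x :+ β :* y) :+ γ :* z) :+ (:- a)) :* P) :* Q) :=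
                  (α :* (((x :* X :* Y) :* Z) :* (P :* Q)) :+ β :* (((X :* (y :* Y)) :* Z) :* (P :* Q)))
                  :+ (γ :* (((X :* Y) :* (z :* Z)) :* (P :* Q)) :+ (:- a) :* (((X :* Y) :* Z) :* (P :* Q))))
               refl α β γ a x y z (x ^ᶠ e) (y ^ᶠ f) (z ^ᶠ g) (roots as (form x y z)) (tensor (xs , ys , zs)) }) ⟩
        Λ (λ v → (α *ᶠ A v +ᶠ β *ᶠ B v) +ᶠ (γ *ᶠ C v +ᶠ (-ᶠ a) *ᶠ D v))
          ≡⟨ trans (add _ _) (cong₂ _+ᶠ_ (trans (add _ _) (cong₂ _+ᶠ_ (scale α A) (scale β B)))
                                          (trans (add _ _) (cong₂ _+ᶠ_ (scale γ C) (scale (-ᶠ a) D)))) ⟩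
        (α *ᶠ Λ A +ᶠ β *ᶠ Λ B) +ᶠ (γ *ᶠ Λ C +ᶠ (-ᶠ a) *ᶠ Λ D)
          ≡⟨ cong₂ _+ᶠ_
               (cong₂ (λ u v → α *ᶠ u +ᶠ β *ᶠ v) (block as (suc e) f g le₁) (block as e (suc f) g le₂))
               (cong₂ (λ u v → γ *ᶠ u +ᶠ (-ᶠ a) *ᶠ v) (block as e f (suc g) le₃) (block as e f g (≤-trans (n≤1+n _) le₁))) ⟩
        (α *ᶠ 0ᶠ +ᶠ β *ᶠ 0ᶠ) +ᶠ (γ *ᶠ 0ᶠ +ᶠ (-ᶠ a) *ᶠ 0ᶠ)
          ≡⟨ solve 4 (λ α β γ a → (α :* :0 :+ β :* :0) :+ (γ :* :0 :+ (:- a) :* :0) := :0) refl α β γ a ⟩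
        0ᶠ ∎
        where
        open ≡-Reasoning
        le₁ : suc (e + f + g + length as) ≤ pred q
        le₁ = ≤-trans (≤-reflexive (sym (+-suc (e + f + g) (length as)))) le
        le₂ : e + suc f + g + length as ≤ pred q
        le₂ = ≤-trans (≤-reflexive (cong (λ u → u + g + length as) (+-suc e f))) le₁
        le₃ : e + f + suc g + length as ≤ pred q
        le₃ = ≤-trans (≤-reflexive (cong (_+ length as) (+-suc (e + f) g))) le₁
        A B C D : Pt F (suc m) × Pt F (suc m) × Pt F (suc m) → Fin q
        A = times (suc e) f g (roots as) tensor
        B = times e (suc f) g (roots as) tensor
        C = times e f (suc g) (roots as) tensor
        D = times e f g (roots as) tensor

  eval-pairs : ∀ {X : Set} (ps : List X) → Pt F (length ps) → List (Fin q × X)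
  eval-pairs [] [] = []
  eval-pairs (p ∷ ps) (k ∷ ks) = (k , p) ∷ eval-pairs ps ks

  eval-pairs-zero : ∀ {X : Set} (ps : List X) ks {f : X → Fin q} → (∀ x → x ∈ ps → f x ≡ 0ᶠ) → eval (eval-pairs ps ks) f ≡ 0ᶠ
  eval-pairs-zero [] [] h = refl
  eval-pairs-zero (p ∷ ps) (k ∷ ks) h =
    trans (cong₂ _+ᶠ_ (trans (cong (k *ᶠ_) (h p (here refl))) (R.zeroʳ k)) (eval-pairs-zero ps ks (λ x x∈ → h x (there x∈)))) (R.+-identityʳ _)

  eval-pairs-⊟ : ∀ {X : Set} (ps : List X) ks (f : X → Fin q) → eval (eval-pairs ps (⊟ ks)) f ≡ -ᶠ eval (eval-pairs ps ks) f
  eval-pairs-⊟ [] [] f = solve 0 (:0 := :- :0) refl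
  eval-pairs-⊟ (p ∷ ps) (k ∷ ks) f = trans (cong (_ +ᶠ_) (eval-pairs-⊟ ps ks f))
    (solve 3 (λ k x e → ((:- :1) :* k) :* x :+ (:- e) := :- (k :* x :+ e)) refl k (f p) _)

  module _ {m r : ℕ} (val : Fin r → Pt F m → Fin q) where
    open Span (λ u → Vec.tabulate (λ i → val i u))

    lookup-comb : ∀ ps ks i → Vec.lookup (comb ps ks) i ≡ eval (eval-pairs ps ks) (val i)
    lookup-comb [] [] i = Vec.lookup-replicate i 0ᶠ
    lookup-comb (p ∷ ps) (k ∷ ks) i = trans (Vec.lookup-zipWith _+ᶠ_ i (k ⊡ Vec.tabulate (λ i → val i p)) (comb ps ks))
      (cong₂ _+ᶠ_ (trans (Vec.lookup-map i (k *ᶠ_) (Vec.tabulate (λ i → val i p))) (cong (k *ᶠ_) (Vec.lookup∘tabulate (λ i → val i p) i))) (lookup-comb ps ks i))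

    relation-weights : ∀ u ps → InSpan ps (Vec.tabulate (λ i → val i u)) →
      ∃ λ ks → ∀ i → eval ((1ᶠ , u) ∷ eval-pairs ps ks) (val i) ≡ 0ᶠ
    relation-weights u ps (ks , e) = ⊟ ks , λ i → begin
      1ᶠ *ᶠ val i u +ᶠ eval (eval-pairs ps (⊟ ks)) (val i) ≡⟨ cong (1ᶠ *ᶠ val i u +ᶠ_) (eval-pairs-⊟ ps ks (val i)) ⟩
      1ᶠ *ᶠ val i u +ᶠ -ᶠ eval (eval-pairs ps ks) (val i)
        ≡⟨ cong (λ v → 1ᶠ *ᶠ val i u +ᶠ -ᶠ v) (trans (sym (lookup-comb ps ks i)) (trans (cong (λ v → Vec.lookup v i) e) (Vec.lookup∘tabulate _ i))) ⟩
      1ᶠ *ᶠ val i u +ᶠ -ᶠ val i u ≡⟨ solve 1 (λ v → :1 :* v :+ (:- v) := :0) refl (val i u) ⟩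
      0ᶠ ∎
      where open ≡-Reasoning

  degree : ∀ {m} → Vec (Fin q) m → ℕ
  degree e = Vec.sum (Vec.map toℕ e)

  -- The cutoff is a third of the total degree `pred q * m` of `tensor`: in each of its monomials
  -- the factor in x, in y or in z is low.
  low? : ∀ {m} (e : Vec (Fin q) m) → Dec (3 * degree e ≤ pred q * m)
  low? {m} e = 3 * degree e ≤? pred q * m

  low : ∀ m → List (Vec (Fin q) m)
  low m = filter low? (elems (Gs m))

  lowMonomial : ∀ m → Fin (length (low m)) → Pt F m → Fin q
  lowMonomial m i = monomial (Vec.map toℕ (lookup (low m) i))

  module _ {X Y Z : Set} (w₁ : List (Fin q × X)) (w₂ : List (Fin q × Y)) (w₃ : List (Fin q × Z)) where
    eval₃ : (X × Y × Z → Fin q) → Fin q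
    eval₃ h = eval w₁ (λ x → eval w₂ (λ y → eval w₃ (λ z → h (x , y , z))))

    eval₃-linear : Linear eval₃
    eval₃-linear = compose-linear (eval-linear w₁) (compose-linear (eval-linear w₂) (eval-linear w₃))

    eval₃-product : ∀ (a : X → Fin q) (b : Y → Fin q) (c : Z → Fin q) →
      eval₃ (λ { (x , y , z) → (a x *ᶠ b y) *ᶠ c z }) ≡ (eval w₃ c *ᶠ eval w₂ b) *ᶠ eval w₁ a
    eval₃-product a b c = begin
      eval w₁ (λ x → eval w₂ (λ y → eval w₃ (λ z → (a x *ᶠ b y) *ᶠ c z)))
        ≡⟨ L₁.ext (λ x → L₂.ext (λ y → trans (L₃.scale (a x *ᶠ b y) c) (rearrange (a x) (b y) (eval w₃ c)))) ⟩
      eval w₁ (λ x → eval w₂ (λ y → (eval w₃ c *ᶠ a x) *ᶠ b y)) ≡⟨ L₁.ext (λ x → trans (L₂.scale _ b) (swap-last _ (a x) (eval w₂ b))) ⟩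
      eval w₁ (λ x → (eval w₃ c *ᶠ eval w₂ b) *ᶠ a x) ≡⟨ L₁.scale _ a ⟩
      (eval w₃ c *ᶠ eval w₂ b) *ᶠ eval w₁ a ∎
      where
      open ≡-Reasoning
      module L₁ = Linear (eval-linear w₁)
      module L₂ = Linear (eval-linear w₂)
      module L₃ = Linear (eval-linear w₃)
      rearrange : ∀ a b c → (a *ᶠ b) *ᶠ c ≡ (c *ᶠ a) *ᶠ b
      rearrange = solve 3 (λ a b c → (a :* b) :* c := (c :* a) :* b) refl
      swap-last : ∀ c a b → (c *ᶠ a) *ᶠ b ≡ (c *ᶠ b) *ᶠ a
      swap-last = solve 3 (λ c a b → (c :* a) :* b := (c :* b) :* a) refl

  private
    e-bounded : (t : Exponents) → Exponents.e t < q
    e-bounded (exponents e f g b) = ≤-<-trans (≤-trans (m≤m+n e f) (≤-trans (m≤m+n (e + f) g) b)) pred-q<q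
      where pred-q<q : pred q < q
            pred-q<q = ≤-reflexive (suc-pred q {{>-nonZero (≤-trans (s≤s z≤n) 2≤q)}})
    f-bounded : (t : Exponents) → Exponents.f t < q
    f-bounded (exponents e f g b) = e-bounded (exponents f e g (subst (λ v → v + g ≤ pred q) (+-comm e f) b))
    g-bounded : (t : Exponents) → Exponents.g t < q
    g-bounded (exponents e f g b) = e-bounded (exponents g e f (subst (_≤ pred q) (trans (+-comm (e + f) g) (sym (+-assoc g e f))) b))

    bounded-exponents : ∀ {m} (sel : Exponents → ℕ) → (∀ t → sel t < q) → (ts : Vec Exponents m) →
      ∃ λ (v : Vec (Fin q) m) → Vec.map sel ts ≡ Vec.map toℕ v
    bounded-exponents sel h [] = [] , refl
    bounded-exponents sel h (t ∷ ts) with bounded-exponents sel h ts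
    ... | v , eq = fromℕ< (h t) ∷ v , cong₂ _∷_ (sym (Fin.toℕ-fromℕ< (h t))) eq

    total-degree : ∀ {m} (ts : Vec Exponents m) →
      Vec.sum (Vec.map Exponents.e ts) + Vec.sum (Vec.map Exponents.f ts) + Vec.sum (Vec.map Exponents.g ts) ≤ pred q * m
    total-degree [] = z≤n
    total-degree {suc m} (exponents e f g b ∷ ts) = begin
      (e + E) + (f + F') + (g + G) ≡⟨ lem e f g E F' G ⟩
      (e + f + g) + (E + F' + G) ≤⟨ +-mono-≤ b (total-degree ts) ⟩
      pred q + pred q * m ≡⟨ sym (*-suc (pred q) m) ⟩
      pred q * suc m ∎
      where
      open ≤-Reasoning
      E = Vec.sum (Vec.map Exponents.e ts)
      F' = Vec.sum (Vec.map Exponents.f ts)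
      G = Vec.sum (Vec.map Exponents.g ts)
      lem : ∀ e f g E F G → (e + E) + (f + F) + (g + G) ≡ (e + f + g) + (E + F + G)
      lem = solve-∀

    one-third : ∀ a b c s → a + b + c ≤ s → 3 * a ≤ s ⊎ 3 * b ≤ s ⊎ 3 * c ≤ s
    one-third a b c s h with 3 * a ≤? s | 3 * b ≤? s | 3 * c ≤? s
    ... | yes p | _ | _ = inj₁ p
    ... | no _ | yes p | _ = inj₂ (inj₁ p)
    ... | no _ | no _ | yes p = inj₂ (inj₂ p)
    ... | no p₁ | no p₂ | no p₃ = contradiction (*-monoʳ-≤ 3 h) (<⇒≱ (begin-strict
          3 * s ≡⟨ lem₁ s ⟩
          s + s + s <⟨ +-mono-< (+-mono-< (≰⇒> p₁) (≰⇒> p₂)) (≰⇒> p₃) ⟩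
          3 * a + 3 * b + 3 * c ≡⟨ lem₂ a b c ⟩
          3 * (a + b + c) ∎))
      where
      open ≤-Reasoning
      lem₁ : ∀ s → 3 * s ≡ s + s + s
      lem₁ = solve-∀
      lem₂ : ∀ a b c → 3 * a + 3 * b + 3 * c ≡ 3 * (a + b + c)
      lem₂ = solve-∀

  KillsLow : ∀ {m} → List (Fin q × Pt F m) → Set
  KillsLow {m} w = ∀ i → eval w (lowMonomial m i) ≡ 0ᶠ

  kills-low : ∀ {m} (w : List (Fin q × Pt F m)) → KillsLow w → (sel : Exponents → ℕ) → (∀ t → sel t < q) →
    (ts : Vec Exponents m) → 3 * Vec.sum (Vec.map sel ts) ≤ pred q * m → eval w (monomial (Vec.map sel ts)) ≡ 0ᶠ
  kills-low {m} w k sel h ts le with bounded-exponents sel h ts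
  ... | v , eq = subst (λ es → eval w (monomial es) ≡ 0ᶠ) (sym eq)
      (subst (λ v → eval w (monomial (Vec.map toℕ v)) ≡ 0ᶠ) (sym (lookup-index v∈)) (k (index v∈)))
    where
    v∈ : v ∈ low m
    v∈ = ∈-filter⁺ low? (Enum.complete (Gs m) v) (subst (λ es → 3 * Vec.sum es ≤ pred q * m) eq le)

  -- The slice rank argument: a point whose low-degree monomial vector lies in the span of those of
  -- its predecessors as well as of its successors gives functionals Λ₁, Λ₂ that annihilate the low
  -- monomials while their only common point is the pivot.
  module _ {m : ℕ} (α β γ : Fin q) (γ≢0 : γ ≢ 0ᶠ) (sum≡0 : (α +ᶠ β) +ᶠ γ ≡ 0ᶠ) where
    diagonal-solution : ∀ {n} (u : Pt F n) → α ⊡ u ⊞ β ⊡ u ⊞ γ ⊡ u ≡ 𝟎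
    diagonal-solution u = trans (cong (_⊞ γ ⊡ u) (sym (⊡-distribʳ α β u)))
      (trans (sym (⊡-distribʳ (α +ᶠ β) γ u)) (trans (cong (_⊡ u) sum≡0) (⊡-zeroˡ u)))

    last-determined : ∀ {n} (u z : Pt F n) → α ⊡ u ⊞ β ⊡ u ⊞ γ ⊡ z ≡ 𝟎 → z ≡ u
    last-determined [] [] e = refl
    last-determined (u ∷ us) (z ∷ zs) e = cong₂ _∷_ z≡u (last-determined us zs (Vec.∷-injectiveʳ e))
      where
      open ≡-Reasoning
      γ' = inv γ γ≢0
      z≡u : z ≡ u
      z≡u = begin
        z ≡⟨ solve 1 (λ z → z := :1 :* z) refl z ⟩
        1ᶠ *ᶠ z ≡⟨ cong (_*ᶠ z) (sym (inv-l γ γ≢0)) ⟩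
        (γ' *ᶠ γ) *ᶠ z ≡⟨ solve 6 (λ γ' γ z α β u → (γ' :* γ) :* z :=
             γ' :* ((α :* u :+ β :* u) :+ γ :* z) :+ ((γ' :* γ) :* u :+ (:- (γ' :* u)) :* ((α :+ β) :+ γ))) refl γ' γ z α β u ⟩
        γ' *ᶠ ((α *ᶠ u +ᶠ β *ᶠ u) +ᶠ γ *ᶠ z) +ᶠ ((γ' *ᶠ γ) *ᶠ u +ᶠ (-ᶠ (γ' *ᶠ u)) *ᶠ ((α +ᶠ β) +ᶠ γ))
          ≡⟨ cong₂ (λ a b → γ' *ᶠ a +ᶠ b) (Vec.∷-injectiveˡ e) (cong₂ (λ a b → a *ᶠ u +ᶠ (-ᶠ (γ' *ᶠ u)) *ᶠ b) (inv-l γ γ≢0) sum≡0) ⟩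
        γ' *ᶠ 0ᶠ +ᶠ (1ᶠ *ᶠ u +ᶠ (-ᶠ (γ' *ᶠ u)) *ᶠ 0ᶠ)
          ≡⟨ solve 2 (λ γ' u → γ' :* :0 :+ (:1 :* u :+ (:- (γ' :* u)) :* :0) := u) refl γ' u ⟩
        u ∎

    private
      no-pivot : ∀ pre u post → Unique (pre ʳ++ (u ∷ post)) →
        (∀ x y z → x ∈ pre ʳ++ (u ∷ post) → y ∈ pre ʳ++ (u ∷ post) → z ∈ pre ʳ++ (u ∷ post) →
           α ⊡ x ⊞ β ⊡ y ⊞ γ ⊡ z ≡ 𝟎 → x ≡ y) →
        ∀ ks ls → KillsLow ((1ᶠ , u) ∷ eval-pairs pre ks) → KillsLow ((1ᶠ , u) ∷ eval-pairs post ls) → ⊥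
      no-pivot pre u post unique rigid ks ls k₂ k₁ = tensor-nonzero α β γ u u u (diagonal-solution u) (trans (sym value) vanishes)
        where
        -- The weights `w₁` serve x and z, the weights `w₂` serve y. A nonzero term has x = y by
        -- rigidity; x is `u` or a successor and y is `u` or a predecessor, so both are `u`, and
        -- then `last-determined` gives z = `u`.
        w₁ = (1ᶠ , u) ∷ eval-pairs post ls
        w₂ = (1ᶠ , u) ∷ eval-pairs pre ks
        T = tensor α β γ {m}
        vanishes : eval₃ w₁ w₂ w₁ T ≡ 0ᶠ
        vanishes = tensor-vanishes α β γ m (eval₃ w₁ w₂ w₁) (eval₃-linear w₁ w₂ w₁) (λ ts →
          trans (Linear.ext (eval₃-linear w₁ w₂ w₁) {g = λ { (x , y , z) → (monomial (Vec.map Exponents.e ts) x *ᶠ monomial (Vec.map Exponents.f ts) y) *ᶠ monomial (Vec.map Exponents.g ts) z }} (λ { (x , y , z) → refl }))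
          (trans (eval₃-product w₁ w₂ w₁ _ _ _) (factor-zero (eval w₁ _) (eval w₂ _) (eval w₁ _) (⊎-map (kills-low w₁ k₁ _ e-bounded ts) (⊎-map (kills-low w₂ k₂ _ f-bounded ts) (kills-low w₁ k₁ _ g-bounded ts)) (one-third (Vec.sum (Vec.map Exponents.e ts)) (Vec.sum (Vec.map Exponents.f ts)) (Vec.sum (Vec.map Exponents.g ts)) _ (total-degree ts))))))
          where
          factor-zero : ∀ a b c → a ≡ 0ᶠ ⊎ b ≡ 0ᶠ ⊎ c ≡ 0ᶠ → (c *ᶠ b) *ᶠ a ≡ 0ᶠ
          factor-zero a b c (inj₁ refl) = R.zeroʳ _
          factor-zero a b c (inj₂ (inj₁ refl)) = trans (cong (_*ᶠ a) (R.zeroʳ c)) (R.zeroˡ a)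
          factor-zero a b c (inj₂ (inj₂ refl)) = trans (cong (_*ᶠ a) (R.zeroˡ b)) (R.zeroˡ a)
        head-only : ∀ ps js {f : Pt F m → Fin q} → (∀ x → x ∈ ps → f x ≡ 0ᶠ) → eval ((1ᶠ , u) ∷ eval-pairs ps js) f ≡ f u
        head-only ps js h = trans (cong₂ _+ᶠ_ (R.*-identityˡ _) (eval-pairs-zero ps js h)) (R.+-identityʳ _)
        u∉post : All (u ≢_) post
        u∉post with proj₁ (unique-ʳ++⁻ pre unique)
        ... | h ∷ _ = h
        separate : ∀ {x y} → x ∈ pre → y ∈ u ∷ post → x ≢ y
        separate = proj₂ (unique-ʳ++⁻ pre unique)
        in-post : ∀ {x} → x ∈ u ∷ post → x ∈ pre ʳ++ (u ∷ post)
        in-post = ∈-ʳ++⁺ʳ pre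
        in-pre : ∀ {x} → x ∈ pre → x ∈ pre ʳ++ (u ∷ post)
        in-pre = ∈-ʳ++⁺ˡ pre
        off-diagonal : ∀ x y z → x ∈ u ∷ post → y ∈ pre ʳ++ (u ∷ post) → z ∈ u ∷ post → x ≢ y → T (x , y , z) ≡ 0ᶠ
        off-diagonal x y z x∈ y∈ z∈ x≢y = tensor-zero α β γ x y z (λ e → x≢y (rigid x y z (in-post x∈) y∈ (in-post z∈) e))
        z-sum : ∀ x y → x ∈ u ∷ post → y ∈ pre ʳ++ (u ∷ post) → x ≢ y → eval w₁ (λ z → T (x , y , z)) ≡ 0ᶠ
        z-sum x y x∈ y∈ x≢y = trans (head-only post ls (λ z z∈ → off-diagonal x y z x∈ y∈ (there z∈) x≢y)) (off-diagonal x y u x∈ y∈ (here refl) x≢y)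
        value : eval₃ w₁ w₂ w₁ T ≡ T (u , u , u)
        value = begin
          eval₃ w₁ w₂ w₁ T
            ≡⟨ head-only post ls (λ x x∈ → trans
                 (head-only pre ks (λ y y∈ → z-sum x y (there x∈) (in-pre y∈) (λ e → separate y∈ (there x∈) (sym e))))
                 (z-sum x u (there x∈) (in-post (here refl)) (λ e → All.lookup u∉post x∈ (sym e)))) ⟩
          eval w₂ (λ y → eval w₁ (λ z → T (u , y , z)))
            ≡⟨ head-only pre ks (λ y y∈ → z-sum u y (here refl) (in-pre y∈) (λ e → separate y∈ (here refl) (sym e))) ⟩
          eval w₁ (λ z → T (u , u , z))
            ≡⟨ head-only post ls (λ z z∈ → tensor-zero α β γ u u z (λ e → All.lookup u∉post z∈ (sym (last-determined u z e)))) ⟩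
          T (u , u , u) ∎
          where open ≡-Reasoning

    -- The monomial vectors have `length (low m)` coordinates, so a longer list has a pivot `u`; the
    -- resulting functional sends `tensor` to 0 by the degree count, yet also to its nonzero value
    -- at (u , u , u).
    rigid-length : ∀ (U : List (Pt F m)) → Unique U →
      (∀ x y z → x ∈ U → y ∈ U → z ∈ U → α ⊡ x ⊞ β ⊡ y ⊞ γ ⊡ z ≡ 𝟎 → x ≡ y) → length U ≤ 2 * length (low m)
    rigid-length U unique rigid = ≮⇒≥ (λ long → contra (pivot U long))
      where
      open Span (λ u → Vec.tabulate (λ i → lowMonomial m i u))
      contra : Pivot U → ⊥
      contra (pre , u , post , refl , p , p') with relation-weights (lowMonomial m) u pre p | relation-weights (lowMonomial m) u post p'
      ... | ks , k₂ | ls , k₁ = no-pivot pre u post unique rigid ks ls k₂ k₁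

-- Counting low-degree monomials by an exponential moment

length-filter : ∀ {A : Set} {P : A → Set} (P? : ∀ x → Dec (P x)) xs → length (filter P? xs) ≡ ∑ xs (λ x → iv (P? x))
length-filter P? [] = refl
length-filter P? (x ∷ xs) with P? x
... | yes _ = cong suc (length-filter P? xs)
... | no _ = length-filter P? xs

*-^ : ∀ a b m → (a * b) ^ m ≡ a ^ m * b ^ m
*-^ a b zero = refl
*-^ a b (suc m) = trans (cong (a * b *_) (*-^ a b m)) (lem a b (a ^ m) (b ^ m))
  where lem : ∀ a b c d → a * b * (c * d) ≡ a * c * (b * d)
        lem = solve-∀

1≤^ : ∀ a m → 1 ≤ a → 1 ≤ a ^ m
1≤^ a m h = m^n>0 a {{>-nonZero h}} m

cross-≤ : ∀ {x y X Y} → x ≤ X → y ≤ Y → Y * x + X * y ≤ X * Y + x * y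
cross-≤ {x} {y} {X} {Y} h k = subst₂ (λ X Y → Y * x + X * y ≤ X * Y + x * y) (m+[n∸m]≡n h) (m+[n∸m]≡n k)
  (≤-trans (m≤m+n _ _) (≤-reflexive (lem x y (X ∸ x) (Y ∸ y))))
  where lem : ∀ x y c d → ((y + d) * x + (x + c) * y) + c * d ≡ (x + c) * (y + d) + x * y
        lem = solve-∀

-- Bernoulli's inequality (1 - 1/(L+1))^j ≥ 1 - j/(L+1), cleared of denominators.
bernoulli-down : ∀ L j → j ≤ suc L → suc L ^ j * (suc L ∸ j) ≤ L ^ j * suc L
bernoulli-down L zero h = ≤-refl
bernoulli-down L (suc j) h = begin
  suc L * suc L ^ j * (L ∸ j) ≡⟨ lem₁ (suc L) (suc L ^ j) (L ∸ j) ⟩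
  suc L ^ j * (suc L * (L ∸ j)) ≤⟨ *-monoʳ-≤ (suc L ^ j) step ⟩
  suc L ^ j * (L * (suc L ∸ j)) ≡⟨ lem₁' (suc L ^ j) L (suc L ∸ j) ⟩
  L * (suc L ^ j * (suc L ∸ j)) ≤⟨ *-monoʳ-≤ L (bernoulli-down L j (≤-trans (n≤1+n j) h)) ⟩
  L * (L ^ j * suc L) ≡⟨ sym (*-assoc L (L ^ j) (suc L)) ⟩
  L * L ^ j * suc L ∎
  where
  open ≤-Reasoning
  lem₁ : ∀ a b c → a * b * c ≡ b * (a * c)
  lem₁ = solve-∀
  lem₁' : ∀ a b c → a * (b * c) ≡ b * (a * c)
  lem₁' = solve-∀
  j≤L = s≤s⁻¹ h
  step : suc L * (L ∸ j) ≤ L * (suc L ∸ j)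
  step rewrite +-∸-assoc 1 j≤L = ≤-trans (+-monoˡ-≤ (L * (L ∸ j)) (m∸n≤m L j)) (≤-reflexive (sym (*-suc L (L ∸ j))))

-- Bernoulli's inequality (1 + 1/Q)^j ≥ 1 + j/Q, cleared of denominators.
bernoulli-up : ∀ Q j → Q ^ j * (Q + j) ≤ suc Q ^ j * Q
bernoulli-up Q zero = ≤-reflexive (cong (1 *_) (+-identityʳ Q))
bernoulli-up Q (suc j) = begin
  Q * Q ^ j * (Q + suc j) ≤⟨ ≤-trans (m≤m+n _ (Q ^ j * j)) (≤-reflexive (lem Q (Q ^ j) j)) ⟩
  suc Q * (Q ^ j * (Q + j)) ≤⟨ *-monoʳ-≤ (suc Q) (bernoulli-up Q j) ⟩
  suc Q * (suc Q ^ j * Q) ≡⟨ sym (*-assoc (suc Q) (suc Q ^ j) Q) ⟩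
  suc Q * suc Q ^ j * Q ∎
  where
  open ≤-Reasoning
  lem : ∀ Q P j → Q * P * (Q + suc j) + P * j ≡ suc Q * (P * (Q + j))
  lem = solve-∀

doubling : ∀ Q → 1 ≤ Q → 2 * Q ^ Q ≤ suc Q ^ Q
doubling Q h = *-cancelʳ-≤ (2 * Q ^ Q) (suc Q ^ Q) Q {{>-nonZero h}}
  (≤-trans (≤-reflexive (lem (Q ^ Q) Q)) (bernoulli-up Q Q))
  where lem : ∀ P Q → 2 * P * Q ≡ P * (Q + Q)
        lem = solve-∀

-- The difference of the two sides factors as (a - b)(a² - ab - b²), which is negative when a/b lies
-- strictly between 1 and the golden ratio; 3/2 is a convenient rational bound.
cubes< : ∀ {a b} → b < a → 2 * a ≤ 3 * b → a * a * a + b * b * b < 2 * (a * a * b)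
cubes< {a} {b} b<a h = subst (λ a → a * a * a + b * b * b < 2 * (a * a * b)) (m+[n∸m]≡n (<⇒≤ b<a)) (go (a ∸ b) (m<n⇒0<n∸m b<a) c-small)
  where
  c-small : 2 * (a ∸ b) ≤ b
  c-small = ≤-trans (≤-reflexive (*-distribˡ-∸ 2 a b)) (≤-trans (∸-monoˡ-≤ (2 * b) h) (≤-reflexive (m+n∸n≡m b (2 * b))))
  go : ∀ c → 1 ≤ c → 2 * c ≤ b → (b + c) * (b + c) * (b + c) + b * b * b < 2 * ((b + c) * (b + c) * b)
  go c 1≤c 2c≤b = *-cancelˡ-< 4 _ _ (begin-strict
    4 * ((b + c) * (b + c) * (b + c) + b * b * b) ≡⟨ l₁ b c ⟩
    8 * (b * b * b) + 12 * (b * b * c) + 8 * (b * c * c) + (2 * (b * c) * (2 * c) + c * (2 * c) * (2 * c))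
      ≤⟨ +-monoʳ-≤ (8 * (b * b * b) + 12 * (b * b * c) + 8 * (b * c * c)) (+-mono-≤ (*-monoʳ-≤ (2 * (b * c)) 2c≤b) (*-mono-≤ (*-monoʳ-≤ c 2c≤b) 2c≤b)) ⟩
    8 * (b * b * b) + 12 * (b * b * c) + 8 * (b * c * c) + (2 * (b * c) * b + c * b * b)
      <⟨ +-monoʳ-< (8 * (b * b * b) + 12 * (b * b * c) + 8 * (b * c * c)) (≤-trans (+-monoˡ-≤ (2 * (b * c) * b + c * b * b) pos) (≤-reflexive (l₂ b c))) ⟩
    8 * (b * b * b) + 12 * (b * b * c) + 8 * (b * c * c) + 4 * (b * b * c) ≡⟨ l₃ b c ⟩
    4 * (2 * ((b + c) * (b + c) * b)) ∎)
    where
    open ≤-Reasoning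
    1≤b : 1 ≤ b
    1≤b = ≤-trans 1≤c (≤-trans (m≤m+n c (c + 0)) 2c≤b)
    pos : 1 ≤ b * b * c
    pos = *-mono-≤ (*-mono-≤ 1≤b 1≤b) 1≤c
    l₁ : ∀ b c → 4 * ((b + c) * (b + c) * (b + c) + b * b * b) ≡ 8 * (b * b * b) + 12 * (b * b * c) + 8 * (b * c * c) + (2 * (b * c) * (2 * c) + c * (2 * c) * (2 * c))
    l₁ = solve-∀
    l₂ : ∀ b c → b * b * c + (2 * (b * c) * b + c * b * b) ≡ 4 * (b * b * c)
    l₂ = solve-∀
    l₃ : ∀ b c → 8 * (b * b * b) + 12 * (b * b * c) + 8 * (b * c * c) + 4 * (b * b * c) ≡ 4 * (2 * ((b + c) * (b + c) * b))
    l₃ = solve-∀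

module CapSet {q : ℕ} (F : FiniteField q) where
  open Geometry F
  open LinearAlgebra F
  open PolynomialMethod F

  private
    p L : ℕ
    p = pred q
    -- This choice makes ((L+1)/L)^p at most 3/2 by Bernoulli, as `cubes<` demands.
    L = 3 * p

    1≤p : 1 ≤ p
    1≤p = s≤s⁻¹ (≤-trans 2≤q (≤-reflexive (sym (suc-pred q {{>-nonZero (≤-trans (s≤s z≤n) 2≤q)}}))))
    1≤L : 1 ≤ L
    1≤L = ≤-trans 1≤p (m≤m+n p _)

    toℕ≤p : (e : Fin q) → toℕ e ≤ p
    toℕ≤p e = pred-mono-≤ (Fin.toℕ<n e)

    -- The exponent weights of an exponential moment bound on the number of low monomials:
    -- a low monomial weighs at least base ^ m, while the average weight is smaller than base.
    weight : Fin q → ℕ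
    weight e = suc L ^ (3 * (p ∸ toℕ e)) * L ^ (3 * toℕ e)

    base total : ℕ
    base = suc L ^ (2 * p) * L ^ p
    total = ∑ (elems Fs) weight

    weights : ∀ {m} → Vec (Fin q) m → ℕ
    weights [] = 1
    weights (e ∷ es) = weight e * weights es

    sum-weights : ∀ m → ∑ (elems (Gs m)) weights ≡ total ^ m
    sum-weights zero = refl
    sum-weights (suc m) = trans (∑-vec Fs m weights)
      (trans (∑-cong (elems Fs) (λ e → trans (∑-*ˡ (elems (Gs m)) (weight e) weights) (cong (weight e *_) (sum-weights m))))
             (∑-*ʳ (elems Fs) (total ^ m) weight))

    weights-degree : ∀ {m} (e : Vec (Fin q) m) → ∃ λ D' → weights e ≡ suc L ^ (3 * D') * L ^ (3 * degree e) × degree e + D' ≡ p * m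
    weights-degree [] = 0 , refl , sym (*-zeroʳ p)
    weights-degree {suc m} (e ∷ es) with weights-degree es
    ... | D' , eq , s = (p ∸ toℕ e) + D' ,
          trans (cong (weight e *_) eq) (trans (lem (suc L ^ (3 * (p ∸ toℕ e))) (L ^ (3 * toℕ e)) (suc L ^ (3 * D')) (L ^ (3 * degree es)))
            (cong₂ _*_ (collect (suc L) (p ∸ toℕ e) D') (collect L (toℕ e) (degree es)))) ,
          trans (lem₂ (toℕ e) (degree es) (p ∸ toℕ e) D') (trans (cong₂ _+_ (m+[n∸m]≡n (toℕ≤p e)) s) (sym (*-suc p m)))
      where
      lem : ∀ a b c d → a * b * (c * d) ≡ a * c * (b * d)
      lem = solve-∀
      collect : ∀ x a b → x ^ (3 * a) * x ^ (3 * b) ≡ x ^ (3 * (a + b))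
      collect x a b = trans (sym (^-distribˡ-+-* x (3 * a) (3 * b))) (cong (x ^_) (sym (*-distribˡ-+ 3 a b)))
      lem₂ : ∀ a b c d → (a + b) + (c + d) ≡ (a + c) + (b + d)
      lem₂ = solve-∀

    low-weight : ∀ {m} (e : Vec (Fin q) m) → 3 * degree e ≤ p * m → base ^ m ≤ weights e
    low-weight {m} e h with weights-degree e
    ... | D' , eq , s = begin
      base ^ m ≡⟨ trans (*-^ (suc L ^ (2 * p)) (L ^ p) m) (cong₂ _*_ (^-*-assoc (suc L) (2 * p) m) (^-*-assoc L p m)) ⟩
      suc L ^ (2 * p * m) * L ^ (p * m) ≡⟨ cong (λ v → suc L ^ (2 * p * m) * L ^ v) (sym split) ⟩
      suc L ^ (2 * p * m) * L ^ (3 * degree e + x) ≡⟨ cong (suc L ^ (2 * p * m) *_) (^-distribˡ-+-* L (3 * degree e) x) ⟩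
      suc L ^ (2 * p * m) * (L ^ (3 * degree e) * L ^ x) ≤⟨ *-monoʳ-≤ (suc L ^ (2 * p * m)) (*-monoʳ-≤ (L ^ (3 * degree e)) (^-monoˡ-≤ x (n≤1+n L))) ⟩
      suc L ^ (2 * p * m) * (L ^ (3 * degree e) * suc L ^ x) ≡⟨ lem (suc L ^ (2 * p * m)) (L ^ (3 * degree e)) (suc L ^ x) ⟩
      suc L ^ (2 * p * m) * suc L ^ x * L ^ (3 * degree e) ≡⟨ cong (_* L ^ (3 * degree e)) (trans (sym (^-distribˡ-+-* (suc L) (2 * p * m) x)) (cong (suc L ^_) exps)) ⟩
      suc L ^ (3 * D') * L ^ (3 * degree e) ≡⟨ sym eq ⟩
      weights e ∎
      where
      open ≤-Reasoning
      x = p * m ∸ 3 * degree e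
      split : 3 * degree e + x ≡ p * m
      split = m+[n∸m]≡n h
      lem : ∀ a b c → a * (b * c) ≡ a * c * b
      lem = solve-∀
      l₁ : ∀ pm d x → 2 * pm + x + (3 * d) ≡ 2 * pm + (3 * d + x)
      l₁ = solve-∀
      l₂ : ∀ d D' → 2 * (d + D') + (d + D') ≡ 3 * D' + 3 * d
      l₂ = solve-∀
      exps : 2 * p * m + x ≡ 3 * D'
      exps = +-cancelʳ-≡ (3 * degree e) _ _ (trans (cong (λ v → v + x + 3 * degree e) (*-assoc 2 p m))
        (trans (l₁ (p * m) (degree e) x) (trans (cong (2 * (p * m) +_) split)
          (trans (sym (cong₂ (λ u v → 2 * u + v) s s)) (l₂ (degree e) D')))))

    low-count : ∀ m → length (low m) * base ^ m ≤ total ^ m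
    low-count m = begin
      length (low m) * base ^ m ≡⟨ cong (_* base ^ m) (length-filter low? (elems (Gs m))) ⟩
      ∑ (elems (Gs m)) (λ e → iv (low? e)) * base ^ m ≡⟨ sym (∑-*ʳ (elems (Gs m)) (base ^ m) _) ⟩
      ∑ (elems (Gs m)) (λ e → iv (low? e) * base ^ m) ≤⟨ ∑-mono (elems (Gs m)) bound ⟩
      ∑ (elems (Gs m)) weights ≡⟨ sum-weights m ⟩
      total ^ m ∎
      where
      open ≤-Reasoning
      bound : ∀ e → iv (low? e) * base ^ m ≤ weights e
      bound e with low? e
      ... | yes h = ≤-trans (≤-reflexive (*-identityˡ _)) (low-weight e h)
      ... | no _ = z≤n

    2L^p : 2 * suc L ^ p ≤ 3 * L ^ p
    2L^p = *-cancelʳ-≤ _ _ (suc L) (begin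
      2 * suc L ^ p * suc L ≡⟨ l₁ (suc L ^ p) (suc L) ⟩
      suc L ^ p * (2 * suc L) ≤⟨ *-monoʳ-≤ (suc L ^ p) (≤-trans (n≤1+n _) (≤-reflexive (l₂ p))) ⟩
      suc L ^ p * (3 * suc (2 * p)) ≡⟨ l₁' (suc L ^ p) (suc (2 * p)) ⟩
      3 * (suc L ^ p * suc (2 * p)) ≡⟨ cong (λ v → 3 * (suc L ^ p * v)) (sym (trans (cong (_∸ p) (l₃ p)) (m+n∸n≡m (suc (2 * p)) p))) ⟩
      3 * (suc L ^ p * (suc L ∸ p)) ≤⟨ *-monoʳ-≤ 3 (bernoulli-down L p (≤-trans (m≤m+n p _) (n≤1+n L))) ⟩
      3 * (L ^ p * suc L) ≡⟨ sym (*-assoc 3 (L ^ p) (suc L)) ⟩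
      3 * L ^ p * suc L ∎)
      where
      open ≤-Reasoning
      l₁ : ∀ a b → 2 * a * b ≡ a * (2 * b)
      l₁ = solve-∀
      l₁' : ∀ a b → a * (3 * b) ≡ 3 * (a * b)
      l₁' = solve-∀
      l₂ : ∀ p → suc (2 * suc (3 * p)) ≡ 3 * suc (2 * p)
      l₂ = solve-∀
      l₃ : ∀ p → suc (3 * p) ≡ suc (2 * p) + p
      l₃ = solve-∀

    -- Each exponent e is paired with its complement p - e. By the rearrangement inequality
    -- `cross-≤` the sum of the two weights is largest at the extremes, and there `cubes<` puts it
    -- strictly below `2 * base`.
    total<q*base : suc total ≤ q * base
    total<q*base = *-cancelˡ-< 2 total (q * base) (begin-strict
      2 * total ≡⟨ cong (total +_) (+-identityʳ total) ⟩
      total + total ≡⟨ cong (total +_) (sym (∑-reindex Fs opposite opposite Fin.opposite-involutive Fin.opposite-involutive weight)) ⟩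
      total + ∑ (elems Fs) (weight ∘ opposite) ≡⟨ sym (∑-+ (elems Fs) weight (weight ∘ opposite)) ⟩
      ∑ (elems Fs) (λ e → weight e + weight (opposite e)) ≤⟨ ∑-mono (elems Fs) pair ⟩
      ∑ (elems Fs) (λ _ → a * a * a + b * b * b) ≡⟨ ∑-const (elems Fs) _ ⟩
      card Fs * (a * a * a + b * b * b) ≡⟨ cong (_* (a * a * a + b * b * b)) card-F ⟩
      q * (a * a * a + b * b * b) <⟨ *-monoʳ-< q {{>-nonZero (≤-trans (s≤s z≤n) 2≤q)}} (cubes< (^-monoˡ-< p {{>-nonZero 1≤p}} (n<1+n L)) 2L^p) ⟩
      q * (2 * (a * a * b)) ≡⟨ lem q (a * a * b) ⟩
      2 * (q * (a * a * b)) ≡⟨ cong (λ v → 2 * (q * (v * b))) (trans (sym (^-distribˡ-+-* (suc L) p p)) (cong (λ v → suc L ^ (p + v)) (sym (+-identityʳ p)))) ⟩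
      2 * (q * base) ∎)
      where
      open ≤-Reasoning
      a = suc L ^ p
      b = L ^ p
      lem : ∀ q x → q * (2 * x) ≡ 2 * (q * x)
      lem = solve-∀
      cube : ∀ x → x ^ (3 * p) ≡ x ^ p * x ^ p * x ^ p
      cube x = trans (^-distribˡ-+-* x p (p + (p + 0))) (trans (cong (x ^ p *_) (trans (^-distribˡ-+-* x p (p + 0)) (cong (λ v → x ^ p * x ^ v) (+-identityʳ p)))) (sym (*-assoc (x ^ p) _ _)))
      pair : ∀ e → weight e + weight (opposite e) ≤ a * a * a + b * b * b
      pair e = begin
        weight e + weight (opposite e) ≡⟨ cong₂ (λ u v → weight e + suc L ^ (3 * u) * L ^ (3 * v)) opp′ opp ⟩
        Y * x + X * y ≤⟨ cross-≤ (^-monoˡ-≤ (3 * toℕ e) (n≤1+n L)) (^-monoˡ-≤ (3 * (p ∸ toℕ e)) (n≤1+n L)) ⟩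
        X * Y + x * y ≡⟨ cong₂ _+_ (trans (join (suc L)) (cube (suc L))) (trans (join L) (cube L)) ⟩
        a * a * a + b * b * b ∎
        where
        X = suc L ^ (3 * toℕ e)
        Y = suc L ^ (3 * (p ∸ toℕ e))
        x = L ^ (3 * toℕ e)
        y = L ^ (3 * (p ∸ toℕ e))
        opp : toℕ (opposite e) ≡ p ∸ toℕ e
        opp = trans (Fin.opposite-prop e) (sym (pred-∸ q (toℕ e)))
          where pred-∸ : ∀ q i → pred q ∸ i ≡ q ∸ suc i
                pred-∸ zero i = 0∸n≡0 i
                pred-∸ (suc q) i = refl
        opp′ : p ∸ toℕ (opposite e) ≡ toℕ e
        opp′ = trans (cong (p ∸_) opp) (m∸[m∸n]≡n (toℕ≤p e))
        join : ∀ z → z ^ (3 * toℕ e) * z ^ (3 * (p ∸ toℕ e)) ≡ z ^ (3 * p)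
        join z = trans (sym (^-distribˡ-+-* z (3 * toℕ e) (3 * (p ∸ toℕ e))))
          (cong (z ^_) (trans (sym (*-distribˡ-+ 3 (toℕ e) (p ∸ toℕ e))) (cong (3 *_) (m+[n∸m]≡n (toℕ≤p e)))))

    1≤total : 1 ≤ total
    1≤total = ≤-trans (*-mono-≤ (1≤^ (suc L) (3 * (p ∸ toℕ 0ᶠ)) (s≤s z≤n)) (1≤^ L (3 * toℕ 0ᶠ) 1≤L)) (∑-term weight (Enum.complete Fs 0ᶠ))

  -- As `total` and `q * base` are integers, their ratio is at most total/(total+1), and by
  -- `doubling` every `total` coordinates gain a factor 2. Thus `capDim * l` coordinates gain
  -- 2^(3l), more than the 2^(l+1) that `few-low` has to beat.
  capDim : ℕ
  capDim = total * 3

  few-low : ∀ l → 1 ≤ l → 2 ^ l * (2 * length (low (capDim * l))) < q ^ (capDim * l)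
  few-low l 1≤l = ≰⇒> λ h → <⇒≱ (begin-strict
    2 ^ suc l * total ^ m <⟨ *-monoˡ-< (total ^ m) {{>-nonZero (1≤^ total m 1≤total)}} (^-monoʳ-< 2 (s≤s (s≤s z≤n)) (≤-trans (s≤s (+-monoˡ-≤ l 1≤l)) (+-monoˡ-≤ (l + l) 1≤l))) ⟩
    2 ^ (l + (l + l)) * total ^ m ≡⟨ cong₂ _*_ (cong (2 ^_) (l₁ l)) (sym (trans (^-*-assoc total total (3 * l)) (cong (total ^_) (sym (*-assoc total 3 l))))) ⟩
    2 ^ (3 * l) * (total ^ total) ^ (3 * l) ≡⟨ sym (*-^ 2 (total ^ total) (3 * l)) ⟩
    (2 * total ^ total) ^ (3 * l) ≤⟨ ^-monoˡ-≤ (3 * l) (doubling total 1≤total) ⟩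
    (suc total ^ total) ^ (3 * l) ≡⟨ trans (^-*-assoc (suc total) total (3 * l)) (cong (suc total ^_) (sym (*-assoc total 3 l))) ⟩
    suc total ^ m ≤⟨ ^-monoˡ-≤ m total<q*base ⟩
    (q * base) ^ m ≡⟨ *-^ q base m ⟩
    q ^ m * base ^ m ∎)
    (begin
    q ^ m * base ^ m ≤⟨ *-monoˡ-≤ (base ^ m) h ⟩
    2 ^ l * (2 * length (low m)) * base ^ m ≡⟨ l₂ (2 ^ l) (length (low m)) (base ^ m) ⟩
    2 ^ suc l * (length (low m) * base ^ m) ≤⟨ *-monoʳ-≤ (2 ^ suc l) (low-count m) ⟩
    2 ^ suc l * total ^ m ∎)
    where
    open ≤-Reasoning
    m = capDim * l
    l₁ : ∀ l → l + (l + l) ≡ 3 * l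
    l₁ = solve-∀
    l₂ : ∀ a b c → a * (2 * b) * c ≡ 2 * a * (b * c)
    l₂ = solve-∀

  -- The dimension is only proportional to l, the logarithm of the inverse density. Hence the space
  -- has a number of points polynomial in 2^l, which keeps the later averaging over maps from it
  -- polynomial.
  nontrivial-solution : ∀ α β γ → γ ≢ 0ᶠ → (α +ᶠ β) +ᶠ γ ≡ 0ᶠ → ∀ l → 1 ≤ l →
    {P : Pt F (capDim * l) → Set} (P? : ∀ u → Dec (P u)) → q ^ (capDim * l) ≤ 2 ^ l * ΣG (λ u → iv (P? u)) →
    ∃ λ x → ∃ λ y → ∃ λ z → P x × P y × P z × α ⊡ x ⊞ β ⊡ y ⊞ γ ⊡ z ≡ 𝟎 × x ≢ y
  nontrivial-solution α β γ γ≢0 s≡0 l 1≤l {P} P? h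
    with any-elem (Gs m) (λ x → any-elem (Gs m) (λ y → any-elem (Gs m) (λ z →
           P? x ×-dec P? y ×-dec P? z ×-dec ((α ⊡ x ⊞ β ⊡ y ⊞ γ ⊡ z) ≟ᵛ 𝟎) ×-dec ¬? (x ≟ᵛ y))))
    where m = capDim * l
  ... | yes sol = sol
  ... | no none = contradiction (few-low l 1≤l) (≤⇒≯ (≤-trans h (*-monoʳ-≤ (2 ^ l) (subst (_≤ 2 * length (low m)) (length-filter P? (elems (Gs m)))
        (rigid-length α β γ γ≢0 s≡0 (filter P? (elems (Gs m))) (Unique.filter⁺ P? (Enum.unique (Gs m)))
          (λ x y z x∈ y∈ z∈ e → rigid x y z (member x∈) (member y∈) (member z∈) e))))))
    where
    m = capDim * l
    member : ∀ {x} → x ∈ filter P? (elems (Gs m)) → P x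
    member x∈ = proj₂ (∈-filter⁻ P? {xs = elems (Gs m)} x∈)
    rigid : ∀ x y z → P x → P y → P z → α ⊡ x ⊞ β ⊡ y ⊞ γ ⊡ z ≡ 𝟎 → x ≡ y
    rigid x y z px py pz e with x ≟ᵛ y
    ... | yes x≡y = x≡y
    ... | no x≢y = contradiction (x , y , z , px , py , pz , e , x≢y) none

-- Supersaturation

n<2^n : ∀ n → n < 2 ^ n
n<2^n zero = s≤s z≤n
n<2^n (suc n) = ≤-trans (s≤s (n<2^n n)) (≤-trans (+-monoˡ-≤ (2 ^ n) (1≤^ 2 n (s≤s z≤n))) (≤-reflexive (cong (2 ^ n +_) (sym (+-identityʳ _)))))

module GroupSums {q : ℕ} (F : FiniteField q) where
  open Geometry F

  add-sub : ∀ {n} (x w : Pt F n) → (x ⊞ ⊟ w) ⊞ w ≡ x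
  add-sub [] [] = refl
  add-sub (a ∷ x) (b ∷ w) = cong₂ _∷_ (solve 2 (λ a b → (a :+ (:- :1) :* b) :+ b := a) refl a b) (add-sub x w)

  sub-add : ∀ {n} (x w : Pt F n) → (x ⊞ w) ⊞ ⊟ w ≡ x
  sub-add [] [] = refl
  sub-add (a ∷ x) (b ∷ w) = cong₂ _∷_ (solve 2 (λ a b → (a :+ b) :+ (:- :1) :* b := a) refl a b) (sub-add x w)

  ⊡-inv : ∀ {n} c (h : c ≢ 0ᶠ) (x : Pt F n) → c ⊡ (inv c h ⊡ x) ≡ x
  ⊡-inv c h x = trans (sym (⊡-assoc c _ x)) (trans (cong (_⊡ x) (inv-r c h)) (⊡-identity x))
  inv-⊡ : ∀ {n} c (h : c ≢ 0ᶠ) (x : Pt F n) → inv c h ⊡ (c ⊡ x) ≡ x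
  inv-⊡ c h x = trans (sym (⊡-assoc _ c x)) (trans (cong (_⊡ x) (inv-l c h)) (⊡-identity x))

  ΣG-shift : ∀ {n} (w : Pt F n) (f : Pt F n → ℕ) → ΣG (λ x → f (x ⊞ w)) ≡ ΣG f
  ΣG-shift {n} w f = ∑-reindex (Gs n) (_⊞ w) (_⊞ ⊟ w) (λ x → add-sub x w) (λ x → sub-add x w) f

  ΣG-shiftˡ : ∀ {n} (w : Pt F n) (f : Pt F n → ℕ) → ΣG (λ x → f (w ⊞ x)) ≡ ΣG f
  ΣG-shiftˡ {n} w f = trans (∑-cong (elems (Gs n)) (λ x → cong f (⊞-comm w x))) (ΣG-shift w f)

  ΣG-dilate : ∀ {n} c → c ≢ 0ᶠ → (f : Pt F n → ℕ) → ΣG (λ x → f (c ⊡ x)) ≡ ΣG f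
  ΣG-dilate {n} c h f = ∑-reindex (Gs n) (c ⊡_) (inv c h ⊡_) (⊡-inv c h) (inv-⊡ c h) f

  ΣG-const : ∀ n c → ΣG {n} (λ _ → c) ≡ q ^ n * c
  ΣG-const n c = trans (∑-const (elems (Gs n)) c) (cong (_* c) (card-G n))

  ΣG-iv≤ : ∀ {n} {P : Pt F n → Set} (P? : ∀ x → Dec (P x)) → ΣG (λ x → iv (P? x)) ≤ q ^ n
  ΣG-iv≤ {n} P? = ≤-trans (∑-mono (elems (Gs n)) (λ x → iv≤1 (P? x))) (≤-reflexive (card-G n))

  1≤q^ : ∀ n → 1 ≤ q ^ n
  1≤q^ n = 1≤^ q n (≤-trans (s≤s z≤n) 2≤q)

  q^≤2^ : ∀ m → q ^ m ≤ 2 ^ (q * m)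
  q^≤2^ m = ≤-trans (^-monoˡ-≤ m (<⇒≤ (n<2^n q))) (≤-reflexive (^-*-assoc 2 q m))

  -- reps f base (c₁ ∷ ⋯ ∷ cₖ ∷ []) p is the sum of f x₁ ⋯ f xₖ base (p + c₁ x₁ + ⋯ + cₖ xₖ).
  reps : ∀ {n} (f base : Pt F n → ℕ) → List (Fin q) → Pt F n → ℕ
  reps f base [] p = base p
  reps f base (c ∷ cs) p = ΣG (λ x → f x * reps f base cs (p ⊞ c ⊡ x))

  atZero : ∀ {n} → Pt F n → ℕ
  atZero x = iv (x ≟ᵛ 𝟎)

  module _ {n} (f base : Pt F n → ℕ) where
    reps-swap : ∀ a b cs p → reps f base (a ∷ b ∷ cs) p ≡ reps f base (b ∷ a ∷ cs) p
    reps-swap a b cs p = begin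
      ΣG (λ x → f x * ΣG (λ y → f y * reps f base cs ((p ⊞ a ⊡ x) ⊞ b ⊡ y)))
        ≡⟨ ∑-cong xs (λ x → sym (∑-*ˡ xs (f x) _)) ⟩
      ΣG (λ x → ΣG (λ y → f x * (f y * reps f base cs ((p ⊞ a ⊡ x) ⊞ b ⊡ y)))) ≡⟨ ∑-swap xs xs _ ⟩
      ΣG (λ y → ΣG (λ x → f x * (f y * reps f base cs ((p ⊞ a ⊡ x) ⊞ b ⊡ y))))
        ≡⟨ ∑-cong xs (λ y → trans (∑-cong xs (λ x → trans (lem (f x) (f y) _)
              (cong (λ v → f y * (f x * reps f base cs v)) (swap-terms p (a ⊡ x) (b ⊡ y))))) (∑-*ˡ xs (f y) _)) ⟩
      ΣG (λ y → f y * ΣG (λ x → f x * reps f base cs ((p ⊞ b ⊡ y) ⊞ a ⊡ x))) ∎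
      where
      open ≡-Reasoning
      xs = elems (Gs n)
      lem : ∀ a b c → a * (b * c) ≡ b * (a * c)
      lem = solve-∀
      swap-terms : ∀ {n} (p u v : Pt F n) → (p ⊞ u) ⊞ v ≡ (p ⊞ v) ⊞ u
      swap-terms p u v = trans (⊞-assoc p u v) (trans (cong (p ⊞_) (⊞-comm u v)) (sym (⊞-assoc p v u)))

    reps-cons-cong : ∀ a cs ds → (∀ p → reps f base cs p ≡ reps f base ds p) → ∀ p → reps f base (a ∷ cs) p ≡ reps f base (a ∷ ds) p
    reps-cons-cong a cs ds h p = ∑-cong (elems (Gs n)) (λ x → cong (f x *_) (h _))

    ΣG-reps : ∀ cs → ΣG (reps f base cs) ≡ ΣG f ^ length cs * ΣG base
    ΣG-reps [] = sym (*-identityˡ _)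
    ΣG-reps (c ∷ cs) = begin
      ΣG (λ p → ΣG (λ x → f x * reps f base cs (p ⊞ c ⊡ x))) ≡⟨ ∑-swap xs xs _ ⟩
      ΣG (λ x → ΣG (λ p → f x * reps f base cs (p ⊞ c ⊡ x)))
        ≡⟨ ∑-cong xs (λ x → trans (∑-*ˡ xs (f x) _) (cong (f x *_) (trans (ΣG-shift (c ⊡ x) (reps f base cs)) (ΣG-reps cs)))) ⟩
      ΣG (λ x → f x * (ΣG f ^ length cs * ΣG base)) ≡⟨ ∑-*ʳ xs _ f ⟩
      ΣG f * (ΣG f ^ length cs * ΣG base) ≡⟨ sym (*-assoc (ΣG f) _ _) ⟩
      ΣG f * ΣG f ^ length cs * ΣG base ∎
      where
      open ≡-Reasoning
      xs = elems (Gs n)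

module Supersaturation {q : ℕ} (F : FiniteField q) where
  open Geometry F
  open GroupSums F
  open CapSet F using (capDim; nontrivial-solution)

  -- Comes from the loss `2 ^ suc l * (q ^ m * q ^ m)` with m = `capDim * suc l`, using q ≤ 2^q.
  tripleExponent : ℕ
  tripleExponent = suc (q * capDim + q * capDim)

  lin : ∀ {n m} → Vec (Pt F n) m → Pt F m → Pt F n
  lin [] [] = 𝟎
  lin (v ∷ φ) (a ∷ u) = a ⊡ v ⊞ lin φ u

  lin-+ : ∀ {n m} (φ : Vec (Pt F n) m) u w → lin φ (u ⊞ w) ≡ lin φ u ⊞ lin φ w
  lin-+ [] [] [] = sym (⊞-identityˡ 𝟎)
  lin-+ (v ∷ φ) (a ∷ u) (b ∷ w) = trans (cong ((a +ᶠ b) ⊡ v ⊞_) (lin-+ φ u w)) (lem a b v _ _)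
    where
    lem : ∀ {n} a b (v x y : Pt F n) → (a +ᶠ b) ⊡ v ⊞ (x ⊞ y) ≡ (a ⊡ v ⊞ x) ⊞ (b ⊡ v ⊞ y)
    lem a b [] [] [] = refl
    lem a b (v ∷ vs) (x ∷ xs) (y ∷ ys) = cong₂ _∷_
      (solve 5 (λ a b v x y → (a :+ b) :* v :+ (x :+ y) := (a :* v :+ x) :+ (b :* v :+ y)) refl a b v x y) (lem a b vs xs ys)

  lin-⊡ : ∀ {n m} (φ : Vec (Pt F n) m) c u → lin φ (c ⊡ u) ≡ c ⊡ lin φ u
  lin-⊡ [] c [] = sym (⊡-zeroʳ c)
  lin-⊡ (v ∷ φ) c (a ∷ u) = trans (cong₂ _⊞_ (⊡-assoc c a v) (lin-⊡ φ c u)) (sym (⊡-distribˡ c _ _))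

  ΣΦ : ∀ {n} m → (Vec (Pt F n) m → ℕ) → ℕ
  ΣΦ {n} m = ∑ (elems (vecEnum (Gs n) m))

  card-Φ : ∀ n m → card (vecEnum (Gs n) m) ≡ (q ^ n) ^ m
  card-Φ n m = trans (card-vec (Gs n) m) (cong (_^ m) (card-G n))

  -- A map is the list of images of the basis vectors. At a nonzero coordinate of `w` that image
  -- runs over the whole space, and so does the value at `w`.
  lin-uniform : ∀ {n} m (w : Pt F m) → w ≢ 𝟎 → (g : Pt F n → ℕ) → q ^ n * ΣΦ m (λ φ → g (lin φ w)) ≡ (q ^ n) ^ m * ΣG g
  lin-uniform zero [] h g = contradiction refl h
  lin-uniform {n} (suc m) (a ∷ w) h g with a ≟ᶠ 0ᶠ
  ... | no a≢0 = begin
    N * ΣΦ (suc m) (λ φ → g (lin φ (a ∷ w))) ≡⟨ cong (N *_) (trans (∑-vec (Gs n) m _) (∑-swap (elems (Gs n)) Φ _)) ⟩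
    N * ∑ Φ (λ φ → ΣG (λ v → g (a ⊡ v ⊞ lin φ w)))
      ≡⟨ cong (N *_) (∑-cong Φ (λ φ → trans (ΣG-dilate a a≢0 (λ v → g (v ⊞ lin φ w))) (ΣG-shift (lin φ w) g))) ⟩
    N * ∑ Φ (λ φ → ΣG g) ≡⟨ cong (N *_) (trans (∑-const Φ _) (cong (_* ΣG g) (card-Φ n m))) ⟩
    N * (N ^ m * ΣG g) ≡⟨ sym (*-assoc N _ _) ⟩
    N * N ^ m * ΣG g ∎
    where
    open ≡-Reasoning
    N = q ^ n
    Φ = elems (vecEnum (Gs n) m)
  ... | yes refl = begin
    N * ΣΦ (suc m) (λ φ → g (lin φ (0ᶠ ∷ w))) ≡⟨ cong (N *_) (∑-vec (Gs n) m _) ⟩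
    N * ΣG (λ v → ∑ Φ (λ φ → g (0ᶠ ⊡ v ⊞ lin φ w)))
      ≡⟨ cong (N *_) (∑-cong (elems (Gs n)) (λ v → ∑-cong Φ (λ φ → cong g (trans (cong (_⊞ lin φ w) (⊡-zeroˡ v)) (⊞-identityˡ _))))) ⟩
    N * ΣG {n} (λ v → ∑ Φ (λ φ → g (lin φ w))) ≡⟨ cong (N *_) (ΣG-const n _) ⟩
    N * (N * ∑ Φ (λ φ → g (lin φ w))) ≡⟨ cong (N *_) (lin-uniform m w (λ e → h (cong (0ᶠ ∷_) e)) g) ⟩
    N * (N ^ m * ΣG g) ≡⟨ sym (*-assoc N _ _) ⟩
    N * N ^ m * ΣG g ∎
    where
    open ≡-Reasoning
    N = q ^ n
    Φ = elems (vecEnum (Gs n) m)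

  module _ (c₁ c₂ : Fin q) (b≢0 : c₁ +ᶠ c₂ ≢ 0ᶠ) where
    private
      b b' : Fin q
      b = c₁ +ᶠ c₂
      b' = inv b b≢0

    -- A weighted mean with weights c₁/b and c₂/b summing to 1; this is why it commutes with
    -- translations and linear maps.
    third : ∀ {n} → Pt F n → Pt F n → Pt F n
    third x y = b' ⊡ (c₁ ⊡ x ⊞ c₂ ⊡ y)

    third-translate : ∀ {n} (x y z : Pt F n) → z ⊞ third x y ≡ third (z ⊞ x) (z ⊞ y)
    third-translate [] [] [] = refl
    third-translate (x ∷ xs) (y ∷ ys) (z ∷ zs) = cong₂ _∷_ eq (third-translate xs ys zs)
      where
      open ≡-Reasoning
      eq : z +ᶠ b' *ᶠ (c₁ *ᶠ x +ᶠ c₂ *ᶠ y) ≡ b' *ᶠ (c₁ *ᶠ (z +ᶠ x) +ᶠ c₂ *ᶠ (z +ᶠ y))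
      eq = begin
        z +ᶠ b' *ᶠ (c₁ *ᶠ x +ᶠ c₂ *ᶠ y) ≡⟨ cong (_+ᶠ b' *ᶠ (c₁ *ᶠ x +ᶠ c₂ *ᶠ y)) (trans (sym (R.*-identityˡ z)) (cong (_*ᶠ z) (sym (inv-l b b≢0)))) ⟩
        (b' *ᶠ b) *ᶠ z +ᶠ b' *ᶠ (c₁ *ᶠ x +ᶠ c₂ *ᶠ y)
          ≡⟨ solve 6 (λ b' c₁ c₂ x y z → (b' :* (c₁ :+ c₂)) :* z :+ b' :* (c₁ :* x :+ c₂ :* y) := b' :* (c₁ :* (z :+ x) :+ c₂ :* (z :+ y))) refl b' c₁ c₂ x y z ⟩
        b' *ᶠ (c₁ *ᶠ (z +ᶠ x) +ᶠ c₂ *ᶠ (z +ᶠ y)) ∎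

    third-lin : ∀ {n m} (φ : Vec (Pt F n) m) u w → lin φ (third u w) ≡ third (lin φ u) (lin φ w)
    third-lin φ u w = trans (lin-⊡ φ b' _) (cong (b' ⊡_) (trans (lin-+ φ _ _) (cong₂ _⊞_ (lin-⊡ φ c₁ u) (lin-⊡ φ c₂ w))))

    third-unique : ∀ {n} (x y z : Pt F n) → c₁ ⊡ x ⊞ c₂ ⊡ y ⊞ (-ᶠ b) ⊡ z ≡ 𝟎 → third x y ≡ z
    third-unique [] [] [] e = refl
    third-unique (x ∷ xs) (y ∷ ys) (z ∷ zs) e = cong₂ _∷_ eq (third-unique xs ys zs (Vec.∷-injectiveʳ e))
      where
      open ≡-Reasoning
      s = c₁ *ᶠ x +ᶠ c₂ *ᶠ y
      eq : b' *ᶠ s ≡ z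
      eq = begin
        b' *ᶠ s ≡⟨ solve 4 (λ b' b s z → b' :* s := b' :* (s :+ (:- b) :* z) :+ (b' :* b) :* z) refl b' b s z ⟩
        b' *ᶠ (s +ᶠ (-ᶠ b) *ᶠ z) +ᶠ (b' *ᶠ b) *ᶠ z ≡⟨ cong₂ (λ u v → b' *ᶠ u +ᶠ v *ᶠ z) (Vec.∷-injectiveˡ e) (inv-l b b≢0) ⟩
        b' *ᶠ 0ᶠ +ᶠ 1ᶠ *ᶠ z ≡⟨ solve 2 (λ b' z → b' :* :0 :+ :1 :* z := z) refl b' z ⟩
        z ∎

    b⊡third : ∀ {n} (x y : Pt F n) → b ⊡ third x y ≡ c₁ ⊡ x ⊞ c₂ ⊡ y
    b⊡third x y = ⊡-inv b b≢0 _

    module _ {n} {S : Pt F n → Set} (S? : ∀ x → Dec (S x)) where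
      triple : Pt F n → Pt F n → ℕ
      triple x y = iv (S? x) * (iv (S? y) * iv (S? (third x y)))

      triples : ℕ
      triples = ΣG (λ x → ΣG (λ y → triple x y))

      triple-sum : ∀ m (u w : Pt F m) → w ≢ u →
        q ^ n * ΣΦ m (λ φ → ΣG (λ y → triple (y ⊞ lin φ u) (y ⊞ lin φ w))) ≡ (q ^ n) ^ m * triples
      triple-sum m u w w≢u = begin
        N * ∑ Φ (λ φ → ΣG (λ y → triple (y ⊞ lin φ u) (y ⊞ lin φ w)))
          ≡⟨ cong (N *_) (∑-cong Φ (λ φ → trans (∑-cong xs (λ y → cong (triple (y ⊞ lin φ u)) (differ φ y)))
               (ΣG-shift (lin φ u) (λ y → triple y (y ⊞ lin φ d))))) ⟩
        N * ∑ Φ (λ φ → ΣG (λ y → triple y (y ⊞ lin φ d))) ≡⟨ cong (N *_) (∑-swap Φ xs _) ⟩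
        N * ΣG (λ y → ∑ Φ (λ φ → triple y (y ⊞ lin φ d))) ≡⟨ sym (∑-*ˡ xs N _) ⟩
        ΣG (λ y → N * ∑ Φ (λ φ → triple y (y ⊞ lin φ d)))
          ≡⟨ ∑-cong xs (λ y → trans (lin-uniform m d d≢𝟎 (λ z → triple y (y ⊞ z))) (cong (N ^ m *_) (ΣG-shiftˡ y (triple y)))) ⟩
        ΣG (λ y → N ^ m * ΣG (triple y)) ≡⟨ ∑-*ˡ xs (N ^ m) _ ⟩
        N ^ m * triples ∎
        where
        open ≡-Reasoning
        N = q ^ n
        xs = elems (Gs n)
        Φ = elems (vecEnum (Gs n) m)
        d = w ⊞ ⊟ u
        d≢𝟎 : d ≢ 𝟎
        d≢𝟎 e = w≢u (trans (sym (add-sub w u)) (trans (cong (_⊞ u) e) (⊞-identityˡ u)))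
        differ : ∀ φ y → y ⊞ lin φ w ≡ (y ⊞ lin φ u) ⊞ lin φ d
        differ φ y = trans (cong (y ⊞_) (trans (cong (lin φ) (trans (sym (add-sub w u)) (⊞-comm d u))) (lin-+ φ u d))) (sym (⊞-assoc y _ _))

      -- Averaging over all affine maps u ↦ y + φ(u): a dense preimage of S contains a nontrivial
      -- solution, and each pair of distinct points is mapped uniformly.
      triples-bound : ∀ l → q ^ n ≤ 2 ^ l * ΣG (λ x → iv (S? x)) →
        q ^ n * q ^ n ≤ 2 ^ suc l * (q ^ (capDim * suc l) * q ^ (capDim * suc l)) * triples
      triples-bound l dense = *-cancelˡ-≤ (N ^ m) {{>-nonZero (1≤^ N m (1≤q^ n))}} (begin
        N ^ m * (N * N) ≡⟨ l₁ (N ^ m) N ⟩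
        N * (N ^ m * N) ≤⟨ *-monoʳ-≤ N (*-cancelˡ-≤ Q {{>-nonZero (1≤q^ m)}} (+-cancelˡ-≤ (N ^ m * (N * Q)) _ _ summed)) ⟩
        N * (2 ^ suc l * Ztotal) ≡⟨ l₂ N (2 ^ suc l) Ztotal ⟩
        2 ^ suc l * (N * Ztotal) ≤⟨ *-monoʳ-≤ (2 ^ suc l) Z-bound ⟩
        2 ^ suc l * (Q * Q * (N ^ m * triples)) ≡⟨ l₃ (2 ^ suc l) (Q * Q) (N ^ m) triples ⟩
        N ^ m * (2 ^ suc l * (Q * Q) * triples) ∎)
        where
        open ≤-Reasoning
        m = capDim * suc l
        N = q ^ n
        Q = q ^ m
        xs = elems (Gs n)
        us = elems (Gs m)
        Φ = elems (vecEnum (Gs n) m)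
        W : Vec (Pt F n) m → Pt F n → ℕ
        W φ y = ∑ us (λ u → iv (S? (y ⊞ lin φ u)))
        Z : Vec (Pt F n) m → Pt F n → ℕ
        Z φ y = ∑ us (λ u → ∑ us (λ w → iv (¬? (w ≟ᵛ u)) * triple (y ⊞ lin φ u) (y ⊞ lin φ w)))
        Ztotal = ∑ Φ (λ φ → ΣG (λ y → Z φ y))
        l₁ : ∀ a b → a * (b * b) ≡ b * (a * b)
        l₁ = solve-∀
        l₂ : ∀ a b c → a * (b * c) ≡ b * (a * c)
        l₂ = solve-∀
        l₃ : ∀ a b c d → a * (b * (c * d)) ≡ c * (a * b * d)
        l₃ = solve-∀
        Z-positive : ∀ φ y → Q ≤ 2 ^ suc l * W φ y → 1 ≤ Z φ y
        Z-positive φ y h with nontrivial-solution c₁ c₂ (-ᶠ b) (-≢0 b≢0) (R.-‿inverseʳ b) (suc l) (s≤s z≤n) (λ u → S? (y ⊞ lin φ u)) h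
        ... | u , w , z , su , sw , sz , e , u≢w = ≤-trans (≤-trans (≤-reflexive (sym one))
              (∑-term (λ w → iv (¬? (w ≟ᵛ u)) * triple (y ⊞ lin φ u) (y ⊞ lin φ w)) (Enum.complete (Gs m) w)))
              (∑-term (λ u → ∑ us (λ w → iv (¬? (w ≟ᵛ u)) * triple (y ⊞ lin φ u) (y ⊞ lin φ w))) (Enum.complete (Gs m) u))
          where
          s₃ : S (third (y ⊞ lin φ u) (y ⊞ lin φ w))
          s₃ = subst S (trans (cong (λ v → y ⊞ v) (trans (cong (lin φ) (sym (third-unique u w z e))) (third-lin φ u w))) (third-translate _ _ y)) sz
          one : iv (¬? (w ≟ᵛ u)) * triple (y ⊞ lin φ u) (y ⊞ lin φ w) ≡ 1
          one = cong₂ _*_ (iv-yes (¬? (w ≟ᵛ u)) (λ e → u≢w (sym e))) (cong₂ _*_ (iv-yes (S? _) su) (cong₂ _*_ (iv-yes (S? _) sw) (iv-yes (S? _) s₃)))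
        -- The threshold `2 ^ suc l` is half the mean density of the preimages, so the sparse
        -- preimages account for at most half of the sum, and `summed` cancels that half.
        pointwise : ∀ φ y → 2 ^ suc l * W φ y ≤ Q + 2 ^ suc l * Q * Z φ y
        pointwise φ y with 2 ^ suc l * W φ y ≤? Q
        ... | yes h = ≤-trans h (m≤m+n Q _)
        ... | no h = ≤-trans (*-monoʳ-≤ (2 ^ suc l) (ΣG-iv≤ (λ u → S? (y ⊞ lin φ u))))
               (≤-trans (≤-reflexive (sym (*-identityʳ _))) (≤-trans (*-monoʳ-≤ (2 ^ suc l * Q) (Z-positive φ y (<⇒≤ (≰⇒> h)))) (m≤n+m _ Q)))
        W-sum : ∑ Φ (λ φ → ΣG (W φ)) ≡ N ^ m * (Q * ΣG (λ x → iv (S? x)))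
        W-sum = trans (∑-cong Φ (λ φ → trans (∑-swap xs us _) (trans (∑-cong us (λ u → ΣG-shift (lin φ u) (λ x → iv (S? x)))) (ΣG-const m _))))
                      (trans (∑-const Φ _) (cong (_* (Q * ΣG (λ x → iv (S? x)))) (card-Φ n m)))
        summed : N ^ m * (N * Q) + Q * (N ^ m * N) ≤ N ^ m * (N * Q) + Q * (2 ^ suc l * Ztotal)
        summed = begin
          N ^ m * (N * Q) + Q * (N ^ m * N) ≡⟨ a₁ (N ^ m) N Q ⟩
          2 * (N ^ m * Q) * N ≤⟨ *-monoʳ-≤ (2 * (N ^ m * Q)) dense ⟩
          2 * (N ^ m * Q) * (2 ^ l * ΣG (λ x → iv (S? x))) ≡⟨ a₂ (N ^ m) Q (2 ^ l) (ΣG (λ x → iv (S? x))) ⟩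
          2 ^ suc l * (N ^ m * (Q * ΣG (λ x → iv (S? x)))) ≡⟨ cong (2 ^ suc l *_) (sym W-sum) ⟩
          2 ^ suc l * ∑ Φ (λ φ → ΣG (W φ)) ≡⟨ trans (sym (∑-*ˡ Φ (2 ^ suc l) _)) (∑-cong Φ (λ φ → sym (∑-*ˡ xs (2 ^ suc l) _))) ⟩
          ∑ Φ (λ φ → ΣG (λ y → 2 ^ suc l * W φ y)) ≤⟨ ∑-mono Φ (λ φ → ∑-mono xs (pointwise φ)) ⟩
          ∑ Φ (λ φ → ΣG (λ y → Q + 2 ^ suc l * Q * Z φ y))
            ≡⟨ ∑-cong Φ (λ φ → trans (∑-+ xs _ _) (cong₂ _+_ (ΣG-const n Q) (∑-*ˡ xs (2 ^ suc l * Q) _))) ⟩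
          ∑ Φ (λ φ → N * Q + 2 ^ suc l * Q * ΣG (Z φ))
            ≡⟨ trans (∑-+ Φ _ _) (cong₂ _+_ (trans (∑-const Φ _) (cong (_* (N * Q)) (card-Φ n m))) (∑-*ˡ Φ (2 ^ suc l * Q) _)) ⟩
          N ^ m * (N * Q) + 2 ^ suc l * Q * Ztotal ≡⟨ cong (N ^ m * (N * Q) +_) (a₃ (2 ^ suc l) Q Ztotal) ⟩
          N ^ m * (N * Q) + Q * (2 ^ suc l * Ztotal) ∎
          where
          a₁ : ∀ a b c → a * (b * c) + c * (a * b) ≡ 2 * (a * c) * b
          a₁ = solve-∀
          a₂ : ∀ a b c d → 2 * (a * b) * (c * d) ≡ 2 * c * (a * (b * d))
          a₂ = solve-∀
          a₃ : ∀ a b c → a * b * c ≡ b * (a * c)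
          a₃ = solve-∀
        Z-bound : N * Ztotal ≤ Q * Q * (N ^ m * triples)
        Z-bound = begin
          N * Ztotal ≡⟨ cong (N *_) (∑-cong Φ (λ φ → trans (∑-swap xs us _) (∑-cong us (λ u → trans (∑-swap xs us _) (∑-cong us (λ w → ∑-*ˡ xs (iv (¬? (w ≟ᵛ u))) _)))))) ⟩
          N * ∑ Φ (λ φ → ∑ us (λ u → ∑ us (λ w → iv (¬? (w ≟ᵛ u)) * ΣG (λ y → triple (y ⊞ lin φ u) (y ⊞ lin φ w)))))
            ≡⟨ cong (N *_) (trans (∑-swap Φ us _) (∑-cong us (λ u → trans (∑-swap Φ us _) (∑-cong us (λ w → ∑-*ˡ Φ (iv (¬? (w ≟ᵛ u))) _))))) ⟩
          N * ∑ us (λ u → ∑ us (λ w → iv (¬? (w ≟ᵛ u)) * ∑ Φ (λ φ → ΣG (λ y → triple (y ⊞ lin φ u) (y ⊞ lin φ w)))))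
            ≡⟨ trans (sym (∑-*ˡ us N _)) (∑-cong us (λ u → trans (sym (∑-*ˡ us N _)) (∑-cong us (λ w → l₂ N (iv (¬? (w ≟ᵛ u))) _)))) ⟩
          ∑ us (λ u → ∑ us (λ w → iv (¬? (w ≟ᵛ u)) * (N * ∑ Φ (λ φ → ΣG (λ y → triple (y ⊞ lin φ u) (y ⊞ lin φ w))))))
            ≤⟨ ∑-mono us (λ u → ∑-mono us (λ w → off u w)) ⟩
          ∑ us (λ u → ∑ us (λ w → N ^ m * triples)) ≡⟨ trans (ΣG-const m _) (cong (Q *_) (ΣG-const m _)) ⟩
          Q * (Q * (N ^ m * triples)) ≡⟨ sym (*-assoc Q Q _) ⟩
          Q * Q * (N ^ m * triples) ∎
          where
          off : ∀ u w → iv (¬? (w ≟ᵛ u)) * (N * ∑ Φ (λ φ → ΣG (λ y → triple (y ⊞ lin φ u) (y ⊞ lin φ w)))) ≤ N ^ m * triples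
          off u w with w ≟ᵛ u
          ... | yes _ = z≤n
          ... | no w≢u = ≤-reflexive (trans (*-identityˡ _) (triple-sum m u w w≢u))

      triples-dense : ∀ l → q ^ n ≤ 2 ^ l * ΣG (λ x → iv (S? x)) → q ^ n * q ^ n ≤ 2 ^ (tripleExponent * suc l) * triples
      triples-dense l dense = ≤-trans (triples-bound l dense) (*-monoˡ-≤ triples (begin
        2 ^ suc l * (q ^ m * q ^ m) ≤⟨ *-monoʳ-≤ (2 ^ suc l) (*-mono-≤ (q^≤2^ m) (q^≤2^ m)) ⟩
        2 ^ suc l * (2 ^ (q * m) * 2 ^ (q * m)) ≡⟨ trans (cong (2 ^ suc l *_) (sym (^-distribˡ-+-* 2 (q * m) (q * m)))) (sym (^-distribˡ-+-* 2 (suc l) _)) ⟩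
        2 ^ (suc l + (q * m + q * m)) ≡⟨ cong (2 ^_) (lem (suc l) q capDim) ⟩
        2 ^ (tripleExponent * suc l) ∎))
        where
        open ≤-Reasoning
        m = capDim * suc l
        lem : ∀ l q c → l + (q * (c * l) + q * (c * l)) ≡ suc (q * c + q * c) * l
        lem = solve-∀

  -- Supersaturation with polynomial dependence: density 2^(-l) yields a proportion 2^(-c(l+1)) of
  -- all tuples satisfying the equation. The exponent has `suc l` so that constant factors are
  -- absorbed when l = 0 as well.
  Super : List (Fin q) → Set₁
  Super cs = ∃ λ c → ∀ {n} {S : Pt F n → Set} (S? : ∀ x → Dec (S x)) l → q ^ n ≤ 2 ^ l * ΣG (λ x → iv (S? x)) →
    (q ^ n) ^ pred (length cs) ≤ 2 ^ (c * suc l) * reps (λ x → iv (S? x)) atZero cs 𝟎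

  super-perm : ∀ cs ds → length cs ≡ length ds → (∀ {n} (f base : Pt F n → ℕ) p → reps f base cs p ≡ reps f base ds p) →
               Super cs → Super ds
  super-perm cs ds len eq (c , h) = c , λ {n} S? l dense →
    subst₂ (λ k r → (q ^ n) ^ pred k ≤ 2 ^ (c * suc l) * r) len (eq (λ x → iv (S? x)) atZero 𝟎) (h S? l dense)

  -- Fix the value p left by the variables after the third. The merged equation says that for many p
  -- the admissible y, those with both y and the forced third variable `rest p (b ⊡ y)` in S, form a
  -- dense set. In that set the three-variable case finds x₁, x₂ and their weighted mean z with c₁x₁
  -- + c₂x₂ = bz; admissibility of z puts the same forced third variable in S. The exponent is that
  -- of the density of admissible y, plus `tripleExponent` applied to it.
  super-merge : ∀ c₁ c₂ c₃ cs → c₁ +ᶠ c₂ ≢ 0ᶠ → c₃ ≢ 0ᶠ → Super ((c₁ +ᶠ c₂) ∷ c₃ ∷ cs) → Super (c₁ ∷ c₂ ∷ c₃ ∷ cs)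
  super-merge c₁ c₂ c₃ cs b≢0 c₃≢0 (c , old) = c + 1 + tripleExponent * (c + 2) , new
    where
    b c₃' : Fin q
    b = c₁ +ᶠ c₂
    c₃' = inv c₃ c₃≢0
    -- The equation is split according to p, the value that b y + c₃ x takes in the merged equation
    -- and c₁ x₁ + c₂ x₂ + c₃ x in the full one.
    new : ∀ {n} {S : Pt F n → Set} (S? : ∀ x → Dec (S x)) l → q ^ n ≤ 2 ^ l * ΣG (λ x → iv (S? x)) →
      (q ^ n) ^ suc (suc (length cs)) ≤ 2 ^ ((c + 1 + tripleExponent * (c + 2)) * suc l) * reps (λ x → iv (S? x)) atZero (c₁ ∷ c₂ ∷ c₃ ∷ cs) 𝟎
    new {n} {S} S? l dense = +-cancelˡ-≤ (N * N * N ^ j) _ _ (begin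
      N * N * N ^ j + N ^ suc (suc j) ≡⟨ a₁ N (N ^ j) ⟩
      2 * N * N ^ suc j ≤⟨ *-monoʳ-≤ (2 * N) (old S? l dense) ⟩
      2 * N * (2 ^ E * Told) ≡⟨ a₂ N (2 ^ E) Told ⟩
      2 ^ suc E * N * Told ≡⟨ cong (2 ^ suc E * N *_) Told≡ ⟩
      2 ^ suc E * N * ΣG (λ p → κ p * size p) ≡⟨ sym (∑-*ˡ xs (2 ^ suc E * N) _) ⟩
      ΣG (λ p → 2 ^ suc E * N * (κ p * size p)) ≤⟨ ∑-mono xs pointwise ⟩
      ΣG (λ p → κ p * (N * N) + 2 ^ X * (κ p * pairs p)) ≡⟨ trans (∑-+ xs _ _) (cong₂ _+_ (∑-*ʳ xs (N * N) κ) (∑-*ˡ xs (2 ^ X) _)) ⟩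
      ΣG κ * (N * N) + 2 ^ X * ΣG (λ p → κ p * pairs p) ≤⟨ +-monoˡ-≤ _ (≤-trans (*-monoˡ-≤ (N * N) κ-total) (≤-reflexive (*-comm (N ^ j) (N * N)))) ⟩
      N * N * N ^ j + 2 ^ X * ΣG (λ p → κ p * pairs p) ≡⟨ cong (λ v → N * N * N ^ j + 2 ^ X * v) (sym Tnew≡) ⟩
      N * N * N ^ j + 2 ^ X * Tnew ≤⟨ +-monoʳ-≤ (N * N * N ^ j) (*-monoˡ-≤ Tnew (^-monoʳ-≤ 2 X-bound)) ⟩
      N * N * N ^ j + 2 ^ ((c + 1 + tripleExponent * (c + 2)) * suc l) * Tnew ∎)
      where
      open ≤-Reasoning
      N = q ^ n
      j = length cs
      xs = elems (Gs n)
      E = c * suc l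
      X = suc E + tripleExponent * suc (suc E)
      f : Pt F n → ℕ
      f x = iv (S? x)
      κ : Pt F n → ℕ
      κ = reps f atZero cs
      Told = reps f atZero (b ∷ c₃ ∷ cs) 𝟎
      Tnew = reps f atZero (c₁ ∷ c₂ ∷ c₃ ∷ cs) 𝟎
      a₁ : ∀ N P → N * N * P + N * (N * P) ≡ 2 * N * (N * P)
      a₁ = solve-∀
      a₂ : ∀ N P T → 2 * N * (P * T) ≡ 2 * P * N * T
      a₂ = solve-∀
      X-bound : X ≤ (c + 1 + tripleExponent * (c + 2)) * suc l
      X-bound = ≤-trans (m≤m+n X (l + tripleExponent * (l + l))) (≤-reflexive (lem c l tripleExponent))
        where lem : ∀ c l t → suc (c * suc l) + t * suc (suc (c * suc l)) + (l + t * (l + l)) ≡ (c + 1 + t * (c + 2)) * suc l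
              lem = solve-∀
      κ-total : ΣG κ ≤ N ^ j
      κ-total = ≤-trans (≤-reflexive (trans (ΣG-reps f atZero cs) (trans (cong (ΣG f ^ j *_) (∑-point1 (Gs n) 𝟎)) (*-identityʳ _)))) (^-monoˡ-≤ j (ΣG-iv≤ S?))
      rest : Pt F n → Pt F n → Pt F n
      rest p v = c₃' ⊡ (p ⊞ ⊟ v)
      rest? : ∀ p x → Dec (S x × S (rest p (b ⊡ x)))
      rest? p x = S? x ×-dec S? (rest p (b ⊡ x))
      size : Pt F n → ℕ
      size p = ΣG (λ x → iv (rest? p x))
      pairs : Pt F n → ℕ
      pairs p = ΣG (λ x → f x * ΣG (λ y → f y * f (rest p (c₁ ⊡ x ⊞ c₂ ⊡ y))))
      substitute : ∀ v → ΣG (λ x → f x * κ (v ⊞ c₃ ⊡ x)) ≡ ΣG (λ p → κ p * f (rest p v))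
      substitute v = begin-equality
        ΣG (λ x → f x * κ (v ⊞ c₃ ⊡ x)) ≡⟨ ∑-cong xs (λ x → trans (*-comm (f x) _) (cong (λ w → κ (v ⊞ c₃ ⊡ x) * f w) (sym (back x)))) ⟩
        ΣG (λ x → κ (v ⊞ c₃ ⊡ x) * f (rest (v ⊞ c₃ ⊡ x) v)) ≡⟨ ΣG-dilate c₃ c₃≢0 (λ x → κ (v ⊞ x) * f (rest (v ⊞ x) v)) ⟩
        ΣG (λ x → κ (v ⊞ x) * f (rest (v ⊞ x) v)) ≡⟨ ΣG-shiftˡ v (λ x → κ x * f (rest x v)) ⟩
        ΣG (λ p → κ p * f (rest p v)) ∎
        where
        back : ∀ x → rest (v ⊞ c₃ ⊡ x) v ≡ x
        back x = trans (cong (c₃' ⊡_) (trans (cong (_⊞ ⊟ v) (⊞-comm v _)) (sub-add _ v))) (inv-⊡ c₃ c₃≢0 x)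
      Told≡ : Told ≡ ΣG (λ p → κ p * size p)
      Told≡ = begin-equality
        ΣG (λ y → f y * ΣG (λ x → f x * κ ((𝟎 ⊞ b ⊡ y) ⊞ c₃ ⊡ x)))
          ≡⟨ ∑-cong xs (λ y → trans (cong (f y *_) (trans (cong (λ v → ΣG (λ x → f x * κ (v ⊞ c₃ ⊡ x))) (⊞-identityˡ _)) (substitute (b ⊡ y)))) (sym (∑-*ˡ xs (f y) _))) ⟩
        ΣG (λ y → ΣG (λ p → f y * (κ p * f (rest p (b ⊡ y))))) ≡⟨ ∑-swap xs xs _ ⟩
        ΣG (λ p → ΣG (λ y → f y * (κ p * f (rest p (b ⊡ y)))))
          ≡⟨ ∑-cong xs (λ p → trans (∑-cong xs (λ y → trans (exch (f y) (κ p) _) (cong (κ p *_) (sym (iv-× (S? y) (S? (rest p (b ⊡ y)))))))) (∑-*ˡ xs (κ p) _)) ⟩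
        ΣG (λ p → κ p * size p) ∎
        where exch : ∀ a b c → a * (b * c) ≡ b * (a * c)
              exch = solve-∀
      Tnew≡ : Tnew ≡ ΣG (λ p → κ p * pairs p)
      Tnew≡ = begin-equality
        ΣG (λ x → f x * ΣG (λ y → f y * ΣG (λ z → f z * κ (((𝟎 ⊞ c₁ ⊡ x) ⊞ c₂ ⊡ y) ⊞ c₃ ⊡ z))))
          ≡⟨ ∑-cong xs (λ x → cong (f x *_) (trans (∑-cong xs (λ y → trans (cong (f y *_)
               (trans (cong (λ v → ΣG (λ z → f z * κ ((v ⊞ c₂ ⊡ y) ⊞ c₃ ⊡ z))) (⊞-identityˡ _)) (substitute (c₁ ⊡ x ⊞ c₂ ⊡ y)))) (sym (∑-*ˡ xs (f y) _)))) (∑-swap xs xs _))) ⟩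
        ΣG (λ x → f x * ΣG (λ p → ΣG (λ y → f y * (κ p * f (rest p (c₁ ⊡ x ⊞ c₂ ⊡ y))))))
          ≡⟨ trans (∑-cong xs (λ x → sym (∑-*ˡ xs (f x) _))) (∑-swap xs xs _) ⟩
        ΣG (λ p → ΣG (λ x → f x * ΣG (λ y → f y * (κ p * f (rest p (c₁ ⊡ x ⊞ c₂ ⊡ y))))))
          ≡⟨ ∑-cong xs (λ p → trans (∑-cong xs (λ x → trans (cong (f x *_) (trans (∑-cong xs (λ y → exch (f y) (κ p) _)) (∑-*ˡ xs (κ p) _))) (exch (f x) (κ p) _))) (∑-*ˡ xs (κ p) _)) ⟩
        ΣG (λ p → κ p * pairs p) ∎
        where exch : ∀ a b c → a * (b * c) ≡ b * (a * c)
              exch = solve-∀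
      triples≤pairs : ∀ p → triples c₁ c₂ b≢0 (rest? p) ≤ pairs p
      triples≤pairs p = ∑-mono xs (λ x → ≤-trans (∑-mono xs (λ y → bound x y)) (≤-reflexive (∑-*ˡ xs (f x) _)))
        where
        bound : ∀ x y → triple c₁ c₂ b≢0 (rest? p) x y ≤ f x * (f y * f (rest p (c₁ ⊡ x ⊞ c₂ ⊡ y)))
        bound x y = *-mono-≤ (first x) (*-mono-≤ (first y) (≤-trans (second (third c₁ c₂ b≢0 x y)) (≤-reflexive (cong (λ v → f (rest p v)) (b⊡third c₁ c₂ b≢0 x y)))))
          where
          first : ∀ x → iv (rest? p x) ≤ f x
          first x = ≤-trans (≤-reflexive (iv-× (S? x) _)) (≤-trans (*-monoʳ-≤ (f x) (iv≤1 (S? (rest p (b ⊡ x))))) (≤-reflexive (*-identityʳ _)))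
          second : ∀ x → iv (rest? p x) ≤ f (rest p (b ⊡ x))
          second x = ≤-trans (≤-reflexive (iv-× (S? x) _)) (≤-trans (*-monoˡ-≤ _ (iv≤1 (S? x))) (≤-reflexive (*-identityˡ _)))
      pointwise : ∀ p → 2 ^ suc E * N * (κ p * size p) ≤ κ p * (N * N) + 2 ^ X * (κ p * pairs p)
      pointwise p = begin
        2 ^ suc E * N * (κ p * size p) ≡⟨ b₁ (2 ^ suc E) N (κ p) (size p) ⟩
        κ p * (2 ^ suc E * (N * size p)) ≤⟨ *-monoʳ-≤ (κ p) inner ⟩
        κ p * (N * N + 2 ^ X * pairs p) ≡⟨ b₂ (κ p) (N * N) (2 ^ X) (pairs p) ⟩
        κ p * (N * N) + 2 ^ X * (κ p * pairs p) ∎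
        where
        b₁ : ∀ a b c d → a * b * (c * d) ≡ c * (a * (b * d))
        b₁ = solve-∀
        b₂ : ∀ a b c d → a * (b + c * d) ≡ a * b + c * (a * d)
        b₂ = solve-∀
        b₃ : ∀ a b c → a * (b * c) ≡ b * (a * c)
        b₃ = solve-∀
        -- Sets of admissible values with density at most 2^(-E-1) are paid for by `N * N`; with
        -- `suc E` in place of `E` they make up at most half of the lower bound for the merged
        -- count.
        inner : 2 ^ suc E * (N * size p) ≤ N * N + 2 ^ X * pairs p
        inner with 2 ^ suc E * size p ≤? N
        ... | yes h = ≤-trans (≤-reflexive (b₃ (2 ^ suc E) N (size p))) (≤-trans (*-monoʳ-≤ N h) (m≤m+n _ _))
        ... | no h = ≤-trans (begin
              2 ^ suc E * (N * size p) ≤⟨ *-monoʳ-≤ (2 ^ suc E) (*-monoʳ-≤ N (ΣG-iv≤ (rest? p))) ⟩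
              2 ^ suc E * (N * N) ≤⟨ *-monoʳ-≤ (2 ^ suc E) (triples-dense c₁ c₂ b≢0 (rest? p) (suc E) (<⇒≤ (≰⇒> h))) ⟩
              2 ^ suc E * (2 ^ (tripleExponent * suc (suc E)) * triples c₁ c₂ b≢0 (rest? p)) ≤⟨ *-monoʳ-≤ (2 ^ suc E) (*-monoʳ-≤ (2 ^ (tripleExponent * suc (suc E))) (triples≤pairs p)) ⟩
              2 ^ suc E * (2 ^ (tripleExponent * suc (suc E)) * pairs p) ≡⟨ trans (sym (*-assoc (2 ^ suc E) _ _)) (cong (_* pairs p) (sym (^-distribˡ-+-* 2 (suc E) _))) ⟩
              2 ^ X * pairs p ∎) (m≤n+m _ (N * N))

  sumᶠ : List (Fin q) → Fin q
  sumᶠ = foldr _+ᶠ_ 0ᶠ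

  module _ (2≢0 : 1ᶠ +ᶠ 1ᶠ ≢ 0ᶠ) where
    -- Some two of three nonzero elements have a nonzero sum.
    super : ∀ c₁ c₂ cs → All (_≢ 0ᶠ) (c₁ ∷ c₂ ∷ cs) → sumᶠ (c₁ ∷ c₂ ∷ cs) ≡ 0ᶠ → Super (c₁ ∷ c₂ ∷ cs)
    super c₁ c₂ [] _ s≡0 = 1 , λ {n} {S} S? l dense → begin
      q ^ n * 1 ≡⟨ *-identityʳ _ ⟩
      q ^ n ≤⟨ dense ⟩
      2 ^ l * ΣG (λ x → iv (S? x)) ≤⟨ *-mono-≤ (^-monoʳ-≤ 2 (≤-trans (n≤1+n l) (≤-reflexive (sym (*-identityˡ (suc l)))))) (∑-mono (elems (Gs n)) (diagonal S?)) ⟩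
      2 ^ (1 * suc l) * reps (λ x → iv (S? x)) atZero (c₁ ∷ c₂ ∷ []) 𝟎 ∎
      where
      open ≤-Reasoning
      cancels : ∀ {n} (x : Pt F n) → (𝟎 ⊞ c₁ ⊡ x) ⊞ c₂ ⊡ x ≡ 𝟎
      cancels x = trans (cong (_⊞ c₂ ⊡ x) (⊞-identityˡ _)) (trans (sym (⊡-distribʳ c₁ c₂ x))
        (trans (cong (_⊡ x) (trans (cong (c₁ +ᶠ_) (sym (R.+-identityʳ c₂))) s≡0)) (⊡-zeroˡ x)))
      diagonal : ∀ {n} {S : Pt F n → Set} (S? : ∀ x → Dec (S x)) x →
                 iv (S? x) ≤ iv (S? x) * ΣG (λ y → iv (S? y) * atZero ((𝟎 ⊞ c₁ ⊡ x) ⊞ c₂ ⊡ y))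
      diagonal {n} S? x with S? x in eq
      ... | no _ = z≤n
      ... | yes s = ≤-trans (≤-trans (≤-reflexive (sym (cong₂ _*_ (iv-yes (S? x) s) (iv-yes (_ ≟ᵛ 𝟎) (cancels x)))))
                     (∑-term (λ y → iv (S? y) * atZero ((𝟎 ⊞ c₁ ⊡ x) ⊞ c₂ ⊡ y)) (Enum.complete (Gs n) x))) (≤-reflexive (sym (*-identityˡ _)))
    super c₁ c₂ (c₃ ∷ cs) (n₁ ∷ n₂ ∷ n₃ ∷ ns) s≡0 with (c₁ +ᶠ c₂) ≟ᶠ 0ᶠ | (c₁ +ᶠ c₃) ≟ᶠ 0ᶠ | (c₂ +ᶠ c₃) ≟ᶠ 0ᶠ
    ... | no b≢0 | _ | _ = super-merge c₁ c₂ c₃ cs b≢0 n₃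
          (super (c₁ +ᶠ c₂) c₃ cs (b≢0 ∷ n₃ ∷ ns) (trans (R.+-assoc c₁ c₂ _) s≡0))
    ... | yes _ | no b≢0 | _ = super-perm (c₁ ∷ c₃ ∷ c₂ ∷ cs) (c₁ ∷ c₂ ∷ c₃ ∷ cs) refl (λ f base → reps-cons-cong f base c₁ (c₃ ∷ c₂ ∷ cs) (c₂ ∷ c₃ ∷ cs) (reps-swap f base c₃ c₂ cs))
          (super-merge c₁ c₃ c₂ cs b≢0 n₂ (super (c₁ +ᶠ c₃) c₂ cs (b≢0 ∷ n₂ ∷ ns)
            (trans (solve 4 (λ a b c d → (a :+ c) :+ (b :+ d) := a :+ (b :+ (c :+ d))) refl c₁ c₂ c₃ (sumᶠ cs)) s≡0)))
    ... | yes _ | yes _ | no b≢0 = super-perm (c₂ ∷ c₃ ∷ c₁ ∷ cs) (c₁ ∷ c₂ ∷ c₃ ∷ cs) refl (λ f base p → trans (reps-cons-cong f base c₂ (c₃ ∷ c₁ ∷ cs) (c₁ ∷ c₃ ∷ cs) (reps-swap f base c₃ c₁ cs) p) (reps-swap f base c₂ c₁ (c₃ ∷ cs) p))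
          (super-merge c₂ c₃ c₁ cs b≢0 n₁ (super (c₂ +ᶠ c₃) c₁ cs (b≢0 ∷ n₁ ∷ ns)
            (trans (solve 4 (λ a b c d → (b :+ c) :+ (a :+ d) := a :+ (b :+ (c :+ d))) refl c₁ c₂ c₃ (sumᶠ cs)) s≡0)))
    -- Twice c₁ is (c₁+c₂) + (c₁+c₃) - (c₂+c₃). This is where odd characteristic enters.
    ... | yes e₁₂ | yes e₁₃ | yes e₂₃ = contradiction
          (trans (solve 3 (λ a b c → (:1 :+ :1) :* a := ((a :+ b) :+ (a :+ c)) :+ (:- (b :+ c))) refl c₁ c₂ c₃)
            (trans (cong₂ (λ u v → u +ᶠ -ᶠ v) (cong₂ _+ᶠ_ e₁₂ e₁₃) e₂₃) (solve 0 ((:0 :+ :0) :+ (:- :0) := :0) refl)))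
          (*-≢0 2≢0 n₁)

-- Moments of K_{s,t}-free sets

lookup-injective : ∀ {A : Set} {xs : List A} → Unique xs → ∀ i j → lookup xs i ≡ lookup xs j → i ≡ j
lookup-injective (_ ∷ _) fzero fzero e = refl
lookup-injective {xs = _ ∷ xs} (x∉ ∷ _) fzero (fsuc j) e = contradiction e (All.lookup x∉ (∈-lookup {xs = xs} j))
lookup-injective {xs = _ ∷ xs} (x∉ ∷ _) (fsuc i) fzero e = contradiction (sym e) (All.lookup x∉ (∈-lookup {xs = xs} i))
lookup-injective (_ ∷ u) (fsuc i) (fsuc j) e = cong fsuc (lookup-injective u i j e)

falling : ℕ → ℕ → ℕ
falling m zero = 1
falling m (suc j) = m * falling (pred m) j

-- Each factor e - i with i < s ≤ e is at least e/s.
power≤falling : ∀ s e → s ≤ e → ∀ i j → i + j ≤ s → e ^ j ≤ s ^ j * falling (e ∸ i) j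
power≤falling s e s≤e i zero h = ≤-refl
power≤falling s e s≤e i (suc j) h = begin
  e * e ^ j ≤⟨ *-mono-≤ head (power≤falling s e s≤e (suc i) j (≤-trans (≤-reflexive (sym (+-suc i j))) h)) ⟩
  s * (e ∸ i) * (s ^ j * falling (e ∸ suc i) j) ≡⟨ lem s (e ∸ i) (s ^ j) _ ⟩
  s * s ^ j * ((e ∸ i) * falling (e ∸ suc i) j) ≡⟨ cong (λ v → s * s ^ j * ((e ∸ i) * falling v j)) (sym (pred[m∸n]≡m∸[1+n] e i)) ⟩
  s * s ^ j * ((e ∸ i) * falling (pred (e ∸ i)) j) ∎
  where
  open ≤-Reasoning
  lem : ∀ a b c d → a * b * (c * d) ≡ a * c * (b * d)
  lem = solve-∀
  i<s : suc i ≤ s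
  i<s = ≤-trans (≤-trans (s≤s (m≤m+n i j)) (≤-reflexive (sym (+-suc i j)))) h
  i≤e : i ≤ e
  i≤e = ≤-trans (n≤1+n i) (≤-trans i<s s≤e)
  head : e ≤ s * (e ∸ i)
  head = begin
    e ≡⟨ sym (m∸n+n≡m i≤e) ⟩
    (e ∸ i) + i ≤⟨ +-monoʳ-≤ (e ∸ i) (≤-trans (≤-reflexive (sym (*-identityʳ i))) (*-mono-≤ (pred-mono-≤ i<s) (m<n⇒0<n∸m (≤-trans i<s s≤e)))) ⟩
    (e ∸ i) + pred s * (e ∸ i) ≡⟨⟩
    suc (pred s) * (e ∸ i) ≡⟨ cong (_* (e ∸ i)) (suc-pred s {{>-nonZero (≤-trans (s≤s z≤n) i<s)}}) ⟩
    s * (e ∸ i) ∎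

-- Numbers e below s R contribute to the first term, larger ones to the second.
square≤falling : ∀ s' R e → 1 ≤ R → let s = suc (suc s') in
  R ^ s' * (e * e) ≤ s * s * R ^ s + s ^ s * falling e s
square≤falling s' R e 1≤R with e ≤? suc (suc s') * R
... | yes h = ≤-trans (≤-trans (*-monoʳ-≤ (R ^ s') (*-mono-≤ h h)) (≤-reflexive (lem (suc (suc s')) R (R ^ s')))) (m≤m+n _ _)
  where lem : ∀ s R P → P * (s * R * (s * R)) ≡ s * s * (R * (R * P))
        lem = solve-∀
... | no h = ≤-trans (begin
    R ^ s' * (e * e) ≤⟨ *-monoˡ-≤ (e * e) (^-monoˡ-≤ s' (≤-trans (m≤n*m R s) sR≤e)) ⟩
    e ^ s' * (e * e) ≡⟨ lem e (e ^ s') ⟩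
    e * (e * e ^ s') ≤⟨ power≤falling s e (≤-trans (≤-trans (≤-reflexive (sym (*-identityʳ s))) (*-monoʳ-≤ s 1≤R)) sR≤e) 0 s ≤-refl ⟩
    s ^ s * falling e s ∎) (m≤n+m _ _)
  where
  open ≤-Reasoning
  s = suc (suc s')
  sR≤e : s * R ≤ e
  sR≤e = <⇒≤ (≰⇒> h)
  lem : ∀ e P → P * (e * e) ≡ e * (e * P)
  lem = solve-∀

module KovariSosTuran {q : ℕ} (F : FiniteField q) {n : ℕ} {A : Pt F n → Set} (A? : ∀ x → Dec (A x)) (s t : ℕ)
  (free : ¬ (Σ (Fin s → Pt F n) λ x → Σ (Fin t → Pt F n) λ y →
     Injective _≡_ _≡_ x × Injective _≡_ _≡_ y × (∀ i j → A (_⊕_ F (x i) (y j))))) where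
  open Geometry F
  open GroupSums F

  private
    xs = elems (Gs n)

    common? : ∀ L y → Dec (All (λ l → A (l ⊞ y)) L)
    common? L y = all? (λ l → A? (l ⊞ y)) L

    fresh? : ∀ (x : Pt F n) L → Dec (All (x ≢_) L)
    fresh? x L = all? (λ l → ¬? (x ≟ᵛ l)) L

    common-count : ∀ L → Unique L → length L ≡ s → ΣG (λ y → iv (common? L y)) ≤ t
    common-count L unique-L len = ≮⇒≥ λ t< → free (x , y t< , x-injective , y-injective t< , hit t<)
      where
      ys = filter (common? L) xs
      x : Fin s → Pt F n
      x i = lookup L (subst Fin (sym len) i)
      x-injective : Injective _≡_ _≡_ x
      x-injective {i} {j} e = subst-injective (sym len) (lookup-injective unique-L _ _ e)
      module _ (t< : t < ΣG (λ y → iv (common? L y))) where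
        t≤ : t ≤ length ys
        t≤ = ≤-trans (<⇒≤ t<) (≤-reflexive (sym (length-filter (common? L) xs)))
        y : Fin t → Pt F n
        y j = lookup ys (inject≤ j t≤)
        y-injective : Injective _≡_ _≡_ y
        y-injective {i} {j} e = Fin.inject≤-injective t≤ t≤ i j (lookup-injective (Unique.filter⁺ (common? L) (Enum.unique (Gs n))) _ _ e)
        hit : ∀ i j → A (x i ⊞ y j)
        hit i j = All.lookup (proj₂ (∈-filter⁻ (common? L) {xs = xs} (∈-lookup {xs = ys} (inject≤ j t≤)))) (∈-lookup {xs = L} (subst Fin (sym len) i))

  module _ {X : Pt F n → Set} (X? : ∀ x → Dec (X x)) where
    size : ℕ
    size = ΣG (λ x → iv (X? x))

    incidence : Pt F n → ℕ
    incidence y = ΣG (λ x → iv (X? x) * iv (A? (x ⊞ y)))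

    private
      -- Counts the ordered choices of `j` distinct points x of X outside `L` with x + y in A;
      -- unlike `falling`, it can be summed over y first.
      tuples : ℕ → List (Pt F n) → Pt F n → ℕ
      tuples zero L y = 1
      tuples (suc j) L y = ΣG (λ x → (iv (X? x) * iv (A? (x ⊞ y))) * (iv (fresh? x L) * tuples j (x ∷ L) y))

      avoid : ∀ L y → incidence y ≤ ΣG (λ x → (iv (X? x) * iv (A? (x ⊞ y))) * iv (fresh? x L)) + length L
      avoid L y = begin
        incidence y ≤⟨ ∑-mono xs (λ x → split (iv (X? x) * iv (A? (x ⊞ y))) (*-mono-≤ (iv≤1 (X? x)) (iv≤1 (A? (x ⊞ y)))) x L) ⟩
        ΣG (λ x → (iv (X? x) * iv (A? (x ⊞ y))) * iv (fresh? x L) + ∑ L (λ l → iv (x ≟ᵛ l))) ≡⟨ ∑-+ xs _ _ ⟩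
        ΣG (λ x → (iv (X? x) * iv (A? (x ⊞ y))) * iv (fresh? x L)) + ΣG (λ x → ∑ L (λ l → iv (x ≟ᵛ l)))
          ≡⟨ cong (ΣG (λ x → (iv (X? x) * iv (A? (x ⊞ y))) * iv (fresh? x L)) +_) (trans (∑-swap xs L _) (trans (∑-cong L (λ l → ∑-point1 (Gs n) l)) (∑-1-length L))) ⟩
        ΣG (λ x → (iv (X? x) * iv (A? (x ⊞ y))) * iv (fresh? x L)) + length L ∎
        where
        open ≤-Reasoning
        split : ∀ c → c ≤ 1 → ∀ x L → c ≤ c * iv (fresh? x L) + ∑ L (λ l → iv (x ≟ᵛ l))
        split c c≤1 x L with fresh? x L
        ... | yes _ = ≤-trans (≤-reflexive (sym (*-identityʳ c))) (m≤m+n _ _)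
        ... | no ¬fresh = ≤-trans c≤1 (≤-trans (hit L ¬fresh) (m≤n+m _ _))
          where
          hit : ∀ L → ¬ All (x ≢_) L → 1 ≤ ∑ L (λ l → iv (x ≟ᵛ l))
          hit [] h = contradiction [] h
          hit (l ∷ L) h with x ≟ᵛ l
          ... | yes _ = s≤s z≤n
          ... | no x≢l = hit L (λ a → h (x≢l ∷ a))

      falling≤tuples : ∀ j L y → falling (incidence y ∸ length L) j ≤ tuples j L y
      falling≤tuples zero L y = ≤-refl
      falling≤tuples (suc j) L y = begin
        (incidence y ∸ length L) * falling (pred (incidence y ∸ length L)) j
          ≤⟨ *-mono-≤ (≤-trans (∸-monoˡ-≤ (length L) (avoid L y)) (≤-reflexive (m+n∸n≡m _ (length L))))
                      (≤-reflexive (cong (λ v → falling v j) (pred[m∸n]≡m∸[1+n] (incidence y) (length L)))) ⟩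
        ΣG (λ x → (iv (X? x) * iv (A? (x ⊞ y))) * iv (fresh? x L)) * falling (incidence y ∸ suc (length L)) j ≡⟨ sym (∑-*ʳ xs _ _) ⟩
        ΣG (λ x → (iv (X? x) * iv (A? (x ⊞ y))) * iv (fresh? x L) * falling (incidence y ∸ suc (length L)) j)
          ≤⟨ ∑-mono xs (λ x → ≤-trans (≤-reflexive (*-assoc (iv (X? x) * iv (A? (x ⊞ y))) _ _))
               (*-monoʳ-≤ (iv (X? x) * iv (A? (x ⊞ y))) (*-monoʳ-≤ (iv (fresh? x L)) (falling≤tuples j (x ∷ L) y)))) ⟩
        tuples (suc j) L y ∎
        where open ≤-Reasoning

      -- Each chosen x moves its incidence condition into `common?`. Once `L` holds s distinct
      -- points, freeness leaves at most t values of y, whence the Kővári-Sós-Turán double count.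
      tuples-count : ∀ j L → Unique L → j + length L ≡ s → ΣG (λ y → iv (common? L y) * tuples j L y) ≤ t * size ^ j
      tuples-count zero L u len = ≤-trans (≤-reflexive (∑-cong xs (λ y → *-identityʳ _))) (≤-trans (common-count L u len) (≤-reflexive (sym (*-identityʳ t))))
      tuples-count (suc j) L u len = begin
        ΣG (λ y → iv (common? L y) * tuples (suc j) L y) ≡⟨ trans (∑-cong xs (λ y → sym (∑-*ˡ xs (iv (common? L y)) _))) (∑-swap xs xs _) ⟩
        ΣG (λ x → ΣG (λ y → iv (common? L y) * ((iv (X? x) * iv (A? (x ⊞ y))) * (iv (fresh? x L) * tuples j (x ∷ L) y))))
          ≡⟨ ∑-cong xs (λ x → trans (∑-cong xs (λ y → trans (lem (iv (common? L y)) (iv (X? x)) (iv (A? (x ⊞ y))) (iv (fresh? x L)) (tuples j (x ∷ L) y))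
               (cong (λ v → iv (X? x) * iv (fresh? x L) * (v * tuples j (x ∷ L) y)) (grow x y)))) (∑-*ˡ xs (iv (X? x) * iv (fresh? x L)) _)) ⟩
        ΣG (λ x → iv (X? x) * iv (fresh? x L) * ΣG (λ y → iv (common? (x ∷ L) y) * tuples j (x ∷ L) y)) ≤⟨ ∑-mono xs bound ⟩
        ΣG (λ x → iv (X? x) * (t * size ^ j)) ≡⟨ ∑-*ʳ xs _ _ ⟩
        size * (t * size ^ j) ≡⟨ lem₂ size t (size ^ j) ⟩
        t * size ^ suc j ∎
        where
        open ≤-Reasoning
        lem : ∀ c x a f T → c * ((x * a) * (f * T)) ≡ x * f * ((a * c) * T)
        lem = solve-∀
        lem₂ : ∀ a b c → a * (b * c) ≡ b * (a * c)
        lem₂ = solve-∀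
        grow : ∀ x y → iv (A? (x ⊞ y)) * iv (common? L y) ≡ iv (common? (x ∷ L) y)
        grow x y = trans (sym (iv-× (A? (x ⊞ y)) (common? L y))) (iv-cong (A? (x ⊞ y) ×-dec common? L y) (common? (x ∷ L) y) (λ { (a , b) → a ∷ b }) (λ { (a ∷ b) → a , b }))
        bound : ∀ x → iv (X? x) * iv (fresh? x L) * ΣG (λ y → iv (common? (x ∷ L) y) * tuples j (x ∷ L) y) ≤ iv (X? x) * (t * size ^ j)
        bound x with fresh? x L
        ... | no _ = ≤-trans (≤-reflexive (cong (_* ΣG (λ y → iv (common? (x ∷ L) y) * tuples j (x ∷ L) y)) (*-zeroʳ (iv (X? x))))) z≤n
        ... | yes fr = ≤-trans (≤-reflexive (cong (_* ΣG (λ y → iv (common? (x ∷ L) y) * tuples j (x ∷ L) y)) (*-identityʳ (iv (X? x)))))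
              (*-monoʳ-≤ (iv (X? x)) (tuples-count j (x ∷ L) (fr ∷ u) (trans (+-suc j (length L)) len)))

    falling-moment : ΣG (λ y → falling (incidence y) s) ≤ t * size ^ s
    falling-moment = ≤-trans (∑-mono xs (λ y → ≤-trans (falling≤tuples s [] y) (≤-reflexive (sym (*-identityˡ _))))) (tuples-count s [] [] (+-identityʳ s))

    module _ (s' : ℕ) (s≡ : s ≡ suc (suc s')) (M : ℕ) (M^s≤N : M ^ s ≤ q ^ n) where
      momentConstant : ℕ → ℕ
      momentConstant C = s * s + s ^ s * (t * C ^ s)

      -- With |X| at most CRM and M^s ≤ N, the falling moment is at most a constant times N R^s;
      -- `square≤falling` lowers the exponent from s to 2. It is used for X = A, where the left side
      -- is the additive energy, and for X = H, where it is the second moment of the coset counts.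
      second-moment : ∀ C R → 1 ≤ R → size ≤ C * R * M →
        ΣG (λ y → incidence y * incidence y) ≤ momentConstant C * (q ^ n * (R * R))
      second-moment C R 1≤R h = *-cancelˡ-≤ (R ^ s') {{>-nonZero (1≤^ R s' 1≤R)}} (begin
        R ^ s' * ΣG (λ y → incidence y * incidence y) ≡⟨ sym (∑-*ˡ xs (R ^ s') _) ⟩
        ΣG (λ y → R ^ s' * (incidence y * incidence y))
          ≤⟨ ∑-mono xs (λ y → subst (λ s → R ^ s' * (incidence y * incidence y) ≤ s * s * R ^ s + s ^ s * falling (incidence y) s) (sym s≡) (square≤falling s' R (incidence y) 1≤R)) ⟩
        ΣG (λ y → s * s * R ^ s + s ^ s * falling (incidence y) s) ≡⟨ trans (∑-+ xs _ _) (cong₂ _+_ (ΣG-const n _) (∑-*ˡ xs (s ^ s) _)) ⟩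
        N * (s * s * R ^ s) + s ^ s * ΣG (λ y → falling (incidence y) s) ≤⟨ +-monoʳ-≤ (N * (s * s * R ^ s)) (*-monoʳ-≤ (s ^ s) tail) ⟩
        N * (s * s * R ^ s) + s ^ s * (t * (C ^ s * R ^ s * N)) ≡⟨ lem N (s * s) (R ^ s) (s ^ s) t (C ^ s) ⟩
        momentConstant C * (N * R ^ s) ≡⟨ cong (λ v → momentConstant C * (N * R ^ v)) s≡ ⟩
        momentConstant C * (N * (R * (R * R ^ s'))) ≡⟨ lem₂ (momentConstant C) N R (R ^ s') ⟩
        R ^ s' * (momentConstant C * (N * (R * R))) ∎)
        where
        open ≤-Reasoning
        N = q ^ n
        lem : ∀ N a b c t d → N * (a * b) + c * (t * (d * b * N)) ≡ (a + c * (t * d)) * (N * b)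
        lem = solve-∀
        lem₂ : ∀ c N R P → c * (N * (R * (R * P))) ≡ P * (c * (N * (R * R)))
        lem₂ = solve-∀
        tail : ΣG (λ y → falling (incidence y) s) ≤ t * (C ^ s * R ^ s * N)
        tail = ≤-trans falling-moment (*-monoʳ-≤ t (begin
          size ^ s ≤⟨ ^-monoˡ-≤ s h ⟩
          (C * R * M) ^ s ≡⟨ trans (*-^ (C * R) M s) (cong (_* M ^ s) (*-^ C R s)) ⟩
          C ^ s * R ^ s * M ^ s ≤⟨ *-monoʳ-≤ (C ^ s * R ^ s) M^s≤N ⟩
          C ^ s * R ^ s * N ∎))

  -- The falling moment for X the whole space, where every incidence equals |A|, gives |A|^s N ≤ s^s
  -- t N^s.
  size-bound : 1 ≤ s → 1 ≤ t → ∀ M → M ^ s ≤ q ^ n → size A? * M ≤ s * t * q ^ n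
  size-bound 1≤s 1≤t M h = ^-cancelˡ-≤ s (size A? * M) (s * t * q ^ n) 1≤s (begin
    (a * M) ^ s ≡⟨ *-^ a M s ⟩
    a ^ s * M ^ s ≤⟨ *-monoʳ-≤ (a ^ s) h ⟩
    a ^ s * N ≤⟨ main ⟩
    s ^ s * t * N ^ s ≤⟨ *-monoˡ-≤ (N ^ s) (*-monoʳ-≤ (s ^ s) (≤-trans (≤-reflexive (sym (^-identityʳ t))) (^-monoʳ-≤ t {{>-nonZero 1≤t}} 1≤s))) ⟩
    s ^ s * t ^ s * N ^ s ≡⟨ trans (cong (_* N ^ s) (sym (*-^ s t s))) (sym (*-^ (s * t) N s)) ⟩
    (s * t * N) ^ s ∎)
    where
    open ≤-Reasoning
    N = q ^ n
    a = size A?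
    ^-cancelˡ-≤ : ∀ s x y → 1 ≤ s → x ^ s ≤ y ^ s → x ≤ y
    ^-cancelˡ-≤ s x y 1≤s le = ≮⇒≥ λ y<x → <⇒≱ (^-monoˡ-< s {{>-nonZero 1≤s}} y<x) le
    all-G? : ∀ (x : Pt F n) → Dec (x ≡ x)
    all-G? x = yes refl
    incidence-all : ∀ y → incidence all-G? y ≡ a
    incidence-all y = trans (∑-cong xs (λ x → *-identityˡ _)) (ΣG-shift y (λ x → iv (A? x)))
    main : a ^ s * N ≤ s ^ s * t * N ^ s
    main with s ≤? a
    ... | yes s≤a = begin
          a ^ s * N ≤⟨ *-monoˡ-≤ N (power≤falling s a s≤a 0 s ≤-refl) ⟩
          s ^ s * falling a s * N ≡⟨ trans (*-assoc (s ^ s) _ N) (cong (s ^ s *_) (trans (*-comm _ N) (trans (sym (ΣG-const n (falling a s))) (∑-cong xs (λ y → cong (λ v → falling v s) (sym (incidence-all y))))))) ⟩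
          s ^ s * ΣG (λ y → falling (incidence all-G? y) s) ≤⟨ *-monoʳ-≤ (s ^ s) (falling-moment all-G?) ⟩
          s ^ s * (t * size all-G? ^ s) ≡⟨ trans (sym (*-assoc (s ^ s) t _)) (cong (λ v → s ^ s * t * v ^ s) (card-G n)) ⟩
          s ^ s * t * N ^ s ∎
    ... | no s≰a = *-mono-≤ (≤-trans (^-monoˡ-≤ s (<⇒≤ (≰⇒> s≰a))) (≤-trans (≤-reflexive (sym (*-identityʳ _))) (*-monoʳ-≤ (s ^ s) 1≤t)))
                     (≤-trans (≤-reflexive (sym (^-identityʳ N))) (^-monoʳ-≤ N {{>-nonZero (1≤q^ n)}} 1≤s))

open import Data.Integer using (ℤ; +_; ∣_∣; +≤+)

-- Character sums

module ZS = Sum ℤ.+-*-isCommutativeSemiring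

module _ {A : Set} where
  ∑-pos : ∀ (xs : List A) (f : A → ℕ) → + ∑ xs f ≡ ZS.∑ xs (λ x → + f x)
  ∑-pos [] f = refl
  ∑-pos (x ∷ xs) f = trans (ℤ.pos-+ (f x) _) (cong (ℤ._+_ (+ f x)) (∑-pos xs f))

  ∣∑∣≤ : ∀ (xs : List A) (f : A → ℤ) → ∣ ZS.∑ xs f ∣ ≤ ∑ xs (λ x → ∣ f x ∣)
  ∣∑∣≤ [] f = z≤n
  ∣∑∣≤ (x ∷ xs) f = ≤-trans (ℤ.∣i+j∣≤∣i∣+∣j∣ (f x) _) (+-monoʳ-≤ ∣ f x ∣ (∣∑∣≤ xs f))

  ∑-≤ᶻ : ∀ (xs : List A) {f g : A → ℤ} → (∀ x → f x ℤ.≤ g x) → ZS.∑ xs f ℤ.≤ ZS.∑ xs g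
  ∑-≤ᶻ [] h = ℤ.≤-refl
  ∑-≤ᶻ (x ∷ xs) h = ℤ.+-mono-≤ (h x) (∑-≤ᶻ xs h)

  maximum : List A → (A → ℕ) → ℕ
  maximum xs f = foldr (λ x → f x ⊔_) 0 xs

  maximum-upper : ∀ {xs : List A} (f : A → ℕ) {x} → x ∈ xs → f x ≤ maximum xs f
  maximum-upper f (here refl) = m≤m⊔n _ _
  maximum-upper {y ∷ xs} f (there x∈) = ≤-trans (maximum-upper f x∈) (m≤n⊔m (f y) _)

  maximum-square : ∀ (xs : List A) (f : A → ℕ) → maximum xs f * maximum xs f ≤ ∑ xs (λ x → f x * f x)
  maximum-square [] f = z≤n
  maximum-square (x ∷ xs) f with ≤-total (f x) (maximum xs f)
  ... | inj₁ h = subst (λ m → m * m ≤ f x * f x + ∑ xs (λ x → f x * f x)) (sym (m≤n⇒m⊔n≡n h)) (≤-trans (maximum-square xs f) (m≤n+m _ _))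
  ... | inj₂ h = subst (λ m → m * m ≤ f x * f x + ∑ xs (λ x → f x * f x)) (sym (m≥n⇒m⊔n≡m h)) (m≤m+n _ _)

iv-pos : ∀ {P : Set} (d : Dec P) → + iv d ≡ ZS.iv d
iv-pos (yes _) = refl
iv-pos (no _) = refl

square-abs : ∀ i → i ℤ.* i ≡ + (∣ i ∣ * ∣ i ∣)
square-abs (+ n) = sym (ℤ.pos-* n n)
square-abs ℤ.-[1+ n ] = refl

-- The fourth moment of h over an abelian group, rewritten as a sum of squares of autocorrelations.
module _ {R : Set} {_+'_ _*'_ : R → R → R} {0# 1# : R} (S : IsCommutativeSemiring _≡_ _+'_ _*'_ 0# 1#) where
  private
    module S = IsCommutativeSemiring S
    module Σ' = Sum S
    infixl 7 _·_
    _·_ : R → R → R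
    _·_ = _*'_

  autocorrelation : ∀ {X : Set} (E : Enum X) (add sub : X → X → X) (k : X → X → X → X) →
    (∀ b c → add b (sub c b) ≡ c) → (∀ b t → sub (add b t) b ≡ t) → (∀ a b t → k a b (add b t) ≡ add a t) →
    (h : X → R) → let xs = elems E in
    Σ'.∑ xs (λ a → h a · Σ'.∑ xs (λ b → h b · Σ'.∑ xs (λ c → h c · h (k a b c)))) ≡
    Σ'.∑ xs (λ t → Σ'.∑ xs (λ a → h a · h (add a t)) · Σ'.∑ xs (λ a → h a · h (add a t)))
  autocorrelation E add sub k i₁ i₂ kk h = begin
    ∑ᵣ (λ a → h a · ∑ᵣ (λ b → h b · ∑ᵣ (λ c → h c · h (k a b c))))
      ≡⟨ Σ'.∑-cong xs (λ a → cong (h a ·_) (Σ'.∑-cong xs (λ b → cong (h b ·_)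
           (trans (sym (Σ'.∑-reindex E (add b) (λ c → sub c b) (i₁ b) (i₂ b) (λ c → h c · h (k a b c))))
             (Σ'.∑-cong xs (λ t → cong (λ v → h (add b t) · h v) (kk a b t))))))) ⟩
    ∑ᵣ (λ a → h a · ∑ᵣ (λ b → h b · ∑ᵣ (λ t → h (add b t) · h (add a t))))
      ≡⟨ Σ'.∑-cong xs (λ a → trans (cong (h a ·_) (trans (Σ'.∑-cong xs (λ b → sym (Σ'.∑-*ˡ xs (h b) _))) (Σ'.∑-swap xs xs _))) (sym (Σ'.∑-*ˡ xs (h a) _))) ⟩
    ∑ᵣ (λ a → ∑ᵣ (λ t → h a · ∑ᵣ (λ b → h b · (h (add b t) · h (add a t))))) ≡⟨ Σ'.∑-swap xs xs _ ⟩
    ∑ᵣ (λ t → ∑ᵣ (λ a → h a · ∑ᵣ (λ b → h b · (h (add b t) · h (add a t)))))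
      ≡⟨ Σ'.∑-cong xs (λ t → trans (Σ'.∑-cong xs (λ a → trans (cong (h a ·_)
            (trans (Σ'.∑-cong xs (λ b → trans (sym (S.*-assoc (h b) _ _)) (S.*-comm _ (h (add a t))))) (Σ'.∑-*ˡ xs (h (add a t)) _)))
            (sym (S.*-assoc (h a) _ _)))) (Σ'.∑-*ʳ xs _ _)) ⟩
    ∑ᵣ (λ t → ∑ᵣ (λ a → h a · h (add a t)) · ∑ᵣ (λ a → h a · h (add a t))) ∎
    where
    open ≡-Reasoning
    xs = elems E
    ∑ᵣ = Σ'.∑ xs

module CharacterSums {q : ℕ} (F : FiniteField q) where
  open Geometry F
  open GroupSums F

  dot : ∀ {n} → Pt F n → Pt F n → Fin q
  dot [] [] = 0ᶠ
  dot (a ∷ x) (b ∷ y) = a *ᶠ b +ᶠ dot x y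

  dot-comm : ∀ {n} (x y : Pt F n) → dot x y ≡ dot y x
  dot-comm [] [] = refl
  dot-comm (a ∷ x) (b ∷ y) = cong₂ _+ᶠ_ (R.*-comm a b) (dot-comm x y)

  dot-affineʳ : ∀ {n} (ℓ x y : Pt F n) c → dot ℓ (x ⊞ c ⊡ y) ≡ dot ℓ x +ᶠ c *ᶠ dot ℓ y
  dot-affineʳ [] [] [] c = solve 1 (λ c → :0 := :0 :+ c :* :0) refl c
  dot-affineʳ (l ∷ ℓ) (a ∷ x) (b ∷ y) c = trans (cong (l *ᶠ (a +ᶠ c *ᶠ b) +ᶠ_) (dot-affineʳ ℓ x y c))
    (solve 6 (λ l a b c u v → l :* (a :+ c :* b) :+ (u :+ c :* v) := (l :* a :+ u) :+ c :* (l :* b :+ v)) refl l a b c (dot ℓ x) (dot ℓ y))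

  dot-affineˡ : ∀ {n} (u x y : Pt F n) c → dot (x ⊞ c ⊡ y) u ≡ dot x u +ᶠ c *ᶠ dot y u
  dot-affineˡ u x y c = trans (dot-comm _ u) (trans (dot-affineʳ u x y c) (cong₂ (λ v w → v +ᶠ c *ᶠ w) (dot-comm u x) (dot-comm u y)))

  dot-zeroʳ : ∀ {n} (ℓ : Pt F n) → dot ℓ 𝟎 ≡ 0ᶠ
  dot-zeroʳ [] = refl
  dot-zeroʳ (l ∷ ℓ) = trans (cong₂ _+ᶠ_ (R.zeroʳ l) (dot-zeroʳ ℓ)) (R.+-identityʳ _)

  dot-separates : ∀ {n} (u : Pt F n) → u ≢ 𝟎 → ∃ λ ℓ → dot ℓ u ≢ 0ᶠ
  dot-separates [] h = contradiction refl h
  dot-separates (a ∷ u) h with a ≟ᶠ 0ᶠ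
  ... | no a≢0 = 1ᶠ ∷ 𝟎 , λ e → a≢0 (trans (solve 1 (λ a → a := :1 :* a :+ :0) refl a)
          (trans (cong (1ᶠ *ᶠ a +ᶠ_) (sym (trans (dot-comm 𝟎 u) (dot-zeroʳ u)))) e))
  ... | yes refl with dot-separates u (λ e → h (cong (0ᶠ ∷_) e))
  ...   | ℓ , s = 0ᶠ ∷ ℓ , λ e → s (trans (solve 1 (λ v → v := :0 :* :0 :+ v) refl (dot ℓ u)) e)

  r : ℕ
  r = pred q
  q≡suc-r : q ≡ suc r
  q≡suc-r = sym (suc-pred q {{>-nonZero (≤-trans (s≤s z≤n) 2≤q)}})

  -- χ z is the sum of ψ(z) over the nontrivial additive characters ψ of the field.
  χ : Fin q → ℤ
  χ z = + q ℤ.* ZS.iv (z ≟ᶠ 0ᶠ) ℤ.+ ℤ.-1ℤ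

  χ-0 : ∀ {z} → z ≡ 0ᶠ → χ z ≡ + r
  χ-0 {z} e = trans (cong (λ v → + q ℤ.* v ℤ.+ ℤ.-1ℤ) (ZS.iv-yes (z ≟ᶠ 0ᶠ) e))
    (trans (cong (λ v → + v ℤ.* ℤ.1ℤ ℤ.+ ℤ.-1ℤ) q≡suc-r) (cong (ℤ._+ ℤ.-1ℤ) (ℤ.*-identityʳ (+ suc r))))

  χ-bound : ∀ z → ∣ χ z ∣ ≤ q
  χ-bound z with z ≟ᶠ 0ᶠ
  ... | yes _ = subst (λ q → ∣ + q ℤ.* ℤ.1ℤ ℤ.+ ℤ.-1ℤ ∣ ≤ q) (sym q≡suc-r)
                  (≤-trans (≤-reflexive (cong (λ v → ∣ v ℤ.+ ℤ.-1ℤ ∣) (ℤ.*-identityʳ (+ suc r)))) (n≤1+n r))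
  ... | no _ = ≤-trans (≤-reflexive (cong (λ v → ∣ v ℤ.+ ℤ.-1ℤ ∣) (ℤ.*-zeroʳ (+ q)))) (≤-trans (s≤s z≤n) 2≤q)

  ZΣG : ∀ {n} → (Pt F n → ℤ) → ℤ
  ZΣG {n} = ZS.∑ (elems (Gs n))
  ZΣF : (Fin q → ℤ) → ℤ
  ZΣF = ZS.∑ (elems Fs)

  ΣF-shift : ∀ (f : Fin q → ℤ) w → ZΣF (λ z → f (z +ᶠ w)) ≡ ZΣF f
  ΣF-shift f w = ZS.∑-reindex Fs (_+ᶠ w) (_+ᶠ -ᶠ w)
    (λ x → solve 2 (λ x w → (x :+ :- w) :+ w := x) refl x w) (λ x → solve 2 (λ x w → (x :+ w) :+ :- w := x) refl x w) f

  ∑-minus : ∀ {A : Set} (E : Enum A) (f g : A → ℤ) → ZS.∑ (elems E) (λ x → f x ℤ.* (+ q ℤ.* g x ℤ.+ ℤ.-1ℤ)) ≡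
            + q ℤ.* ZS.∑ (elems E) (λ x → f x ℤ.* g x) ℤ.+ ℤ.-1ℤ ℤ.* ZS.∑ (elems E) f
  ∑-minus E f g = trans (ZS.∑-cong xs (λ x → lem (+ q) (f x) (g x))) (trans (ZS.∑-+ xs _ _) (cong₂ ℤ._+_ (ZS.∑-*ˡ xs (+ q) _) (ZS.∑-*ˡ xs ℤ.-1ℤ f)))
    where
    xs = elems E
    lem : ∀ q f g → f ℤ.* (q ℤ.* g ℤ.+ ℤ.-1ℤ) ≡ q ℤ.* (f ℤ.* g) ℤ.+ ℤ.-1ℤ ℤ.* f
    lem = ℤ-RingSolver.solve-∀

  module _ {n} {W : Pt F n → Set} (W? : ∀ x → Dec (W x)) (φ : Pt F n → Fin q)
           (affine : ∀ x y c → φ (x ⊞ c ⊡ y) ≡ φ x +ᶠ c *ᶠ φ y) where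
    private xs = elems (Gs n)

    -- Translation by the multiple of x₀ on which φ takes the value c carries the zero fibre of φ on
    -- W onto the fibre over c, so all q fibres have the same size.
    balanced : (∀ x y c → W x → W y → W (x ⊞ c ⊡ y)) → ∀ x₀ → W x₀ → φ x₀ ≢ 0ᶠ →
               q * ΣG (λ x → iv (W? x) * iv (φ x ≟ᶠ 0ᶠ)) ≡ ΣG (λ x → iv (W? x))
    balanced closed x₀ w₀ φ≢0 = sym (begin
      ΣG (λ x → iv (W? x)) ≡⟨ ∑-fibre Fs xs φ (λ x → iv (W? x)) ⟩
      ∑ (elems Fs) (λ c → ΣG (λ x → iv (c ≟ᶠ φ x) * iv (W? x))) ≡⟨ ∑-cong (elems Fs) fibre ⟩
      ∑ (elems Fs) (λ _ → ΣG (λ x → iv (W? x) * iv (φ x ≟ᶠ 0ᶠ))) ≡⟨ trans (∑-const (elems Fs) _) (cong (_* ΣG (λ x → iv (W? x) * iv (φ x ≟ᶠ 0ᶠ))) card-F) ⟩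
      q * ΣG (λ x → iv (W? x) * iv (φ x ≟ᶠ 0ᶠ)) ∎)
      where
      open ≡-Reasoning
      fibre : ∀ c → ΣG (λ x → iv (c ≟ᶠ φ x) * iv (W? x)) ≡ ΣG (λ x → iv (W? x) * iv (φ x ≟ᶠ 0ᶠ))
      fibre c = trans (sym (ΣG-shift (d ⊡ x₀) (λ x → iv (c ≟ᶠ φ x) * iv (W? x)))) (∑-cong xs (λ x → trans
          (cong₂ _*_ (iv-cong (c ≟ᶠ φ (x ⊞ d ⊡ x₀)) (φ x ≟ᶠ 0ᶠ) (to x) (from x))
            (iv-cong (W? (x ⊞ d ⊡ x₀)) (W? x) (λ w → subst W (undo d x x₀) (closed (x ⊞ d ⊡ x₀) x₀ (-ᶠ d) w w₀)) (λ w → closed x x₀ d w w₀)))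
          (*-comm _ (iv (W? x)))))
        where
        d = c *ᶠ inv (φ x₀) φ≢0
        undo : ∀ {n} d (x y : Pt F n) → (x ⊞ d ⊡ y) ⊞ (-ᶠ d) ⊡ y ≡ x
        undo d [] [] = refl
        undo d (a ∷ x) (b ∷ y) = cong₂ _∷_ (solve 3 (λ d a b → (a :+ d :* b) :+ (:- d) :* b := a) refl d a b) (undo d x y)
        value : ∀ x → φ (x ⊞ d ⊡ x₀) ≡ φ x +ᶠ c
        value x = trans (affine x x₀ d) (cong (φ x +ᶠ_) (trans (R.*-assoc c _ _) (trans (cong (c *ᶠ_) (inv-l (φ x₀) φ≢0)) (R.*-identityʳ c))))
        to : ∀ x → c ≡ φ (x ⊞ d ⊡ x₀) → φ x ≡ 0ᶠ
        to x e = trans (solve 2 (λ v c → v := (v :+ c) :+ :- c) refl (φ x) c) (trans (cong (_+ᶠ -ᶠ c) (sym (trans e (value x)))) (R.-‿inverseʳ c))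
        from : ∀ x → φ x ≡ 0ᶠ → c ≡ φ (x ⊞ d ⊡ x₀)
        from x e = sym (trans (value x) (trans (cong (_+ᶠ c) e) (R.+-identityˡ c)))

    χ-sum : ZΣG (λ x → + iv (W? x) ℤ.* χ (φ x)) ≡ + (q * ΣG (λ x → iv (W? x) * iv (φ x ≟ᶠ 0ᶠ))) ℤ.+ ℤ.-1ℤ ℤ.* + ΣG (λ x → iv (W? x))
    χ-sum = trans (∑-minus (Gs n) (λ x → + iv (W? x)) (λ x → ZS.iv (φ x ≟ᶠ 0ᶠ)))
      (cong₂ (λ a b → a ℤ.+ ℤ.-1ℤ ℤ.* b)
        (trans (cong (+ q ℤ.*_) (trans (ZS.∑-cong xs (λ x → trans (cong (+ iv (W? x) ℤ.*_) (sym (iv-pos (φ x ≟ᶠ 0ᶠ)))) (sym (ℤ.pos-* (iv (W? x)) _)))) (sym (∑-pos xs _)))) (sym (ℤ.pos-* q _)))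
        (sym (∑-pos xs _)))

    χ-sum-balanced : (∀ x y c → W x → W y → W (x ⊞ c ⊡ y)) → ∀ x₀ → W x₀ → φ x₀ ≢ 0ᶠ → ZΣG (λ x → + iv (W? x) ℤ.* χ (φ x)) ≡ + 0
    χ-sum-balanced closed x₀ w₀ h = trans χ-sum (trans (cong (λ v → + v ℤ.+ ℤ.-1ℤ ℤ.* + ΣG (λ x → iv (W? x))) (balanced closed x₀ w₀ h)) (lem (+ ΣG (λ x → iv (W? x)))))
      where lem : ∀ v → v ℤ.+ ℤ.-1ℤ ℤ.* v ≡ + 0
            lem = ℤ-RingSolver.solve-∀

    χ-sum-zero : (∀ x → W x → φ x ≡ 0ᶠ) → ZΣG (λ x → + iv (W? x) ℤ.* χ (φ x)) ≡ + r ℤ.* + ΣG (λ x → iv (W? x))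
    χ-sum-zero h = trans (ZS.∑-cong xs term) (trans (ZS.∑-*ˡ xs (+ r) _) (cong (+ r ℤ.*_) (sym (∑-pos xs _))))
      where
      term : ∀ x → + iv (W? x) ℤ.* χ (φ x) ≡ + r ℤ.* + iv (W? x)
      term x with W? x
      ... | yes w = trans (ℤ.*-identityˡ (χ (φ x))) (trans (χ-0 (h x w)) (sym (ℤ.*-identityʳ (+ r))))
      ... | no _ = trans (ℤ.*-zeroˡ (χ (φ x))) (sym (ℤ.*-zeroʳ (+ r)))

  χ-sum-all : ∀ {n} (u : Pt F n) → ZΣG (λ ℓ → χ (dot ℓ u)) ≡ + r ℤ.* + (q ^ n) ℤ.* + atZero u
  χ-sum-all {n} u = trans (ZS.∑-cong (elems (Gs n)) (λ ℓ → sym (ℤ.*-identityˡ _))) cases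
    where
    whole? : ∀ (x : Pt F n) → Dec (x ≡ x)
    whole? x = yes refl
    cases : ZΣG (λ ℓ → + iv (whole? ℓ) ℤ.* χ (dot ℓ u)) ≡ + r ℤ.* + (q ^ n) ℤ.* + atZero u
    cases with u ≟ᵛ 𝟎
    ... | yes refl = trans (χ-sum-zero whole? (λ ℓ → dot ℓ 𝟎) (dot-affineˡ 𝟎) (λ ℓ _ → dot-zeroʳ ℓ))
                       (trans (cong (λ v → + r ℤ.* + v) (card-G n)) (sym (ℤ.*-identityʳ (+ r ℤ.* + (q ^ n)))))
    ... | no u≢𝟎 with dot-separates u u≢𝟎
    ...   | ℓ , s = trans (χ-sum-balanced whole? (λ ℓ → dot ℓ u) (dot-affineˡ u) (λ _ _ _ _ _ → refl) ℓ refl s) (sym (ℤ.*-zeroʳ (+ r ℤ.* + (q ^ n))))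

  module Orthogonal {n} (Ls : List (Pt F n)) where
    private xs = elems (Gs n)
    H : Pt F n → Set
    H x = All (λ ℓ → dot ℓ x ≡ 0ᶠ) Ls
    H? : ∀ x → Dec (H x)
    H? x = all? (λ ℓ → dot ℓ x ≟ᶠ 0ᶠ) Ls

    H-affine : ∀ x y c → H x → H y → H (x ⊞ c ⊡ y)
    H-affine x y c hx hy = All.tabulate (λ {ℓ} ℓ∈ → trans (dot-affineʳ ℓ x y c)
      (trans (cong₂ (λ u v → u +ᶠ c *ᶠ v) (All.lookup hx ℓ∈) (All.lookup hy ℓ∈)) (solve 1 (λ c → :0 :+ c :* :0 := :0) refl c)))

    -- The span of `Ls`, described as the annihilator of H: in this form it is decidable by search
    -- and its character sum needs no basis.
    W : Pt F n → Set
    W ℓ = ∀ x → H x → dot ℓ x ≡ 0ᶠ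
    W? : ∀ ℓ → Dec (W ℓ)
    W? ℓ with any-elem (Gs n) (λ x → H? x ×-dec ¬? (dot ℓ x ≟ᶠ 0ᶠ))
    ... | yes (x , h , ne) = no (λ w → ne (w x h))
    ... | no none = yes w
      where
      w : ∀ x → H x → dot ℓ x ≡ 0ᶠ
      w x h with dot ℓ x ≟ᶠ 0ᶠ
      ... | yes e = e
      ... | no ne = contradiction (x , h , ne) none

    W-member : ∀ {ℓ} → ℓ ∈ Ls → W ℓ
    W-member ℓ∈ x h = All.lookup h ℓ∈

    W-affine : ∀ x y c → W x → W y → W (x ⊞ c ⊡ y)
    W-affine x y c wx wy u hu = trans (dot-affineˡ u x y c)
      (trans (cong₂ (λ v w → v +ᶠ c *ᶠ w) (wx u hu) (wy u hu)) (solve 1 (λ c → :0 :+ c :* :0 := :0) refl c))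

    ∣H∣ ∣W∣ : ℕ
    ∣H∣ = ΣG (λ x → iv (H? x))
    ∣W∣ = ΣG (λ x → iv (W? x))

    χ-sum-W : ∀ u → ZΣG (λ ℓ → + iv (W? ℓ) ℤ.* χ (dot ℓ u)) ≡ + r ℤ.* + ∣W∣ ℤ.* + iv (H? u)
    χ-sum-W u with H? u
    ... | yes h = trans (χ-sum-zero W? (λ ℓ → dot ℓ u) (dot-affineˡ u) (λ ℓ w → w u h)) (sym (ℤ.*-identityʳ _))
    ... | no ¬h with find (¬All⇒Any¬ (λ ℓ → dot ℓ u ≟ᶠ 0ᶠ) Ls ¬h)
    ...   | ℓ , ℓ∈ , ne = trans (χ-sum-balanced W? (λ ℓ → dot ℓ u) (dot-affineˡ u) W-affine ℓ (W-member ℓ∈) ne) (sym (ℤ.*-zeroʳ (+ r ℤ.* + ∣W∣)))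

    instance
      r≢0 : NonZero r
      r≢0 = >-nonZero (s≤s⁻¹ (≤-trans 2≤q (≤-reflexive q≡suc-r)))

    -- Both sides, multiplied by r, evaluate the sum of χ (ℓ · u) over ℓ in W and all u.
    ∣W∣*∣H∣ : ∣W∣ * ∣H∣ ≡ q ^ n
    ∣W∣*∣H∣ = *-cancelˡ-≡ _ _ r (ℤ.+-injective (begin
      + (r * (∣W∣ * ∣H∣)) ≡⟨ trans (cong +_ (sym (*-assoc r ∣W∣ ∣H∣))) (trans (ℤ.pos-* (r * ∣W∣) ∣H∣) (cong (ℤ._* + ∣H∣) (ℤ.pos-* r ∣W∣))) ⟩
      + r ℤ.* + ∣W∣ ℤ.* + ∣H∣ ≡⟨ trans (cong (+ r ℤ.* + ∣W∣ ℤ.*_) (∑-pos xs _)) (sym (ZS.∑-*ˡ xs (+ r ℤ.* + ∣W∣) _)) ⟩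
      ZΣG (λ u → + r ℤ.* + ∣W∣ ℤ.* + iv (H? u)) ≡⟨ ZS.∑-cong xs (λ u → sym (χ-sum-W u)) ⟩
      ZΣG (λ u → ZΣG (λ ℓ → + iv (W? ℓ) ℤ.* χ (dot ℓ u))) ≡⟨ ZS.∑-swap xs xs _ ⟩
      ZΣG (λ ℓ → ZΣG (λ u → + iv (W? ℓ) ℤ.* χ (dot ℓ u))) ≡⟨ ZS.∑-cong xs (λ ℓ → trans (ZS.∑-*ˡ xs (+ iv (W? ℓ)) _) (trans (cong (+ iv (W? ℓ) ℤ.*_) (inner ℓ)) (at-zero ℓ))) ⟩
      ZΣG {n} (λ ℓ → + r ℤ.* + (q ^ n) ℤ.* + atZero ℓ) ≡⟨ trans (ZS.∑-*ˡ xs (+ r ℤ.* + (q ^ n)) _) (cong (+ r ℤ.* + (q ^ n) ℤ.*_) (trans (sym (∑-pos xs _)) (cong +_ (∑-point1 (Gs n) 𝟎)))) ⟩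
      + r ℤ.* + (q ^ n) ℤ.* + 1 ≡⟨ trans (ℤ.*-identityʳ _) (sym (ℤ.pos-* r _)) ⟩
      + (r * q ^ n) ∎))
      where
      open ≡-Reasoning
      inner : ∀ ℓ → ZΣG (λ u → χ (dot ℓ u)) ≡ + r ℤ.* + (q ^ n) ℤ.* + atZero ℓ
      inner ℓ = trans (ZS.∑-cong xs (λ u → cong χ (dot-comm ℓ u))) (χ-sum-all ℓ)
      at-zero : ∀ ℓ → + iv (W? ℓ) ℤ.* (+ r ℤ.* + (q ^ n) ℤ.* + atZero ℓ) ≡ + r ℤ.* + (q ^ n) ℤ.* + atZero ℓ
      at-zero ℓ with ℓ ≟ᵛ 𝟎
      ... | no _ = trans (cong (+ iv (W? ℓ) ℤ.*_) (ℤ.*-zeroʳ (+ r ℤ.* + (q ^ n)))) (trans (ℤ.*-zeroʳ (+ iv (W? ℓ))) (sym (ℤ.*-zeroʳ (+ r ℤ.* + (q ^ n)))))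
      ... | yes refl = trans (cong (λ v → + v ℤ.* (+ r ℤ.* + (q ^ n) ℤ.* + 1)) (iv-yes (W? 𝟎) (λ x _ → trans (dot-comm 𝟎 x) (dot-zeroʳ x)))) (ℤ.*-identityˡ _)

  -- A further functional either vanishes on the current subspace or splits it into q equal fibres.
  codimension : ∀ {n} (Ls : List (Pt F n)) → q ^ n ≤ q ^ length Ls * Orthogonal.∣H∣ Ls
  codimension {n} [] = ≤-reflexive (sym (trans (*-identityˡ _) (card-G n)))
  codimension {n} (ℓ ∷ Ls) = ≤-trans (codimension Ls) (≤-trans (*-monoʳ-≤ (q ^ length Ls) step) (≤-reflexive (lem (q ^ length Ls) q _)))
    where
    lem : ∀ a b c → a * (b * c) ≡ b * a * c
    lem = solve-∀
    open Orthogonal Ls using (H; H?; H-affine; ∣H∣)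
    module H' = Orthogonal (ℓ ∷ Ls)
    xs = elems (Gs n)
    restrict : ΣG (λ x → iv (H? x) * iv (dot ℓ x ≟ᶠ 0ᶠ)) ≡ H'.∣H∣
    restrict = ∑-cong xs (λ x → trans (sym (iv-× (H? x) (dot ℓ x ≟ᶠ 0ᶠ))) (iv-cong (H? x ×-dec (dot ℓ x ≟ᶠ 0ᶠ)) (H'.H? x) (λ { (a , b) → b ∷ a }) (λ { (b ∷ a) → a , b })))
    step : ∣H∣ ≤ q * H'.∣H∣
    step with any-elem (Gs n) (λ x → H? x ×-dec ¬? (dot ℓ x ≟ᶠ 0ᶠ))
    ... | yes (x₀ , h₀ , ne) = ≤-reflexive (trans (sym (balanced H? (dot ℓ) (dot-affineʳ ℓ) H-affine x₀ h₀ ne)) (cong (q *_) restrict))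
    ... | no none = ≤-trans (∑-mono xs (λ x → term x)) (≤-trans (≤-reflexive restrict) (m≤n*m H'.∣H∣ q {{>-nonZero (≤-trans (s≤s z≤n) 2≤q)}}))
      where
      term : ∀ x → iv (H? x) ≤ iv (H? x) * iv (dot ℓ x ≟ᶠ 0ᶠ)
      term x with H? x
      ... | no _ = z≤n
      ... | yes h with dot ℓ x ≟ᶠ 0ᶠ
      ...   | yes _ = ≤-refl
      ...   | no ne = contradiction (x , h , ne) none

-- Bias along a linear functional

module Discrepancy {q : ℕ} (F : FiniteField q) where
  open Geometry F
  open GroupSums F
  open CharacterSums F

  -- The count `reps` with a signed final weight; the weight χ(ℓ · p) makes it the contribution of ℓ
  -- to the number of solutions.
  Zreps : ∀ {n} (f : Pt F n → ℕ) (base : Pt F n → ℤ) → List (Fin q) → Pt F n → ℤ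
  Zreps f base [] p = base p
  Zreps f base (c ∷ cs) p = ZΣG (λ x → + f x ℤ.* Zreps f base cs (p ⊞ c ⊡ x))

  Zreps-cong : ∀ {n} (f : Pt F n → ℕ) {β γ : Pt F n → ℤ} → (∀ p → β p ≡ γ p) → ∀ cs p → Zreps f β cs p ≡ Zreps f γ cs p
  Zreps-cong f h [] p = h p
  Zreps-cong {n} f h (c ∷ cs) p = ZS.∑-cong (elems (Gs n)) (λ x → cong (+ f x ℤ.*_) (Zreps-cong f h cs _))

  Zreps-sum : ∀ {n} {I : Set} (is : List I) (ω : I → ℤ) (f : Pt F n → ℕ) (β : I → Pt F n → ℤ) cs p →
    ZS.∑ is (λ i → ω i ℤ.* Zreps f (β i) cs p) ≡ Zreps f (λ p → ZS.∑ is (λ i → ω i ℤ.* β i p)) cs p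
  Zreps-sum is ω f β [] p = refl
  Zreps-sum {n} is ω f β (c ∷ cs) p = begin
    ZS.∑ is (λ i → ω i ℤ.* ZΣG (λ x → + f x ℤ.* Zreps f (β i) cs (p ⊞ c ⊡ x)))
      ≡⟨ trans (ZS.∑-cong is (λ i → sym (ZS.∑-*ˡ xs (ω i) _))) (ZS.∑-swap is xs _) ⟩
    ZΣG (λ x → ZS.∑ is (λ i → ω i ℤ.* (+ f x ℤ.* Zreps f (β i) cs (p ⊞ c ⊡ x))))
      ≡⟨ ZS.∑-cong xs (λ x → trans (ZS.∑-cong is (λ i → lem (ω i) (+ f x) _)) (trans (ZS.∑-*ˡ is (+ f x) _) (cong (+ f x ℤ.*_) (Zreps-sum is ω f β cs _)))) ⟩
    ZΣG (λ x → + f x ℤ.* Zreps f (λ p → ZS.∑ is (λ i → ω i ℤ.* β i p)) cs (p ⊞ c ⊡ x)) ∎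
    where
    open ≡-Reasoning
    xs = elems (Gs n)
    lem : ∀ a b c → a ℤ.* (b ℤ.* c) ≡ b ℤ.* (a ℤ.* c)
    lem = ℤ-RingSolver.solve-∀

  Zreps-pos : ∀ {n} (f : Pt F n → ℕ) k (β : Pt F n → ℕ) cs p → Zreps f (λ p → k ℤ.* + β p) cs p ≡ k ℤ.* + reps f β cs p
  Zreps-pos f k β [] p = refl
  Zreps-pos {n} f k β (c ∷ cs) p = begin
    ZΣG (λ x → + f x ℤ.* Zreps f (λ p → k ℤ.* + β p) cs (p ⊞ c ⊡ x))
      ≡⟨ ZS.∑-cong xs (λ x → trans (cong (+ f x ℤ.*_) (Zreps-pos f k β cs _)) (trans (lem (+ f x) k _) (cong (k ℤ.*_) (sym (ℤ.pos-* (f x) _))))) ⟩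
    ZΣG (λ x → k ℤ.* + (f x * reps f β cs (p ⊞ c ⊡ x))) ≡⟨ trans (ZS.∑-*ˡ xs k _) (cong (k ℤ.*_) (sym (∑-pos xs _))) ⟩
    k ℤ.* + reps f β (c ∷ cs) p ∎
    where
    open ≡-Reasoning
    xs = elems (Gs n)
    lem : ∀ a b c → a ℤ.* (b ℤ.* c) ≡ b ℤ.* (a ℤ.* c)
    lem = ℤ-RingSolver.solve-∀

  module _ {n : ℕ} (f : Pt F n → ℕ) (ℓ : Pt F n) where
    private
      xs = elems (Gs n)
      ws = elems Fs
      mass : ℕ
      mass = ΣG f

    -- q times the number of weighted representations with ℓ (p + c₁ x₁ + ⋯ + cₖ xₖ) = 0, where z = ℓ p,
    -- minus its expected value.
    discrepancy : List (Fin q) → Fin q → ℤ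
    discrepancy [] z = χ z
    discrepancy (c ∷ cs) z = ZΣG (λ x → + f x ℤ.* discrepancy cs (z +ᶠ c *ᶠ dot ℓ x))

    Zreps≡discrepancy : ∀ cs p → Zreps f (λ p → χ (dot ℓ p)) cs p ≡ discrepancy cs (dot ℓ p)
    Zreps≡discrepancy [] p = refl
    Zreps≡discrepancy (c ∷ cs) p = ZS.∑-cong xs (λ x → cong (+ f x ℤ.*_)
      (trans (Zreps≡discrepancy cs _) (cong (discrepancy cs) (dot-affineʳ ℓ p x c))))

    fibreMass : Fin q → ℕ
    fibreMass w = ΣG (λ x → iv (w ≟ᶠ dot ℓ x) * f x)

    -- The deviation of a fibre mass from its mean `mass` / q, scaled by q to stay integral. Its
    -- maximum plays the part of the largest Fourier coefficient of f at nonzero multiples of ℓ.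
    bias : Fin q → ℤ
    bias w = + q ℤ.* + fibreMass w ℤ.+ ℤ.-1ℤ ℤ.* + mass

    maxBias : ℕ
    maxBias = maximum ws (λ w → ∣ bias w ∣)

    ∑-fibreMass : ∀ (G : Fin q → ℤ) → ZΣG (λ x → + f x ℤ.* G (dot ℓ x)) ≡ ZΣF (λ w → + fibreMass w ℤ.* G w)
    ∑-fibreMass G = trans (ZS.∑-fibre Fs xs (dot ℓ) _) (ZS.∑-cong ws (λ w → begin
      ZΣG (λ x → ZS.iv (w ≟ᶠ dot ℓ x) ℤ.* (+ f x ℤ.* G (dot ℓ x))) ≡⟨ ZS.∑-cong xs (λ x → term w x) ⟩
      ZΣG (λ x → + (iv (w ≟ᶠ dot ℓ x) * f x) ℤ.* G w) ≡⟨ ZS.∑-*ʳ xs (G w) _ ⟩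
      ZΣG (λ x → + (iv (w ≟ᶠ dot ℓ x) * f x)) ℤ.* G w ≡⟨ cong (ℤ._* G w) (sym (∑-pos xs _)) ⟩
      + fibreMass w ℤ.* G w ∎))
      where
      open ≡-Reasoning
      term : ∀ w x → ZS.iv (w ≟ᶠ dot ℓ x) ℤ.* (+ f x ℤ.* G (dot ℓ x)) ≡ + (iv (w ≟ᶠ dot ℓ x) * f x) ℤ.* G w
      term w x with w ≟ᶠ dot ℓ x
      ... | yes refl = trans (ℤ.*-identityˡ _) (cong (λ v → + v ℤ.* G w) (sym (*-identityˡ (f x))))
      ... | no _ = trans (ℤ.*-zeroˡ (+ f x ℤ.* G (dot ℓ x))) (sym (ℤ.*-zeroˡ (G w)))

    ∑-fibreMass-1 : ∑ ws fibreMass ≡ mass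
    ∑-fibreMass-1 = sym (∑-fibre Fs xs (dot ℓ) f)

    discrepancy-sum : ∀ cs → ZΣF (discrepancy cs) ≡ + 0
    discrepancy-sum [] = begin
      ZΣF χ ≡⟨ ZS.∑-+ ws _ _ ⟩
      ZΣF (λ z → + q ℤ.* ZS.iv (z ≟ᶠ 0ᶠ)) ℤ.+ ZΣF (λ _ → ℤ.-1ℤ)
        ≡⟨ cong₂ ℤ._+_ (trans (ZS.∑-*ˡ ws (+ q) _) (cong (+ q ℤ.*_) (ZS.∑-point1 Fs 0ᶠ)))
             (trans (ZS.∑-cong ws (λ _ → sym (ℤ.*-identityʳ ℤ.-1ℤ))) (trans (ZS.∑-*ˡ ws ℤ.-1ℤ (λ _ → + 1)) (cong (ℤ.-1ℤ ℤ.*_) (trans (sym (∑-pos ws (λ _ → 1))) (cong +_ card-F))))) ⟩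
      + q ℤ.* + 1 ℤ.+ ℤ.-1ℤ ℤ.* + q ≡⟨ lem (+ q) ⟩
      + 0 ∎
      where
      open ≡-Reasoning
      lem : ∀ q → q ℤ.* + 1 ℤ.+ ℤ.-1ℤ ℤ.* q ≡ + 0
      lem = ℤ-RingSolver.solve-∀
    discrepancy-sum (c ∷ cs) = trans (ZS.∑-swap ws xs _) (trans (ZS.∑-cong xs (λ x → trans (ZS.∑-*ˡ ws (+ f x) _)
      (trans (cong (+ f x ℤ.*_) (trans (ΣF-shift (discrepancy cs) _) (discrepancy-sum cs))) (ℤ.*-zeroʳ (+ f x))))) (ZS.∑-0 xs))

    -- The constant part of the bias may be subtracted for free because the discrepancies sum to 0
    -- over the field. Without this, a variable would contribute its full mass instead of its bias.
    discrepancy-step : ∀ c → c ≢ 0ᶠ → ∀ cs z → + q ℤ.* discrepancy (c ∷ cs) z ≡ ZΣF (λ w → bias w ℤ.* discrepancy cs (z +ᶠ c *ᶠ w))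
    discrepancy-step c c≢0 cs z = sym (begin
      ZΣF (λ w → bias w ℤ.* D w) ≡⟨ ZS.∑-cong ws (λ w → lem (+ q) (+ fibreMass w) (+ mass) (D w)) ⟩
      ZΣF (λ w → + q ℤ.* (+ fibreMass w ℤ.* D w) ℤ.+ (ℤ.-1ℤ ℤ.* + mass) ℤ.* D w)
        ≡⟨ trans (ZS.∑-+ ws _ _) (cong₂ ℤ._+_ (ZS.∑-*ˡ ws (+ q) _) (ZS.∑-*ˡ ws (ℤ.-1ℤ ℤ.* + mass) D)) ⟩
      + q ℤ.* ZΣF (λ w → + fibreMass w ℤ.* D w) ℤ.+ (ℤ.-1ℤ ℤ.* + mass) ℤ.* ZΣF D
        ≡⟨ cong₂ (λ u v → + q ℤ.* u ℤ.+ (ℤ.-1ℤ ℤ.* + mass) ℤ.* v) (sym (∑-fibreMass D)) D-sum ⟩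
      + q ℤ.* discrepancy (c ∷ cs) z ℤ.+ (ℤ.-1ℤ ℤ.* + mass) ℤ.* + 0 ≡⟨ trans (cong (ℤ._+_ (+ q ℤ.* discrepancy (c ∷ cs) z)) (ℤ.*-zeroʳ (ℤ.-1ℤ ℤ.* + mass))) (ℤ.+-identityʳ _) ⟩
      + q ℤ.* discrepancy (c ∷ cs) z ∎)
      where
      open ≡-Reasoning
      D : Fin q → ℤ
      D w = discrepancy cs (z +ᶠ c *ᶠ w)
      lem : ∀ q g m d → (q ℤ.* g ℤ.+ ℤ.-1ℤ ℤ.* m) ℤ.* d ≡ q ℤ.* (g ℤ.* d) ℤ.+ (ℤ.-1ℤ ℤ.* m) ℤ.* d
      lem = ℤ-RingSolver.solve-∀
      c' = inv c c≢0
      σ : Fin q → Fin q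
      σ w = z +ᶠ c *ᶠ w
      τ : Fin q → Fin q
      τ v = c' *ᶠ (v +ᶠ -ᶠ z)
      στ : ∀ v → σ (τ v) ≡ v
      στ v = trans (solve 4 (λ z c c' v → z :+ c :* (c' :* (v :+ :- z)) := z :+ (c :* c') :* (v :+ :- z)) refl z c c' v)
        (trans (cong (λ u → z +ᶠ u *ᶠ (v +ᶠ -ᶠ z)) (inv-r c c≢0)) (solve 2 (λ z v → z :+ :1 :* (v :+ :- z) := v) refl z v))
      τσ : ∀ w → τ (σ w) ≡ w
      τσ w = trans (solve 4 (λ z c c' w → c' :* ((z :+ c :* w) :+ :- z) := (c' :* c) :* w) refl z c c' w)
        (trans (cong (_*ᶠ w) (inv-l c c≢0)) (R.*-identityˡ w))
      D-sum : ZΣF D ≡ + 0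
      D-sum = trans (ZS.∑-reindex Fs σ τ στ τσ (discrepancy cs)) (discrepancy-sum cs)

    ∣bias∣≤ : ∀ w → ∣ bias w ∣ ≤ maxBias
    ∣bias∣≤ w = maximum-upper (λ w → ∣ bias w ∣) (Enum.complete Fs w)

    -- The factor q on the left of `discrepancy-step` cancels against its q summands, so every
    -- variable costs exactly one factor `maxBias`.
    discrepancy-bound : ∀ cs → All (_≢ 0ᶠ) cs → ∀ z → ∣ discrepancy cs z ∣ ≤ q * maxBias ^ length cs
    discrepancy-bound [] _ z = ≤-trans (χ-bound z) (≤-reflexive (sym (*-identityʳ q)))
    discrepancy-bound (c ∷ cs) (c≢0 ∷ h) z = *-cancelˡ-≤ q {{>-nonZero (≤-trans (s≤s z≤n) 2≤q)}} (begin
      q * ∣ discrepancy (c ∷ cs) z ∣ ≡⟨ sym (ℤ.abs-* (+ q) (discrepancy (c ∷ cs) z)) ⟩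
      ∣ + q ℤ.* discrepancy (c ∷ cs) z ∣ ≡⟨ cong ∣_∣ (discrepancy-step c c≢0 cs z) ⟩
      ∣ ZΣF (λ w → bias w ℤ.* discrepancy cs (z +ᶠ c *ᶠ w)) ∣ ≤⟨ ∣∑∣≤ ws _ ⟩
      ΣF (λ w → ∣ bias w ℤ.* discrepancy cs (z +ᶠ c *ᶠ w) ∣)
        ≤⟨ ∑-mono ws (λ w → ≤-trans (≤-reflexive (ℤ.abs-* (bias w) _)) (*-mono-≤ (∣bias∣≤ w) (discrepancy-bound cs h _))) ⟩
      ΣF (λ w → maxBias * (q * maxBias ^ length cs)) ≡⟨ trans (∑-const ws _) (cong (_* (maxBias * (q * maxBias ^ length cs))) card-F) ⟩
      q * (maxBias * (q * maxBias ^ length cs)) ≡⟨ cong (q *_) (lem maxBias q _) ⟩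
      q * (q * maxBias ^ suc (length cs)) ∎)
      where
      open ≤-Reasoning
      lem : ∀ a b c → a * (b * c) ≡ b * (a * c)
      lem = solve-∀

    discrepancy-last : ∀ z → discrepancy ((-ᶠ 1ᶠ) ∷ []) z ≡ bias z
    discrepancy-last z = begin
      ZΣG (λ x → + f x ℤ.* χ (z +ᶠ (-ᶠ 1ᶠ) *ᶠ dot ℓ x)) ≡⟨ ∑-fibreMass (λ w → χ (z +ᶠ (-ᶠ 1ᶠ) *ᶠ w)) ⟩
      ZΣF (λ w → + fibreMass w ℤ.* χ (z +ᶠ (-ᶠ 1ᶠ) *ᶠ w)) ≡⟨ ∑-minus Fs (λ w → + fibreMass w) (λ w → ZS.iv ((z +ᶠ (-ᶠ 1ᶠ) *ᶠ w) ≟ᶠ 0ᶠ)) ⟩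
      + q ℤ.* ZΣF (λ w → + fibreMass w ℤ.* ZS.iv ((z +ᶠ (-ᶠ 1ᶠ) *ᶠ w) ≟ᶠ 0ᶠ)) ℤ.+ ℤ.-1ℤ ℤ.* ZΣF (λ w → + fibreMass w)
        ≡⟨ cong₂ (λ u v → + q ℤ.* u ℤ.+ ℤ.-1ℤ ℤ.* v)
             (trans (ZS.∑-cong ws (λ w → trans (ℤ.*-comm (+ fibreMass w) _) (cong (ℤ._* + fibreMass w) (ZS.iv-cong ((z +ᶠ (-ᶠ 1ᶠ) *ᶠ w) ≟ᶠ 0ᶠ) (w ≟ᶠ z) (to w) (from w))))) (ZS.∑-point Fs z (λ w → + fibreMass w)))
             (trans (sym (∑-pos ws fibreMass)) (cong +_ ∑-fibreMass-1)) ⟩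
      bias z ∎
      where
      open ≡-Reasoning
      to : ∀ w → z +ᶠ (-ᶠ 1ᶠ) *ᶠ w ≡ 0ᶠ → w ≡ z
      to w e = trans (solve 2 (λ z w → w := z :+ :- (z :+ (:- :1) :* w)) refl z w) (trans (cong (λ v → z +ᶠ -ᶠ v) e) (solve 1 (λ z → z :+ :- :0 := z) refl z))
      from : ∀ w → w ≡ z → z +ᶠ (-ᶠ 1ᶠ) *ᶠ w ≡ 0ᶠ
      from w refl = solve 1 (λ z → z :+ (:- :1) :* z := :0) refl z

    private
      1≢0 : 1ᶠ ≢ 0ᶠ
      1≢0 e = 0≢1ᶠ (sym e)

    -- Three steps and `discrepancy-last` turn the right side into a fourfold sum of biases, which
    -- by `autocorrelation` is the sum of C(t)² over t. The term t = 0 alone suffices: C(0) is the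
    -- sum of the squared biases, hence at least `maxBias` squared.
    maxBias-fourth : + (maxBias * maxBias * (maxBias * maxBias)) ℤ.≤ + q ℤ.* (+ q ℤ.* (+ q ℤ.* discrepancy (1ᶠ ∷ (-ᶠ 1ᶠ) ∷ 1ᶠ ∷ (-ᶠ 1ᶠ) ∷ []) 0ᶠ))
    maxBias-fourth = ℤ.≤-trans (+≤+ (begin
        maxBias * maxBias * (maxBias * maxBias) ≤⟨ *-mono-≤ square square ⟩
        ∣ C 0ᶠ ∣ * ∣ C 0ᶠ ∣ ≤⟨ ∑-term (λ t → ∣ C t ∣ * ∣ C t ∣) (Enum.complete Fs 0ᶠ) ⟩
        ΣF (λ t → ∣ C t ∣ * ∣ C t ∣) ∎))
      (ℤ.≤-reflexive (sym (trans expanded (trans (autocorrelation ℤ.+-*-isCommutativeSemiring Fs _+ᶠ_ (λ c b → c +ᶠ -ᶠ b) k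
          (λ b c → solve 2 (λ b c → b :+ (c :+ :- b) := c) refl b c) (λ b t → solve 2 (λ b t → (b :+ t) :+ :- b := t) refl b t)
          (λ a b t → solve 3 (λ a b t → ((:0 :+ :1 :* a) :+ (:- :1) :* b) :+ :1 :* (b :+ t) := a :+ t) refl a b t) bias)
        (trans (ZS.∑-cong ws (λ t → square-abs (C t))) (sym (∑-pos ws _)))))))
      where
      open ≤-Reasoning
      C : Fin q → ℤ
      C t = ZΣF (λ a → bias a ℤ.* bias (a +ᶠ t))
      k : Fin q → Fin q → Fin q → Fin q
      k a b c = ((0ᶠ +ᶠ 1ᶠ *ᶠ a) +ᶠ (-ᶠ 1ᶠ) *ᶠ b) +ᶠ 1ᶠ *ᶠ c
      square : maxBias * maxBias ≤ ∣ C 0ᶠ ∣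
      square = ≤-trans (maximum-square ws (λ w → ∣ bias w ∣)) (≤-reflexive (sym (cong ∣_∣
        (trans (ZS.∑-cong ws (λ w → trans (cong (λ v → bias w ℤ.* bias v) (R.+-identityʳ w)) (square-abs (bias w)))) (sym (∑-pos ws _))))))
      pull : ∀ c → c ≢ 0ᶠ → ∀ (G : Fin q → ℤ) cs z → (∀ w → + q ℤ.* (+ q ℤ.* discrepancy cs (z +ᶠ c *ᶠ w)) ≡ G w) →
        + q ℤ.* (+ q ℤ.* (+ q ℤ.* discrepancy (c ∷ cs) z)) ≡ ZΣF (λ w → bias w ℤ.* G w)
      pull c c≢0 G cs z h = trans (cong (λ v → + q ℤ.* (+ q ℤ.* v)) (discrepancy-step c c≢0 cs z))
        (trans (cong (+ q ℤ.*_) (sym (ZS.∑-*ˡ ws (+ q) _))) (trans (sym (ZS.∑-*ˡ ws (+ q) _))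
          (ZS.∑-cong ws (λ w → trans (lem (+ q) (bias w) _) (cong (bias w ℤ.*_) (h w))))))
        where
        lem : ∀ q b d → q ℤ.* (q ℤ.* (b ℤ.* d)) ≡ b ℤ.* (q ℤ.* (q ℤ.* d))
        lem = ℤ-RingSolver.solve-∀
      expanded : + q ℤ.* (+ q ℤ.* (+ q ℤ.* discrepancy (1ᶠ ∷ (-ᶠ 1ᶠ) ∷ 1ᶠ ∷ (-ᶠ 1ᶠ) ∷ []) 0ᶠ)) ≡
                 ZΣF (λ a → bias a ℤ.* ZΣF (λ b → bias b ℤ.* ZΣF (λ c → bias c ℤ.* bias (k a b c))))
      expanded = pull 1ᶠ 1≢0 _ ((-ᶠ 1ᶠ) ∷ 1ᶠ ∷ (-ᶠ 1ᶠ) ∷ []) 0ᶠ (λ a → trans (cong (+ q ℤ.*_) (discrepancy-step (-ᶠ 1ᶠ) (-≢0 1≢0) (1ᶠ ∷ (-ᶠ 1ᶠ) ∷ []) (0ᶠ +ᶠ 1ᶠ *ᶠ a)))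
        (trans (sym (ZS.∑-*ˡ ws (+ q) _)) (ZS.∑-cong ws (λ b → trans (lem (+ q) (bias b) _) (cong (bias b ℤ.*_)
          (trans (discrepancy-step 1ᶠ 1≢0 ((-ᶠ 1ᶠ) ∷ []) ((0ᶠ +ᶠ 1ᶠ *ᶠ a) +ᶠ (-ᶠ 1ᶠ) *ᶠ b)) (ZS.∑-cong ws (λ c → cong (bias c ℤ.*_) (discrepancy-last (k a b c))))))))))
        where
        lem : ∀ q b d → q ℤ.* (b ℤ.* d) ≡ b ℤ.* (q ℤ.* d)
        lem = ℤ-RingSolver.solve-∀

-- Comparing solutions with coset averages

module Counting {q : ℕ} (F : FiniteField q) where
  open Geometry F
  open GroupSums F
  open CharacterSums F
  open Discrepancy F

  module _ {n} (f g base : Pt F n → ℕ) (a b : ℕ) (f≤g : ∀ x → a * f x ≤ b * g x) where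
    reps-mono : ∀ cs p → a ^ length cs * reps f base cs p ≤ b ^ length cs * reps g base cs p
    reps-mono [] p = ≤-refl
    reps-mono (c ∷ cs) p = begin
      a * a ^ length cs * ΣG (λ x → f x * reps f base cs (p ⊞ c ⊡ x)) ≡⟨ sym (∑-*ˡ xs (a * a ^ length cs) _) ⟩
      ΣG (λ x → a * a ^ length cs * (f x * reps f base cs (p ⊞ c ⊡ x)))
        ≤⟨ ∑-mono xs (λ x → ≤-trans (≤-reflexive (lem a (a ^ length cs) (f x) _)) (≤-trans (*-mono-≤ (f≤g x) (reps-mono cs _)) (≤-reflexive (lem b (g x) (b ^ length cs) _)))) ⟩
      ΣG (λ x → b * b ^ length cs * (g x * reps g base cs (p ⊞ c ⊡ x))) ≡⟨ ∑-*ˡ xs (b * b ^ length cs) _ ⟩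
      b * b ^ length cs * reps g base (c ∷ cs) p ∎
      where
      open ≤-Reasoning
      xs = elems (Gs n)
      lem : ∀ a b c d → a * b * (c * d) ≡ a * c * (b * d)
      lem = solve-∀

  alternating : List (Fin q)
  alternating = 1ᶠ ∷ (-ᶠ 1ᶠ) ∷ 1ᶠ ∷ (-ᶠ 1ᶠ) ∷ []

  module _ {n} (f : Pt F n → ℕ) where
    private xs = elems (Gs n)

    energy : reps f atZero alternating 𝟎 ≡ ΣG (λ t → ΣG (λ x → f x * f (x ⊞ t)) * ΣG (λ x → f x * f (x ⊞ t)))
    energy = trans (∑-cong xs (λ a → cong (f a *_) (∑-cong xs (λ b → cong (f b *_) (∑-cong xs (λ c → cong (f c *_) (last (k a b c))))))))
      (autocorrelation +-*-isCommutativeSemiring (Gs n) _⊞_ (λ c b → ⊟ b ⊞ c) k i₁ i₂ i₃ f)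
      where
      k : Pt F n → Pt F n → Pt F n → Pt F n
      k a b c = ((𝟎 ⊞ 1ᶠ ⊡ a) ⊞ (-ᶠ 1ᶠ) ⊡ b) ⊞ 1ᶠ ⊡ c
      i₁ : ∀ {n} (b c : Pt F n) → b ⊞ (⊟ b ⊞ c) ≡ c
      i₁ [] [] = refl
      i₁ (b ∷ bs) (c ∷ cs) = cong₂ _∷_ (solve 2 (λ b c → b :+ ((:- :1) :* b :+ c) := c) refl b c) (i₁ bs cs)
      i₂ : ∀ {n} (b t : Pt F n) → ⊟ b ⊞ (b ⊞ t) ≡ t
      i₂ [] [] = refl
      i₂ (b ∷ bs) (t ∷ ts) = cong₂ _∷_ (solve 2 (λ b t → (:- :1) :* b :+ (b :+ t) := t) refl b t) (i₂ bs ts)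
      i₃ : ∀ {n} (a b t : Pt F n) → ((𝟎 ⊞ 1ᶠ ⊡ a) ⊞ (-ᶠ 1ᶠ) ⊡ b) ⊞ 1ᶠ ⊡ (b ⊞ t) ≡ a ⊞ t
      i₃ [] [] [] = refl
      i₃ (a ∷ as) (b ∷ bs) (t ∷ ts) = cong₂ _∷_
        (solve 3 (λ a b t → ((:0 :+ :1 :* a) :+ (:- :1) :* b) :+ :1 :* (b :+ t) := a :+ t) refl a b t) (i₃ as bs ts)
      to : ∀ {n} (v x : Pt F n) → v ⊞ (-ᶠ 1ᶠ) ⊡ x ≡ 𝟎 → x ≡ v
      to v x e = trans (sym (⊞-identityˡ x)) (trans (cong (_⊞ x) (sym e)) (add-sub v x))
      last : ∀ v → ΣG (λ x → f x * atZero (v ⊞ (-ᶠ 1ᶠ) ⊡ x)) ≡ f v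
      last v = trans (∑-cong xs (λ x → trans (*-comm (f x) _) (cong (_* f x) (iv-cong ((v ⊞ (-ᶠ 1ᶠ) ⊡ x) ≟ᵛ 𝟎) (x ≟ᵛ v) (to v x) (λ { refl → ⊞-inverseʳ x }))))) (∑-point (Gs n) v f)

    -- Orthogonality: by `χ-sum-all`, summing χ(ℓ · p) over all ℓ detects p = 𝟎.
    Zreps-χ-sum : ∀ cs → ZΣG (λ ℓ → Zreps f (λ p → χ (dot ℓ p)) cs 𝟎) ≡ + (r * q ^ n * reps f atZero cs 𝟎)
    Zreps-χ-sum cs = begin
      ZΣG (λ ℓ → Zreps f (λ p → χ (dot ℓ p)) cs 𝟎) ≡⟨ ZS.∑-cong xs (λ ℓ → sym (ℤ.*-identityˡ _)) ⟩
      ZΣG (λ ℓ → + 1 ℤ.* Zreps f (λ p → χ (dot ℓ p)) cs 𝟎) ≡⟨ Zreps-sum xs (λ _ → + 1) f (λ ℓ p → χ (dot ℓ p)) cs 𝟎 ⟩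
      Zreps f (λ p → ZΣG (λ ℓ → + 1 ℤ.* χ (dot ℓ p))) cs 𝟎 ≡⟨ Zreps-cong f (λ p → trans (ZS.∑-cong xs (λ ℓ → ℤ.*-identityˡ _)) (χ-sum-all p)) cs 𝟎 ⟩
      Zreps f (λ p → + r ℤ.* + (q ^ n) ℤ.* + atZero p) cs 𝟎 ≡⟨ Zreps-pos f (+ r ℤ.* + (q ^ n)) atZero cs 𝟎 ⟩
      + r ℤ.* + (q ^ n) ℤ.* + reps f atZero cs 𝟎 ≡⟨ trans (cong (ℤ._* + reps f atZero cs 𝟎) (sym (ℤ.pos-* r _))) (sym (ℤ.pos-* (r * q ^ n) _)) ⟩
      + (r * q ^ n * reps f atZero cs 𝟎) ∎
      where open ≡-Reasoning

    fourth : Pt F n → ℕ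
    fourth ℓ = maxBias f ℓ * maxBias f ℓ * (maxBias f ℓ * maxBias f ℓ)

    -- Summing `maxBias-fourth` over all ℓ turns the alternating discrepancies into the additive
    -- energy. Their signs do not matter, as no absolute values are taken on that side.
    fourth-moment : ΣG fourth ≤ q * (q * (q * (r * q ^ n * reps f atZero alternating 𝟎)))
    fourth-moment = ℤ.drop‿+≤+ (begin
      + ΣG fourth ≡⟨ ∑-pos xs fourth ⟩
      ZΣG (λ ℓ → + fourth ℓ) ≤⟨ ∑-≤ᶻ xs (λ ℓ → ℤ.≤-trans (maxBias-fourth f ℓ) (ℤ.≤-reflexive (cong (λ v → + q ℤ.* (+ q ℤ.* (+ q ℤ.* v)))
          (sym (trans (Zreps≡discrepancy f ℓ alternating 𝟎) (cong (discrepancy f ℓ alternating) (dot-zeroʳ ℓ))))))) ⟩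
      ZΣG (λ ℓ → + q ℤ.* (+ q ℤ.* (+ q ℤ.* Zreps f (λ p → χ (dot ℓ p)) alternating 𝟎)))
        ≡⟨ trans (ZS.∑-*ˡ xs (+ q) _) (cong (+ q ℤ.*_) (trans (ZS.∑-*ˡ xs (+ q) _) (cong (+ q ℤ.*_) (trans (ZS.∑-*ˡ xs (+ q) _) (cong (+ q ℤ.*_) (Zreps-χ-sum alternating)))))) ⟩
      + q ℤ.* (+ q ℤ.* (+ q ℤ.* + (r * q ^ n * reps f atZero alternating 𝟎)))
        ≡⟨ trans (cong (λ v → + q ℤ.* (+ q ℤ.* v)) (sym (ℤ.pos-* q _))) (trans (cong (+ q ℤ.*_) (sym (ℤ.pos-* q _))) (sym (ℤ.pos-* q _))) ⟩
      + (q * (q * (q * (r * q ^ n * reps f atZero alternating 𝟎)))) ∎)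
      where open ℤ.≤-Reasoning

    module _ (Ls : List (Pt F n)) where
      open Orthogonal Ls

      -- The sum over all ℓ counts solutions. Its part over `W` counts the tuples whose combination
      -- lies in H, by `χ-sum-W`; outside `W` each ℓ is bounded by its maximal bias.
      comparison : ∀ cs → All (_≢ 0ᶠ) cs → r * ∣W∣ * reps f (λ p → iv (H? p)) cs 𝟎 ≤
        r * q ^ n * reps f atZero cs 𝟎 + ΣG (λ ℓ → iv (¬? (W? ℓ)) * (q * maxBias f ℓ ^ length cs))
      comparison cs cs≢0 = begin
        r * ∣W∣ * cnt ≤⟨ from-identity (r * ∣W∣ * cnt) (r * q ^ n * reps f atZero cs 𝟎) rest identity ⟩
        r * q ^ n * reps f atZero cs 𝟎 + ∣ rest ∣ ≤⟨ +-monoʳ-≤ (r * q ^ n * reps f atZero cs 𝟎) (≤-trans (∣∑∣≤ xs _) (∑-mono xs term)) ⟩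
        r * q ^ n * reps f atZero cs 𝟎 + ΣG (λ ℓ → iv (¬? (W? ℓ)) * (q * maxBias f ℓ ^ length cs)) ∎
        where
        open ≤-Reasoning
        Z : Pt F n → ℤ
        Z ℓ = Zreps f (λ p → χ (dot ℓ p)) cs 𝟎
        cnt = reps f (λ p → iv (H? p)) cs 𝟎
        rest = ZΣG (λ ℓ → + iv (¬? (W? ℓ)) ℤ.* Z ℓ)
        from-identity : ∀ a b s → + b ≡ + a ℤ.+ s → a ≤ b + ∣ s ∣
        from-identity a b s e = ≤-trans (≤-reflexive (cong ∣_∣ (trans (lem (+ a) s) (cong (ℤ._+ ℤ.- s) (sym e)))))
          (≤-trans (ℤ.∣i+j∣≤∣i∣+∣j∣ (+ b) (ℤ.- s)) (≤-reflexive (cong (λ v → b + v) (ℤ.∣-i∣≡∣i∣ s))))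
          where lem : ∀ a s → a ≡ (a ℤ.+ s) ℤ.+ ℤ.- s
                lem = ℤ-RingSolver.solve-∀
        W-part : ZΣG (λ ℓ → + iv (W? ℓ) ℤ.* Z ℓ) ≡ + (r * ∣W∣ * cnt)
        W-part = trans (Zreps-sum xs (λ ℓ → + iv (W? ℓ)) f (λ ℓ p → χ (dot ℓ p)) cs 𝟎)
          (trans (Zreps-cong f χ-sum-W cs 𝟎) (trans (Zreps-pos f (+ r ℤ.* + ∣W∣) (λ p → iv (H? p)) cs 𝟎)
            (trans (cong (ℤ._* + cnt) (sym (ℤ.pos-* r _))) (sym (ℤ.pos-* (r * ∣W∣) _)))))
        split : ∀ ℓ → Z ℓ ≡ + iv (W? ℓ) ℤ.* Z ℓ ℤ.+ + iv (¬? (W? ℓ)) ℤ.* Z ℓ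
        split ℓ with W? ℓ
        ... | yes _ = lem (Z ℓ)
          where lem : ∀ z → z ≡ + 1 ℤ.* z ℤ.+ + 0 ℤ.* z
                lem = ℤ-RingSolver.solve-∀
        ... | no _ = lem (Z ℓ)
          where lem : ∀ z → z ≡ + 0 ℤ.* z ℤ.+ + 1 ℤ.* z
                lem = ℤ-RingSolver.solve-∀
        identity : + (r * q ^ n * reps f atZero cs 𝟎) ≡ + (r * ∣W∣ * cnt) ℤ.+ rest
        identity = trans (sym (Zreps-χ-sum cs)) (trans (ZS.∑-cong xs split) (trans (ZS.∑-+ xs _ _) (cong (ℤ._+ rest) W-part)))
        term : ∀ ℓ → ∣ + iv (¬? (W? ℓ)) ℤ.* Z ℓ ∣ ≤ iv (¬? (W? ℓ)) * (q * maxBias f ℓ ^ length cs)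
        term ℓ = ≤-trans (≤-reflexive (ℤ.abs-* (+ iv (¬? (W? ℓ))) (Z ℓ))) (*-monoʳ-≤ (iv (¬? (W? ℓ)))
          (≤-trans (≤-reflexive (cong ∣_∣ (Zreps≡discrepancy f ℓ cs 𝟎))) (discrepancy-bound f ℓ cs cs≢0 (dot ℓ 𝟎))))

  module Smoothing {n} (Ls : List (Pt F n)) (f : Pt F n → ℕ) where
    open Orthogonal Ls
    private xs = elems (Gs n)

    H-𝟎 : H 𝟎
    H-𝟎 = All.tabulate (λ {ℓ} _ → dot-zeroʳ ℓ)

    H-scale : ∀ c y → H y → H (c ⊡ y)
    H-scale c y h = subst H (⊞-identityˡ _) (H-affine 𝟎 y c H-𝟎 h)

    H-add : ∀ x y → H x → H y → H (x ⊞ y)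
    H-add x y hx hy = subst (λ v → H (x ⊞ v)) (⊡-identity y) (H-affine x y 1ᶠ hx hy)

    H-shift : ∀ w → H w → (G : Pt F n → ℕ) → ΣG (λ y → iv (H? y) * G (y ⊞ w)) ≡ ΣG (λ y → iv (H? y) * G y)
    H-shift w hw G = trans (∑-cong xs (λ y → cong (_* G (y ⊞ w)) (iv-cong (H? y) (H? (y ⊞ w)) (λ h → H-add y w h hw)
        (λ h → subst H (sub-add y w) (H-add (y ⊞ w) (⊟ w) h (H-scale _ w hw)))))) (ΣG-shift w (λ y → iv (H? y) * G y))

    H-dilate : ∀ c → c ≢ 0ᶠ → (G : Pt F n → ℕ) → ΣG (λ y → iv (H? y) * G (c ⊡ y)) ≡ ΣG (λ y → iv (H? y) * G y)
    H-dilate c c≢0 G = trans (∑-cong xs (λ y → cong (_* G (c ⊡ y)) (iv-cong (H? y) (H? (c ⊡ y)) (H-scale c y)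
        (λ h → subst H (inv-⊡ c c≢0 y) (H-scale _ _ h))))) (ΣG-dilate c c≢0 (λ y → iv (H? y) * G y))

    average : Pt F n → ℕ
    average x = ΣG (λ y → iv (H? y) * f (y ⊞ x))

    private
      exch : ∀ a b c → a * (b * c) ≡ b * (a * c)
      exch = solve-∀

      -- Substituting x by x − y moves the averaging onto the argument of the remaining count.
      unfold : ∀ c (G : Pt F n → ℕ) p → ΣG (λ x → average x * G (p ⊞ c ⊡ x)) ≡
               ΣG (λ x → f x * ΣG (λ y → iv (H? y) * G ((p ⊞ c ⊡ x) ⊞ (-ᶠ c) ⊡ y)))
      unfold c G p = begin
        ΣG (λ x → average x * G (p ⊞ c ⊡ x)) ≡⟨ trans (∑-cong xs (λ x → sym (∑-*ʳ xs (G (p ⊞ c ⊡ x)) _))) (∑-swap xs xs _) ⟩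
        ΣG (λ y → ΣG (λ x → iv (H? y) * f (y ⊞ x) * G (p ⊞ c ⊡ x)))
          ≡⟨ ∑-cong xs (λ y → trans (∑-cong xs (λ x → trans (*-assoc (iv (H? y)) _ _) (cong (λ v → iv (H? y) * (f (y ⊞ x) * G v)) (back c p x y))))
               (ΣG-shiftˡ y (λ x → iv (H? y) * (f x * G ((p ⊞ c ⊡ x) ⊞ (-ᶠ c) ⊡ y))))) ⟩
        ΣG (λ y → ΣG (λ x → iv (H? y) * (f x * G ((p ⊞ c ⊡ x) ⊞ (-ᶠ c) ⊡ y)))) ≡⟨ ∑-swap xs xs _ ⟩
        ΣG (λ x → ΣG (λ y → iv (H? y) * (f x * G ((p ⊞ c ⊡ x) ⊞ (-ᶠ c) ⊡ y))))
          ≡⟨ ∑-cong xs (λ x → trans (∑-cong xs (λ y → exch (iv (H? y)) (f x) _)) (∑-*ˡ xs (f x) _)) ⟩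
        ΣG (λ x → f x * ΣG (λ y → iv (H? y) * G ((p ⊞ c ⊡ x) ⊞ (-ᶠ c) ⊡ y))) ∎
        where
        open ≡-Reasoning
        back : ∀ {n} c (p x y : Pt F n) → p ⊞ c ⊡ x ≡ (p ⊞ c ⊡ (y ⊞ x)) ⊞ (-ᶠ c) ⊡ y
        back c [] [] [] = refl
        back c (p ∷ ps) (x ∷ xs) (y ∷ ys) = cong₂ _∷_ (solve 4 (λ c p x y → p :+ c :* x := (p :+ c :* (y :+ x)) :+ (:- c) :* y) refl c p x y) (back c ps xs ys)

      averaged : ∀ cs p → ΣG (λ y → iv (H? y) * reps average atZero cs (p ⊞ y)) ≡ ∣H∣ ^ length cs * reps f (λ p → iv (H? p)) cs p
      averaged [] p = trans (∑-cong xs (λ y → trans (*-comm (iv (H? y)) _) (cong (_* iv (H? y)) (iv-cong ((p ⊞ y) ≟ᵛ 𝟎) (y ≟ᵛ (⊟ p)) (to y) (λ { refl → ⊞-inverseʳ p })))))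
        (trans (∑-point (Gs n) (⊟ p) (λ y → iv (H? y))) (trans (iv-cong (H? (⊟ p)) (H? p) (λ h → subst H (involutive p) (H-scale _ _ h)) (H-scale _ p)) (sym (*-identityˡ _))))
        where
        involutive : ∀ {n} (p : Pt F n) → ⊟ (⊟ p) ≡ p
        involutive [] = refl
        involutive (a ∷ p) = cong₂ _∷_ (solve 1 (λ a → (:- :1) :* ((:- :1) :* a) := a) refl a) (involutive p)
        to : ∀ y → p ⊞ y ≡ 𝟎 → y ≡ ⊟ p
        to y e = trans (sym (sub-add y p)) (trans (cong (_⊞ ⊟ p) (trans (⊞-comm y p) e)) (⊞-identityˡ _))
      averaged (c ∷ cs) p = begin
        ΣG (λ z → iv (H? z) * ΣG (λ x → average x * R (p ⊞ z ⊞ c ⊡ x)))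
          ≡⟨ ∑-cong xs (λ z → cong (iv (H? z) *_) (unfold c R (p ⊞ z))) ⟩
        ΣG (λ z → iv (H? z) * ΣG (λ x → f x * ΣG (λ y → iv (H? y) * R ((p ⊞ z ⊞ c ⊡ x) ⊞ (-ᶠ c) ⊡ y))))
          ≡⟨ trans (∑-cong xs (λ z → sym (∑-*ˡ xs (iv (H? z)) _))) (trans (∑-swap xs xs _) (∑-cong xs (λ x → trans (∑-cong xs (λ z → exch (iv (H? z)) (f x) _)) (∑-*ˡ xs (f x) _)))) ⟩
        ΣG (λ x → f x * ΣG (λ z → iv (H? z) * ΣG (λ y → iv (H? y) * R ((p ⊞ z ⊞ c ⊡ x) ⊞ (-ᶠ c) ⊡ y)))) ≡⟨ ∑-cong xs (λ x → cong (f x *_) (inner x)) ⟩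
        ΣG (λ x → f x * (∣H∣ * (∣H∣ ^ length cs * reps f (λ p → iv (H? p)) cs (p ⊞ c ⊡ x))))
          ≡⟨ trans (∑-cong xs (λ x → trans (cong (f x *_) (sym (*-assoc ∣H∣ _ _))) (exch (f x) (∣H∣ ^ suc (length cs)) _))) (∑-*ˡ xs (∣H∣ ^ suc (length cs)) _) ⟩
        ∣H∣ ^ suc (length cs) * reps f (λ p → iv (H? p)) (c ∷ cs) p ∎
        where
        open ≡-Reasoning
        R = reps average atZero cs
        arrange : ∀ {n} c (p z x y : Pt F n) → (p ⊞ z ⊞ c ⊡ x) ⊞ (-ᶠ c) ⊡ y ≡ (p ⊞ c ⊡ x) ⊞ (z ⊞ (-ᶠ c) ⊡ y)
        arrange c [] [] [] [] = refl
        arrange c (p ∷ ps) (z ∷ zs) (x ∷ xs) (y ∷ ys) = cong₂ _∷_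
          (solve 5 (λ c p z x y → ((p :+ z) :+ c :* x) :+ (:- c) :* y := (p :+ c :* x) :+ (z :+ (:- c) :* y)) refl c p z x y) (arrange c ps zs xs ys)
        inner : ∀ x → ΣG (λ z → iv (H? z) * ΣG (λ y → iv (H? y) * R ((p ⊞ z ⊞ c ⊡ x) ⊞ (-ᶠ c) ⊡ y))) ≡ ∣H∣ * (∣H∣ ^ length cs * reps f (λ p → iv (H? p)) cs (p ⊞ c ⊡ x))
        inner x = trans (trans (∑-cong xs (λ z → sym (∑-*ˡ xs (iv (H? z)) _))) (∑-swap xs xs _))
          (trans (∑-cong xs (λ y → trans (∑-cong xs (λ z → exch (iv (H? z)) (iv (H? y)) _)) (trans (∑-*ˡ xs (iv (H? y)) _) (per-y y))))
            (∑-*ʳ xs _ _))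
          where
          per-y : ∀ y → iv (H? y) * ΣG (λ z → iv (H? z) * R ((p ⊞ z ⊞ c ⊡ x) ⊞ (-ᶠ c) ⊡ y)) ≡ iv (H? y) * (∣H∣ ^ length cs * reps f (λ p → iv (H? p)) cs (p ⊞ c ⊡ x))
          per-y y with H? y
          ... | no _ = refl
          ... | yes h = cong (1 *_) (trans (∑-cong xs (λ z → cong (λ v → iv (H? z) * R v) (arrange c p z x y)))
                (trans (H-shift ((-ᶠ c) ⊡ y) (H-scale _ y h) (λ z → R ((p ⊞ c ⊡ x) ⊞ z))) (averaged cs (p ⊞ c ⊡ x))))

    -- Unfolding the average in the first variable relaxes the equation to membership in H.
    -- Unfolding it in each other variable then only translates within H and gives a factor |H|,
    -- hence the exponent `length cs` for one variable more.
    smoothed : ∀ c cs → c ≢ 0ᶠ → ∀ p → reps average atZero (c ∷ cs) p ≡ ∣H∣ ^ length cs * reps f (λ p → iv (H? p)) (c ∷ cs) p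
    smoothed c cs c≢0 p = trans (unfold c (reps average atZero cs) p) (trans (∑-cong xs (λ x → trans
        (cong (f x *_) (trans (H-dilate (-ᶠ c) (-≢0 c≢0) (λ y → reps average atZero cs ((p ⊞ c ⊡ x) ⊞ y))) (averaged cs (p ⊞ c ⊡ x))))
        (exch (f x) (∣H∣ ^ length cs) _))) (∑-*ˡ xs (∣H∣ ^ length cs) _))

-- The density bound

≤2^* : ∀ x {l} → 1 ≤ l → x ≤ 2 ^ (x * l)
≤2^* x 1≤l = ≤-trans (<⇒≤ (n<2^n x)) (^-monoʳ-≤ 2 (≤-trans (≤-reflexive (sym (*-identityʳ x))) (*-monoʳ-≤ x 1≤l)))

square-mono : ∀ {x y} → x ≤ y → x * x ≤ y * y
square-mono h = *-mono-≤ h h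

module DensityBound {q : ℕ} (F : FiniteField q) (s' t k' : ℕ) (cs : List (Fin q)) where
  open Geometry F
  open GroupSums F
  open CharacterSums F using (r; module Orthogonal; codimension)
  open Discrepancy F using (maxBias)
  open Counting F
  open Supersaturation F using (Super)

  -- `C-A` is the constant of `size-bound`; `mA` and `mH` are the values of `momentConstant` for X =
  -- A with C = `C-A`, and for X = H with C = 2.
  s k C-A mA mH : ℕ
  s = suc (suc s')
  k = 5 + k'
  C-A = s * t
  mA = s * s + s ^ s * (t * C-A ^ s)
  mH = s * s + s ^ s * (t * 2 ^ s)

  module _ (1≤t : 1 ≤ t) (len : length cs ≡ k) (cs≢0 : All (_≢ 0ᶠ) cs) (supersat : Super cs) where
    -- Exponents of 2^l. B has density at least 2^(-cB l), and σ is the supersaturation exponent at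
    -- that density. `cE` makes E exceed every factor lost between main and error term. In
    -- `threshold` the first bracket bounds the codimension of H by n/2 and the second serves the
    -- final contradiction.
    cB σ cE threshold : ℕ
    cB = 2 + 4 * mH
    σ = proj₁ supersat * (cB + 1)
    cE = k + σ + k + 1 + q ^ 5 * mA
    threshold = (4 * cE + 1 + q ^ 4 * mA) + (σ + k + 5)

    1≤threshold : 1 ≤ threshold
    1≤threshold = ≤-trans (m≤n+m 1 (4 * cE)) (≤-trans (m≤m+n (4 * cE + 1) (q ^ 4 * mA)) (m≤m+n (4 * cE + 1 + q ^ 4 * mA) (σ + k + 5)))

    module _ (n l : ℕ) (1≤l : 1 ≤ l) (l-small : 2 ^ (threshold * l) ≤ n)
      {A : Pt F n → Set} (A? : ∀ x → Dec (A x))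
      (free : ¬ (Σ (Fin s → Pt F n) λ x → Σ (Fin t → Pt F n) λ y →
        Injective _≡_ _≡_ x × Injective _≡_ _≡_ y × (∀ i j → A (_⊕_ F (x i) (y j)))))
      (few-solutions : reps (λ x → iv (A? x)) atZero cs 𝟎 ≤ ΣG (λ x → iv (A? x))) where
      open KovariSosTuran F A? s t free

      private
        xs = elems (Gs n)
        f : Pt F n → ℕ
        f x = iv (A? x)

        -- `M` is N^(1/s) rounded down to a power of q, and `R'` is N/M², the order of the mean
        -- number of representations of a point as a difference when A has about N/M elements.
        -- Functionals count as biased when the bias exceeds N/M by a factor more than 1/E.
        N m M R' E a : ℕ
        N = q ^ n
        m = n / s
        M = q ^ m
        R' = q ^ (n ∸ 2 * m)
        E = 2 ^ (cE * l)
        a = ΣG f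

        1≤q : 1 ≤ q
        1≤q = ≤-trans (s≤s z≤n) 2≤q

        s*m≤n : s * m ≤ n
        s*m≤n = ≤-trans (≤-reflexive (*-comm s m)) (m/n*n≤m n s)
        2*m≤n : 2 * m ≤ n
        2*m≤n = ≤-trans (*-monoˡ-≤ m {2} {s} (s≤s (s≤s z≤n))) s*m≤n

        M^s≤N : M ^ s ≤ N
        M^s≤N = ≤-trans (≤-reflexive (trans (^-*-assoc q m s) (cong (q ^_) (*-comm m s)))) (^-monoʳ-≤ q {{>-nonZero 1≤q}} s*m≤n)

        R'MM : R' * (M * M) ≡ N
        R'MM = trans (cong (R' *_) (trans (sym (^-distribˡ-+-* q m m)) (cong (λ v → q ^ (m + v)) (sym (+-identityʳ m)))))
          (trans (sym (^-distribˡ-+-* q (n ∸ 2 * m) (2 * m))) (cong (q ^_) (m∸n+n≡m 2*m≤n)))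

        a-bound : a ≤ C-A * R' * M
        a-bound = *-cancelʳ-≤ a _ M {{>-nonZero (1≤q^ m)}} (≤-trans (size-bound (s≤s z≤n) 1≤t M M^s≤N)
          (≤-reflexive (trans (cong (C-A *_) (sym R'MM)) (lem C-A R' M))))
          where lem : ∀ c r m → c * (r * (m * m)) ≡ c * r * m * m
                lem = solve-∀

        energy-bound : reps f atZero alternating 𝟎 ≤ mA * (N * (R' * R'))
        energy-bound = ≤-trans (≤-reflexive (energy f)) (second-moment A? s' refl M M^s≤N C-A R' (1≤q^ (n ∸ 2 * m)) a-bound)

        fourth-bound : ΣG (fourth f) * (M * M * (M * M)) ≤ q ^ 4 * mA * (N * N * (N * N))
        fourth-bound = begin
          ΣG (fourth f) * (M * M * (M * M)) ≤⟨ *-monoˡ-≤ (M * M * (M * M)) (≤-trans (fourth-moment f) (*-monoʳ-≤ q (*-monoʳ-≤ q (*-monoʳ-≤ q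
               (*-mono-≤ (*-monoˡ-≤ N (pred[n]≤n {q})) energy-bound))))) ⟩
          q * (q * (q * (q * N * (mA * (N * (R' * R')))))) * (M * M * (M * M)) ≡⟨ lem q N mA R' (M * M) ⟩
          q ^ 4 * mA * (N * N * (R' * (M * M) * (R' * (M * M)))) ≡⟨ cong (λ v → q ^ 4 * mA * (N * N * (v * v))) R'MM ⟩
          q ^ 4 * mA * (N * N * (N * N)) ∎
          where
          open ≤-Reasoning
          lem : ∀ q N c R Q → q * (q * (q * (q * N * (c * (N * (R * R)))))) * (Q * Q) ≡ q * (q * (q * (q * 1))) * c * (N * N * (R * Q * (R * Q)))
          lem = solve-∀

        big? : ∀ ℓ → Dec (N < maxBias f ℓ * (E * M))
        big? ℓ = N <? maxBias f ℓ * (E * M)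

        Ls : List (Pt F n)
        Ls = filter big? xs

        open Orthogonal Ls

        pow4 : ℕ → ℕ
        pow4 x = x * x * (x * x)

        few-big : length Ls ≤ pow4 E * (q ^ 4 * mA)
        few-big = *-cancelʳ-≤ _ _ (pow4 N) {{>-nonZero (*-mono-≤ (*-mono-≤ (1≤q^ n) (1≤q^ n)) (*-mono-≤ (1≤q^ n) (1≤q^ n)))}} (begin
          length Ls * pow4 N ≡⟨ cong (_* pow4 N) (length-filter big? xs) ⟩
          ΣG (λ ℓ → iv (big? ℓ)) * pow4 N ≡⟨ sym (∑-*ʳ xs (pow4 N) _) ⟩
          ΣG (λ ℓ → iv (big? ℓ) * pow4 N) ≤⟨ ∑-mono xs bound ⟩
          ΣG (λ ℓ → fourth f ℓ * pow4 (E * M)) ≡⟨ ∑-*ʳ xs (pow4 (E * M)) _ ⟩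
          ΣG (fourth f) * pow4 (E * M) ≡⟨ lem₁ (ΣG (fourth f)) E M ⟩
          pow4 E * (ΣG (fourth f) * pow4 M) ≤⟨ *-monoʳ-≤ (pow4 E) fourth-bound ⟩
          pow4 E * (q ^ 4 * mA * pow4 N) ≡⟨ sym (*-assoc (pow4 E) _ _) ⟩
          pow4 E * (q ^ 4 * mA) * pow4 N ∎)
          where
          open ≤-Reasoning
          lem₁ : ∀ Σ E M → Σ * (E * M * (E * M) * (E * M * (E * M))) ≡ E * E * (E * E) * (Σ * (M * M * (M * M)))
          lem₁ = solve-∀
          lem₂ : ∀ b e → b * e * (b * e) * (b * e * (b * e)) ≡ b * b * (b * b) * (e * e * (e * e))
          lem₂ = solve-∀
          bound : ∀ ℓ → iv (big? ℓ) * pow4 N ≤ fourth f ℓ * pow4 (E * M)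
          bound ℓ with big? ℓ
          ... | no _ = z≤n
          ... | yes h = ≤-trans (≤-reflexive (*-identityˡ _)) (≤-trans (square-mono (square-mono (<⇒≤ h))) (≤-reflexive (lem₂ (maxBias f ℓ) (E * M))))

        -- The number of biased functionals is of order E^4, a power of 2^l; this is the constraint
        -- that forces l to be of order log n.
        codim-small : 2 * length Ls ≤ n
        codim-small = ≤-trans (begin
          2 * length Ls ≤⟨ *-monoʳ-≤ 2 few-big ⟩
          2 * (pow4 E * (q ^ 4 * mA)) ≤⟨ *-monoʳ-≤ 2 (*-monoʳ-≤ (pow4 E) (≤2^* (q ^ 4 * mA) 1≤l)) ⟩
          2 * (pow4 E * 2 ^ (q ^ 4 * mA * l)) ≡⟨ cong (λ v → 2 * (v * 2 ^ (q ^ 4 * mA * l))) (trans (cong₂ _*_ EE EE) (sym (^-distribˡ-+-* 2 (cE * l + cE * l) (cE * l + cE * l)))) ⟩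
          2 * (2 ^ ((cE * l + cE * l) + (cE * l + cE * l)) * 2 ^ (q ^ 4 * mA * l)) ≡⟨ cong (2 *_) (sym (^-distribˡ-+-* 2 ((cE * l + cE * l) + (cE * l + cE * l)) (q ^ 4 * mA * l))) ⟩
          2 ^ suc ((cE * l + cE * l) + (cE * l + cE * l) + q ^ 4 * mA * l) ≤⟨ ^-monoʳ-≤ 2 exponent ⟩
          2 ^ (threshold * l) ∎) l-small
          where
          open ≤-Reasoning
          EE : E * E ≡ 2 ^ (cE * l + cE * l)
          EE = sym (^-distribˡ-+-* 2 (cE * l) (cE * l))
          exponent : suc ((cE * l + cE * l) + (cE * l + cE * l) + q ^ 4 * mA * l) ≤ threshold * l
          exponent = ≤-trans (+-monoˡ-≤ ((cE * l + cE * l) + (cE * l + cE * l) + q ^ 4 * mA * l) 1≤l)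
            (≤-trans (m≤m+n _ ((σ + k + 5) * l)) (≤-reflexive (lem cE (q ^ 4 * mA) (σ + k + 5) l)))
            where lem : ∀ c x y l → l + ((c * l + c * l) + (c * l + c * l) + x * l) + y * l ≡ ((4 * c + 1 + x) + y) * l
                  lem = solve-∀

        -- Both the codimension of H and m are at most n/2, the latter because s ≥ 2. This makes `R`
        -- at least 1, as `second-moment` requires.
        M≤∣H∣ : M ≤ ∣H∣
        M≤∣H∣ = *-cancelˡ-≤ (q ^ length Ls) {{>-nonZero (1≤q^ (length Ls))}}
          (≤-trans (≤-reflexive (sym (^-distribˡ-+-* q (length Ls) m)))
            (≤-trans (^-monoʳ-≤ q {{>-nonZero 1≤q}} fits) (codimension Ls)))
          where
          fits : length Ls + m ≤ n
          fits = *-cancelˡ-≤ {length Ls + m} {n} 2 (≤-trans (≤-reflexive (*-distribˡ-+ 2 (length Ls) m))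
            (≤-trans (+-mono-≤ codim-small 2*m≤n) (≤-reflexive (cong (λ v → n + v) (sym (+-identityʳ n))))))

        instance
          M≢0 : NonZero M
          M≢0 = >-nonZero (1≤q^ m)

        R : ℕ
        R = ∣H∣ / M

        RM≤∣H∣ : R * M ≤ ∣H∣
        RM≤∣H∣ = m/n*n≤m ∣H∣ M

        ∣H∣<RM+M : ∣H∣ < M + R * M
        ∣H∣<RM+M = ≤-trans (s≤s (≤-reflexive (m≡m%n+[m/n]*n ∣H∣ M))) (+-monoˡ-≤ (R * M) (m%n<n ∣H∣ M))

        1≤R : 1 ≤ R
        1≤R with R in e
        ... | suc _ = s≤s z≤n
        ... | zero = contradiction M≤∣H∣ (<⇒≱ (subst (λ R → ∣H∣ < M + R * M) e (≤-trans ∣H∣<RM+M ≤-refl)) ∘ (λ h → ≤-trans (≤-reflexive (+-identityʳ M)) h))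

        ∣H∣≤2RM : ∣H∣ ≤ 2 * R * M
        ∣H∣≤2RM = ≤-trans (<⇒≤ ∣H∣<RM+M) (≤-trans (+-monoˡ-≤ (R * M) (≤-trans (≤-reflexive (sym (*-identityˡ M))) (*-monoˡ-≤ M 1≤R)))
          (≤-reflexive (trans (cong (λ v → R * M + v) (sym (+-identityʳ (R * M)))) (sym (*-assoc 2 R M)))))

        -- The number of elements of A in the coset x + H. It is by definition both an incidence
        -- with X = H and the `average` of `Smoothing`, so moment bound and smoothing identity apply
        -- to it alike.
        deg : Pt F n → ℕ
        deg = incidence H?

        deg-square : ΣG (λ x → deg x * deg x) ≤ mH * (N * (R * R))
        deg-square = second-moment H? s' refl M M^s≤N 2 R 1≤R ∣H∣≤2RM

        deg-sum : ΣG deg ≡ ∣H∣ * a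
        deg-sum = trans (∑-swap xs xs _) (trans (∑-cong xs (λ y → trans (∑-*ˡ xs (iv (H? y)) _) (cong (iv (H? y) *_) (ΣG-shiftˡ y f)))) (∑-*ʳ xs a _))

        dense? : ∀ x → Dec (∣H∣ * a ≤ 2 * N * deg x)
        dense? x = ∣H∣ * a ≤? 2 * N * deg x

        β T cnt : ℕ
        β = ΣG (λ x → iv (dense? x))
        T = reps (λ x → iv (dense? x)) atZero cs 𝟎
        cnt = reps f (λ p → iv (H? p)) cs 𝟎

        dense-mass : ∣H∣ * a ≤ 2 * ΣG (λ x → iv (dense? x) * deg x)
        dense-mass = *-cancelˡ-≤ N {{>-nonZero (1≤q^ n)}} (+-cancelˡ-≤ (N * (∣H∣ * a)) _ _ (begin
          N * (∣H∣ * a) + N * (∣H∣ * a) ≡⟨ l₁ N (∣H∣ * a) ⟩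
          2 * N * (∣H∣ * a) ≡⟨ trans (cong (2 * N *_) (sym deg-sum)) (sym (∑-*ˡ xs (2 * N) deg)) ⟩
          ΣG (λ x → 2 * N * deg x) ≤⟨ ∑-mono xs split ⟩
          ΣG (λ x → ∣H∣ * a + 2 * N * (iv (dense? x) * deg x)) ≡⟨ trans (∑-+ xs _ _) (cong₂ _+_ (ΣG-const n _) (∑-*ˡ xs (2 * N) _)) ⟩
          N * (∣H∣ * a) + 2 * N * ΣG (λ x → iv (dense? x) * deg x) ≡⟨ cong (λ v → N * (∣H∣ * a) + v) (l₂ N (ΣG (λ x → iv (dense? x) * deg x))) ⟩
          N * (∣H∣ * a) + N * (2 * ΣG (λ x → iv (dense? x) * deg x)) ∎))
          where
          open ≤-Reasoning
          l₁ : ∀ a b → a * b + a * b ≡ 2 * a * b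
          l₁ = solve-∀
          l₂ : ∀ a b → 2 * a * b ≡ a * (2 * b)
          l₂ = solve-∀
          split : ∀ x → 2 * N * deg x ≤ ∣H∣ * a + 2 * N * (iv (dense? x) * deg x)
          split x with dense? x
          ... | yes _ = ≤-trans (≤-reflexive (cong (2 * N *_) (sym (*-identityˡ (deg x))))) (m≤n+m _ (∣H∣ * a))
          ... | no h = ≤-trans (<⇒≤ (≰⇒> h)) (m≤m+n _ _)

        -- Points whose coset count is below half the mean carry at most half of the mass;
        -- Cauchy-Schwarz with `deg-square` shows that the other half needs many points.
        dense-many : (a * M) * (a * M) ≤ 4 * mH * (N * β)
        dense-many = *-cancelˡ-≤ (R * R) {{>-nonZero (*-mono-≤ 1≤R 1≤R)}} (begin
          R * R * ((a * M) * (a * M)) ≡⟨ l₁ R a M ⟩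
          (R * M * a) * (R * M * a) ≤⟨ square-mono (≤-trans (*-monoˡ-≤ a RM≤∣H∣) dense-mass) ⟩
          2 * D * (2 * D) ≡⟨ l₂ D ⟩
          4 * (D * D) ≤⟨ *-monoʳ-≤ 4 (cauchy-schwarz xs (λ x → iv (dense? x)) deg) ⟩
          4 * (ΣG (λ x → iv (dense? x) * iv (dense? x)) * ΣG (λ x → deg x * deg x)) ≤⟨ *-monoʳ-≤ 4 (*-mono-≤ (≤-reflexive (∑-cong xs idem)) deg-square) ⟩
          4 * (β * (mH * (N * (R * R)))) ≡⟨ l₃ β mH N (R * R) ⟩
          R * R * (4 * mH * (N * β)) ∎)
          where
          open ≤-Reasoning
          D = ΣG (λ x → iv (dense? x) * deg x)
          l₁ : ∀ R a M → R * R * ((a * M) * (a * M)) ≡ (R * M * a) * (R * M * a)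
          l₁ = solve-∀
          l₂ : ∀ D → 2 * D * (2 * D) ≡ 4 * (D * D)
          l₂ = solve-∀
          l₃ : ∀ b m N R → 4 * (b * (m * (N * R))) ≡ R * (4 * m * (N * b))
          l₃ = solve-∀
          idem : ∀ x → iv (dense? x) * iv (dense? x) ≡ iv (dense? x)
          idem x with dense? x
          ... | yes _ = refl
          ... | no _ = refl

        len-pred : pred (length cs) ≡ 4 + k'
        len-pred = cong pred len

        -- Solutions weighted by the product of the coset counts: a solution among dense points has
        -- large weight, while `smoothed` evaluates the total weight exactly.
        V-bound : (∣H∣ * a) ^ k * T ≤ (2 * N) ^ k * (∣H∣ ^ (4 + k') * cnt)
        V-bound = subst (λ k → (∣H∣ * a) ^ k * T ≤ (2 * N) ^ k * (∣H∣ ^ (4 + k') * cnt)) len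
          (≤-trans (reps-mono (λ x → iv (dense? x)) deg atZero (∣H∣ * a) (2 * N) pointwise cs 𝟎)
            (≤-reflexive (cong ((2 * N) ^ length cs *_) (smooth cs len cs≢0))))
          where
          pointwise : ∀ x → ∣H∣ * a * iv (dense? x) ≤ 2 * N * deg x
          pointwise x with dense? x
          ... | yes h = ≤-trans (≤-reflexive (*-identityʳ _)) h
          ... | no _ = ≤-trans (≤-reflexive (*-zeroʳ (∣H∣ * a))) z≤n
          smooth : ∀ cs → length cs ≡ k → All (_≢ 0ᶠ) cs → reps deg atZero cs 𝟎 ≡ ∣H∣ ^ (4 + k') * reps f (λ p → iv (H? p)) cs 𝟎
          smooth (c ∷ cs) e (c≢0 ∷ _) = trans (Smoothing.smoothed Ls f c cs c≢0 𝟎) (cong (λ j → ∣H∣ ^ j * reps f (λ p → iv (H? p)) (c ∷ cs) 𝟎) (suc-injective e))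

        -- The assumption to be refuted: A exceeds the desired bound.
        module _ (dense : N ≤ 2 ^ l * (a * M)) where
          β-large : N ≤ 2 ^ (cB * l) * β
          β-large = *-cancelˡ-≤ N {{>-nonZero (1≤q^ n)}} (begin
            N * N ≤⟨ square-mono dense ⟩
            2 ^ l * (a * M) * (2 ^ l * (a * M)) ≡⟨ l₁ (2 ^ l) (a * M) ⟩
            2 ^ l * 2 ^ l * (a * M * (a * M)) ≤⟨ *-monoʳ-≤ (2 ^ l * 2 ^ l) dense-many ⟩
            2 ^ l * 2 ^ l * (4 * mH * (N * β)) ≤⟨ *-monoʳ-≤ (2 ^ l * 2 ^ l) (*-monoˡ-≤ (N * β) (≤2^* (4 * mH) 1≤l)) ⟩
            2 ^ l * 2 ^ l * (2 ^ (4 * mH * l) * (N * β)) ≡⟨ l₂ (2 ^ l) (2 ^ (4 * mH * l)) N β ⟩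
            N * (2 ^ l * (2 ^ l * 2 ^ (4 * mH * l)) * β) ≡⟨ cong (λ v → N * (v * β)) (trans (cong (2 ^ l *_) (sym (^-distribˡ-+-* 2 l _))) (sym (^-distribˡ-+-* 2 l _))) ⟩
            N * (2 ^ (cB * l) * β) ∎)
            where
            open ≤-Reasoning
            l₁ : ∀ p x → p * x * (p * x) ≡ p * p * (x * x)
            l₁ = solve-∀
            l₂ : ∀ p x N b → p * p * (x * (N * b)) ≡ N * (p * (p * x) * b)
            l₂ = solve-∀

          T-large : N ^ (4 + k') ≤ 2 ^ (σ * l) * T
          T-large = ≤-trans (subst (λ j → N ^ j ≤ 2 ^ (proj₁ supersat * suc (cB * l)) * T) len-pred (proj₂ supersat dense? (cB * l) β-large))
            (*-monoˡ-≤ T (^-monoʳ-≤ 2 (≤-trans (*-monoʳ-≤ (proj₁ supersat) (≤-trans (+-monoˡ-≤ (cB * l) 1≤l) (≤-reflexive (lem cB l)))) (≤-reflexive (sym (*-assoc (proj₁ supersat) (cB + 1) l))))))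
            where lem : ∀ c l → l + c * l ≡ (c + 1) * l
                  lem = solve-∀

          X : ℕ
          X = ∣W∣ * cnt

          -- The lower bound for `T` inserted into `V-bound`; the powers of |H| cancel up to one,
          -- which together with |W| makes N.
          main-term : a ^ k ≤ 2 ^ (σ * l) * 2 ^ k * X
          main-term = *-cancelˡ-≤ (N ^ k * h) {{>-nonZero (*-mono-≤ (1≤^ N k (1≤q^ n)) (1≤^ ∣H∣ (4 + k') (≤-trans (1≤q^ m) M≤∣H∣)))}} (begin
            N * N ^ (4 + k') * h * a ^ k ≡⟨ cong (λ v → v * N ^ (4 + k') * h * a ^ k) (sym ∣W∣*∣H∣) ⟩
            ∣W∣ * ∣H∣ * N ^ (4 + k') * h * a ^ k ≡⟨ l₁ ∣W∣ ∣H∣ (N ^ (4 + k')) h (a ^ k) ⟩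
            ∣W∣ * (∣H∣ * h * a ^ k * N ^ (4 + k')) ≡⟨ cong (λ v → ∣W∣ * (v * N ^ (4 + k'))) (sym (*-^ ∣H∣ a k)) ⟩
            ∣W∣ * ((∣H∣ * a) ^ k * N ^ (4 + k')) ≤⟨ *-monoʳ-≤ ∣W∣ (*-monoʳ-≤ ((∣H∣ * a) ^ k) T-large) ⟩
            ∣W∣ * ((∣H∣ * a) ^ k * (2 ^ (σ * l) * T)) ≡⟨ l₂ ∣W∣ ((∣H∣ * a) ^ k) (2 ^ (σ * l)) T ⟩
            ∣W∣ * 2 ^ (σ * l) * ((∣H∣ * a) ^ k * T) ≤⟨ *-monoʳ-≤ (∣W∣ * 2 ^ (σ * l)) V-bound ⟩
            ∣W∣ * 2 ^ (σ * l) * ((2 * N) ^ k * (h * cnt)) ≡⟨ cong (λ v → ∣W∣ * 2 ^ (σ * l) * (v * (h * cnt))) (*-^ 2 N k) ⟩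
            ∣W∣ * 2 ^ (σ * l) * (2 ^ k * N ^ k * (h * cnt)) ≡⟨ l₃ ∣W∣ (2 ^ (σ * l)) (2 ^ k) (N ^ k) h cnt ⟩
            N ^ k * h * (2 ^ (σ * l) * 2 ^ k * X) ∎)
            where
            open ≤-Reasoning
            h = ∣H∣ ^ (4 + k')
            l₁ : ∀ w H N h A → w * H * N * h * A ≡ w * (H * h * A * N)
            l₁ = solve-∀
            l₂ : ∀ w a p T → w * (a * (p * T)) ≡ w * p * (a * T)
            l₂ = solve-∀
            l₃ : ∀ w p t N h c → w * p * (t * N * (h * c)) ≡ N * h * (p * t * (w * c))
            l₃ = solve-∀

          Err : ℕ
          Err = ΣG (λ ℓ → iv (¬? (W? ℓ)) * (q * maxBias f ℓ ^ k))

          -- Four of the k factors `maxBias` are spent on the fourth moment. Outside `W` each of the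
          -- other k - 4 is at most N/(EM), and as k ≥ 5 at least one factor 1/E remains.
          error-term : E * Err ≤ q ^ 5 * mA * (2 ^ (l * k) * a ^ k)
          error-term = *-cancelʳ-≤ _ _ (M ^ k) {{>-nonZero (1≤^ M k (1≤q^ m))}} (begin
            E * Err * M ^ k ≤⟨ *-monoˡ-≤ (M ^ k) (*-monoˡ-≤ Err (≤-trans (≤-reflexive (sym (*-identityʳ E))) (*-monoʳ-≤ E (1≤^ E k' (1≤^ 2 (cE * l) (s≤s z≤n)))))) ⟩
            E ^ suc k' * Err * M ^ k ≡⟨ l₁ (E ^ suc k') Err M (M ^ k') ⟩
            E ^ suc k' * M ^ suc k' * Err * pow4 M ≡⟨ cong (λ v → v * Err * pow4 M) (sym (*-^ E M (suc k'))) ⟩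
            (E * M) ^ suc k' * Err * pow4 M ≡⟨ cong (_* pow4 M) (sym (∑-*ˡ xs ((E * M) ^ suc k') _)) ⟩
            ΣG (λ ℓ → (E * M) ^ suc k' * (iv (¬? (W? ℓ)) * (q * maxBias f ℓ ^ k))) * pow4 M ≤⟨ *-monoˡ-≤ (pow4 M) (∑-mono xs bound) ⟩
            ΣG (λ ℓ → q * N ^ suc k' * fourth f ℓ) * pow4 M ≡⟨ trans (cong (_* pow4 M) (∑-*ˡ xs (q * N ^ suc k') _)) (*-assoc (q * N ^ suc k') _ _) ⟩
            q * N ^ suc k' * (ΣG (fourth f) * pow4 M) ≤⟨ *-monoʳ-≤ (q * N ^ suc k') fourth-bound ⟩
            q * N ^ suc k' * (q ^ 4 * mA * pow4 N) ≡⟨ l₂ q (N ^ k') (q ^ 4) mA N ⟩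
            q ^ 5 * mA * N ^ k ≤⟨ *-monoʳ-≤ (q ^ 5 * mA) (^-monoˡ-≤ k dense) ⟩
            q ^ 5 * mA * (2 ^ l * (a * M)) ^ k ≡⟨ cong (q ^ 5 * mA *_) (trans (*-^ (2 ^ l) (a * M) k) (cong₂ _*_ (^-*-assoc 2 l k) (*-^ a M k))) ⟩
            q ^ 5 * mA * (2 ^ (l * k) * (a ^ k * M ^ k)) ≡⟨ l₃ (q ^ 5 * mA) (2 ^ (l * k)) (a ^ k) (M ^ k) ⟩
            q ^ 5 * mA * (2 ^ (l * k) * a ^ k) * M ^ k ∎)
            where
            open ≤-Reasoning
            l₁ : ∀ e r M P → e * r * (M * (M * (M * (M * (M * P))))) ≡ e * (M * P) * r * (M * M * (M * M))
            l₁ = solve-∀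
            l₂ : ∀ q P q4 c N → q * (N * P) * (q4 * c * (N * N * (N * N))) ≡ q * q4 * c * (N * (N * (N * (N * (N * P)))))
            l₂ = solve-∀
            l₃ : ∀ c p a M → c * (p * (a * M)) ≡ c * (p * a) * M
            l₃ = solve-∀
            l₄ : ∀ e q b P → e * (1 * (q * (b * (b * (b * (b * P)))))) ≡ q * (P * e) * (b * b * (b * b))
            l₄ = solve-∀
            bound : ∀ ℓ → (E * M) ^ suc k' * (iv (¬? (W? ℓ)) * (q * maxBias f ℓ ^ k)) ≤ q * N ^ suc k' * fourth f ℓ
            bound ℓ with W? ℓ
            ... | yes _ = ≤-trans (≤-reflexive (*-zeroʳ ((E * M) ^ suc k'))) z≤n
            ... | no ∉W = ≤-trans (≤-reflexive (trans (l₄ ((E * M) ^ suc k') q (maxBias f ℓ) (maxBias f ℓ ^ suc k')) (cong (λ v → q * v * fourth f ℓ) (sym (*-^ (maxBias f ℓ) (E * M) (suc k'))))))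
                  (*-monoˡ-≤ (fourth f ℓ) (*-monoʳ-≤ q (^-monoˡ-≤ (suc k') small)))
              where
              small : maxBias f ℓ * (E * M) ≤ N
              small = ≮⇒≥ (λ h → ∉W (W-member (∈-filter⁺ big? (Enum.complete (Gs n) ℓ) h)))

          error-small : 2 * Err ≤ X
          error-small = *-cancelˡ-≤ E {{>-nonZero (1≤^ 2 (cE * l) (s≤s z≤n))}} (begin
            E * (2 * Err) ≡⟨ l₁ E Err ⟩
            2 * (E * Err) ≤⟨ *-monoʳ-≤ 2 error-term ⟩
            2 * (q ^ 5 * mA * (2 ^ (l * k) * a ^ k)) ≤⟨ *-monoʳ-≤ 2 (*-mono-≤ (≤2^* (q ^ 5 * mA) 1≤l) (*-monoʳ-≤ (2 ^ (l * k)) main-term)) ⟩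
            2 * (2 ^ (q ^ 5 * mA * l) * (2 ^ (l * k) * (2 ^ (σ * l) * 2 ^ k * X))) ≡⟨ l₂ (2 ^ (q ^ 5 * mA * l)) (2 ^ (l * k)) (2 ^ (σ * l)) (2 ^ k) X ⟩
            2 * (2 ^ (q ^ 5 * mA * l) * (2 ^ (l * k) * (2 ^ (σ * l) * 2 ^ k))) * X ≡⟨ cong (λ v → 2 * v * X) combine ⟩
            2 ^ suc (q ^ 5 * mA * l + (l * k + (σ * l + k))) * X ≤⟨ *-monoˡ-≤ X (^-monoʳ-≤ 2 exponent) ⟩
            E * X ∎)
            where
            open ≤-Reasoning
            l₁ : ∀ e r → e * (2 * r) ≡ 2 * (e * r)
            l₁ = solve-∀
            l₂ : ∀ a b c d X → 2 * (a * (b * (c * d * X))) ≡ 2 * (a * (b * (c * d))) * X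
            l₂ = solve-∀
            combine : 2 ^ (q ^ 5 * mA * l) * (2 ^ (l * k) * (2 ^ (σ * l) * 2 ^ k)) ≡ 2 ^ (q ^ 5 * mA * l + (l * k + (σ * l + k)))
            combine = trans (cong (λ v → 2 ^ (q ^ 5 * mA * l) * (2 ^ (l * k) * v)) (sym (^-distribˡ-+-* 2 (σ * l) k)))
              (trans (cong (2 ^ (q ^ 5 * mA * l) *_) (sym (^-distribˡ-+-* 2 (l * k) _))) (sym (^-distribˡ-+-* 2 (q ^ 5 * mA * l) _)))
            exponent : suc (q ^ 5 * mA * l + (l * k + (σ * l + k))) ≤ cE * l
            exponent = ≤-trans (+-mono-≤ 1≤l (+-monoʳ-≤ (q ^ 5 * mA * l) (+-monoʳ-≤ (l * k) (+-monoʳ-≤ (σ * l) (≤-trans (≤-reflexive (sym (*-identityʳ k))) (*-monoʳ-≤ k 1≤l))))))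
              (≤-reflexive (lem (q ^ 5 * mA) l k σ))
              where lem : ∀ x l k σ → l + (x * l + (l * k + (σ * l + k * l))) ≡ (k + σ + k + 1 + x) * l
                    lem = solve-∀

          X-small : X ≤ 2 * (N * a)
          X-small = *-cancelˡ-≤ r {{r≢0}} (+-cancelʳ-≤ X _ _ (begin
            -- The comparison bounds rX by rN times the number of solutions plus `Err`. Doubling it
            -- leaves `2 * Err` ≤ X, which the additional X on the left absorbs.
            r * X + X ≤⟨ +-monoʳ-≤ (r * X) (m≤n*m X r {{r≢0}}) ⟩
            r * X + r * X ≡⟨ l₁ r X ⟩
            2 * (r * X) ≤⟨ *-monoʳ-≤ 2 (≤-trans (≤-reflexive (sym (*-assoc r ∣W∣ cnt))) compared) ⟩
            2 * (r * N * F₀ + Err) ≡⟨ l₂ r N F₀ Err ⟩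
            r * (2 * (N * F₀)) + 2 * Err ≤⟨ +-mono-≤ (*-monoʳ-≤ r (*-monoʳ-≤ 2 (*-monoʳ-≤ N few-solutions))) error-small ⟩
            r * (2 * (N * a)) + X ∎))
            where
            open ≤-Reasoning
            F₀ = reps f atZero cs 𝟎
            compared : r * ∣W∣ * cnt ≤ r * N * F₀ + Err
            compared = subst (λ k → r * ∣W∣ * cnt ≤ r * N * F₀ + ΣG (λ ℓ → iv (¬? (W? ℓ)) * (q * maxBias f ℓ ^ k))) len (comparison f Ls cs cs≢0)
            l₁ : ∀ r X → r * X + r * X ≡ 2 * (r * X)
            l₁ = solve-∀
            l₂ : ∀ r N F e → 2 * (r * N * F + e) ≡ r * (2 * (N * F)) + 2 * e
            l₂ = solve-∀

          1≤a : 1 ≤ a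
          1≤a = positive a dense
            where
            positive : ∀ a → N ≤ 2 ^ l * (a * M) → 1 ≤ a
            positive zero h = contradiction (≤-trans (1≤q^ n) (≤-trans h (≤-reflexive (*-zeroʳ (2 ^ l))))) (λ ())
            positive (suc a) h = s≤s z≤n

          -- Since s ≥ 2, M² is at most N, so a set as large as `dense` claims has at least about
          -- N^(1/2) elements.
          N≤a² : N ≤ 2 ^ l * 2 ^ l * (a * a)
          N≤a² = *-cancelˡ-≤ (M * M) {{>-nonZero (*-mono-≤ (1≤q^ m) (1≤q^ m))}} (begin
            M * M * N ≤⟨ *-monoˡ-≤ N (≤-trans (m≤n*m (M * M) R' {{>-nonZero (1≤q^ (n ∸ 2 * m))}}) (≤-reflexive R'MM)) ⟩
            N * N ≤⟨ square-mono dense ⟩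
            2 ^ l * (a * M) * (2 ^ l * (a * M)) ≡⟨ lem (2 ^ l) a M ⟩
            M * M * (2 ^ l * 2 ^ l * (a * a)) ∎)
            where
            open ≤-Reasoning
            lem : ∀ p a M → p * (a * M) * (p * (a * M)) ≡ M * M * (p * p * (a * a))
            lem = solve-∀

          -- The main term gives a^5 ≤ a^k, at most a power of 2^l times Na, hence at most such a
          -- power times a³ by `N≤a²`.
          a²-small : a * a ≤ 2 ^ (σ * l) * 2 ^ k * 2 * (2 ^ l * 2 ^ l)
          a²-small = *-cancelʳ-≤ _ _ (a * a * a) {{>-nonZero (*-mono-≤ (*-mono-≤ 1≤a 1≤a) 1≤a)}} (begin
            a * a * (a * a * a) ≡⟨ l₁ a ⟩
            a ^ 5 ≤⟨ ^-monoʳ-≤ a {{>-nonZero 1≤a}} (m≤m+n 5 k') ⟩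
            a ^ k ≤⟨ main-term ⟩
            2 ^ (σ * l) * 2 ^ k * X ≤⟨ *-monoʳ-≤ (2 ^ (σ * l) * 2 ^ k) X-small ⟩
            2 ^ (σ * l) * 2 ^ k * (2 * (N * a)) ≤⟨ *-monoʳ-≤ (2 ^ (σ * l) * 2 ^ k) (*-monoʳ-≤ 2 (*-monoˡ-≤ a N≤a²)) ⟩
            2 ^ (σ * l) * 2 ^ k * (2 * (2 ^ l * 2 ^ l * (a * a) * a)) ≡⟨ l₂ (2 ^ (σ * l) * 2 ^ k) (2 ^ l * 2 ^ l) a ⟩
            2 ^ (σ * l) * 2 ^ k * 2 * (2 ^ l * 2 ^ l) * (a * a * a) ∎)
            where
            open ≤-Reasoning
            l₁ : ∀ a → a * a * (a * a * a) ≡ a * (a * (a * (a * (a * 1))))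
            l₁ = solve-∀
            l₂ : ∀ p x a → p * (2 * (x * (a * a) * a)) ≡ p * 2 * x * (a * a * a)
            l₂ = solve-∀

          too-large : n ≤ threshold * l
          too-large = ≮⇒≥ λ lt → <⇒≱ (^-monoʳ-< 2 (s≤s (s≤s z≤n)) lt) (begin
            2 ^ n ≤⟨ ^-monoˡ-≤ n 2≤q ⟩
            N ≤⟨ N≤a² ⟩
            2 ^ l * 2 ^ l * (a * a) ≤⟨ *-monoʳ-≤ (2 ^ l * 2 ^ l) a²-small ⟩
            2 ^ l * 2 ^ l * (2 ^ (σ * l) * 2 ^ k * 2 * (2 ^ l * 2 ^ l)) ≡⟨ cong₂ (λ u v → u * (v * 2 * u)) (sym (^-distribˡ-+-* 2 l l)) (sym (^-distribˡ-+-* 2 (σ * l) k)) ⟩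
            2 ^ (l + l) * (2 ^ (σ * l + k) * 2 * 2 ^ (l + l)) ≡⟨ l₁ (2 ^ (l + l)) (2 ^ (σ * l + k)) ⟩
            2 * (2 ^ (l + l) * (2 ^ (σ * l + k) * 2 ^ (l + l))) ≡⟨ cong (2 *_) (trans (cong (2 ^ (l + l) *_) (sym (^-distribˡ-+-* 2 (σ * l + k) (l + l)))) (sym (^-distribˡ-+-* 2 (l + l) _))) ⟩
            2 ^ suc ((l + l) + ((σ * l + k) + (l + l))) ≤⟨ ^-monoʳ-≤ 2 exponent ⟩
            2 ^ (threshold * l) ∎)
            where
            open ≤-Reasoning
            l₁ : ∀ u v → u * (v * 2 * u) ≡ 2 * (u * (v * u))
            l₁ = solve-∀
            exponent : suc ((l + l) + ((σ * l + k) + (l + l))) ≤ threshold * l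
            exponent = ≤-trans (+-mono-≤ 1≤l (+-monoʳ-≤ (l + l) (+-monoˡ-≤ (l + l) (+-monoʳ-≤ (σ * l) (≤-trans (≤-reflexive (sym (*-identityʳ k))) (*-monoʳ-≤ k 1≤l))))))
              (≤-trans (m≤n+m _ ((4 * cE + 1 + q ^ 4 * mA) * l)) (≤-reflexive (lem (4 * cE + 1 + q ^ 4 * mA) l k σ)))
              where lem : ∀ x l k σ → x * l + (l + ((l + l) + ((σ * l + k * l) + (l + l)))) ≡ (x + (σ + k + 5)) * l
                    lem = solve-∀

      density-bound : 2 ^ l * (ΣG (λ x → iv (A? x)) * q ^ (n / s)) ≤ q ^ n
      density-bound = ≮⇒≥ λ lt → <⇒≱ (≤-trans (n<2^n (threshold * l)) l-small) (too-large (<⇒≤ lt))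

-- From powers of 2 to powers of the logarithm

log-bracket : ∀ v n → 1 ≤ v → 1 ≤ n → ∃ λ l → 2 ^ (v * l) ≤ n × n < 2 ^ (v * suc l)
log-bracket v n 1≤v 1≤n = search n (≤-trans (n<2^n n) (^-monoʳ-≤ 2 (≤-trans (m≤n*m n v {{>-nonZero 1≤v}}) (*-monoʳ-≤ v (n≤1+n n)))))
  where
  search : ∀ j → n < 2 ^ (v * suc j) → ∃ λ l → 2 ^ (v * l) ≤ n × n < 2 ^ (v * suc l)
  search zero h = zero , ≤-trans (≤-reflexive (cong (2 ^_) (*-zeroʳ v))) 1≤n , h
  search (suc j) h with 2 ^ (v * suc j) ≤? n
  ... | yes le = suc j , le , h
  ... | no nle = search j (≰⇒> nle)

module FromLists {q : ℕ} (F : FiniteField q) where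
  open Geometry F
  open GroupSums F
  open Supersaturation F using (sumᶠ)

  -- In characteristic 2 the involution x ↦ x + 1 pairs off the elements of the field.
  odd⇒2≢0 : ¬ (2 ∣ q) → 1ᶠ +ᶠ 1ᶠ ≢ 0ᶠ
  odd⇒2≢0 odd 2≡0 = odd (divides S (begin
    q ≡⟨ sym card-F ⟩
    ΣF (λ _ → 1) ≡⟨ ∑-cong (elems Fs) pair ⟩
    ΣF (λ x → iv (toℕ x <? toℕ (σ x)) + iv (toℕ (σ x) <? toℕ x)) ≡⟨ ∑-+ (elems Fs) _ _ ⟩
    S + ΣF (λ x → iv (toℕ (σ x) <? toℕ x)) ≡⟨ cong (λ v → S + v) (trans (sym (∑-reindex Fs σ σ σσ σσ (λ x → iv (toℕ (σ x) <? toℕ x))))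
        (∑-cong (elems Fs) (λ x → cong (λ v → iv (toℕ v <? toℕ (σ x))) (σσ x)))) ⟩
    S + S ≡⟨ lem S ⟩
    S * 2 ∎))
    where
    open ≡-Reasoning
    lem : ∀ S → S + S ≡ S * 2
    lem = solve-∀
    σ : Fin q → Fin q
    σ x = x +ᶠ 1ᶠ
    σσ : ∀ x → σ (σ x) ≡ x
    σσ x = trans (R.+-assoc x 1ᶠ 1ᶠ) (trans (cong (x +ᶠ_) 2≡0) (R.+-identityʳ x))
    σ≢ : ∀ x → σ x ≢ x
    σ≢ x e = 0≢1ᶠ (sym (trans (solve 2 (λ x y → y := (x :+ y) :+ :- x) refl x 1ᶠ) (trans (cong (_+ᶠ -ᶠ x) e) (R.-‿inverseʳ x))))
    S = ΣF (λ x → iv (toℕ x <? toℕ (σ x)))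
    pair : ∀ x → 1 ≡ iv (toℕ x <? toℕ (σ x)) + iv (toℕ (σ x) <? toℕ x)
    pair x with <-cmp (toℕ x) (toℕ (σ x))
    ... | tri< lt _ ¬gt = sym (cong₂ _+_ (iv-yes (toℕ x <? toℕ (σ x)) lt) (iv-no (toℕ (σ x) <? toℕ x) ¬gt))
    ... | tri≈ _ e _ = contradiction (Fin.toℕ-injective (sym e)) (σ≢ x)
    ... | tri> ¬lt _ gt = sym (cong₂ _+_ (iv-no (toℕ x <? toℕ (σ x)) ¬lt) (iv-yes (toℕ (σ x) <? toℕ x) gt))

  sum-tabulate : ∀ k (a : Fin k → Fin q) → sumᶠ (tabulate a) ≡ fsum F k a
  sum-tabulate zero a = refl
  sum-tabulate (suc k) a = cong (a fzero +ᶠ_) (sum-tabulate k (a ∘ fsuc))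

  module _ {n} (A : List (Pt F n)) where
    member? : ∀ x → Dec (x ∈ A)
    member? x = any? (λ y → x ≟ᵛ y) A

    length≤ : Unique A → length A ≤ ΣG (λ x → iv (member? x))
    length≤ unique = begin
      length A ≡⟨ sym (∑-1-length A) ⟩
      ∑ A (λ _ → 1) ≡⟨ ∑-cong A (λ a → sym (∑-point1 (Gs n) a)) ⟩
      ∑ A (λ a → ΣG (λ x → iv (x ≟ᵛ a))) ≡⟨ ∑-swap A (elems (Gs n)) _ ⟩
      ΣG (λ x → ∑ A (λ a → iv (x ≟ᵛ a))) ≤⟨ ∑-mono (elems (Gs n)) bound ⟩
      ΣG (λ x → iv (member? x)) ∎
      where
      open ≤-Reasoning
      bound : ∀ x → ∑ A (λ a → iv (x ≟ᵛ a)) ≤ iv (member? x)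
      bound x with member? x
      ... | yes _ = ∑-iv≤1 (λ a → x ≟ᵛ a) A unique (λ p q → trans (sym p) q)
      ... | no x∉ = ≤-reflexive (trans (∑-cong∈ A (λ a a∈ → iv-no (x ≟ᵛ a) (λ { refl → x∉ a∈ }))) (∑-0 A))

    private
      f : Pt F n → ℕ
      f x = iv (member? x)
      xs = elems (Gs n)

    Solution : ∀ k → (Fin k → Fin q) → Pt F n → Set
    Solution k a p = Σ (Fin k → Pt F n) λ x → (∀ i → x i ∈ A) × p ⊞ lincomb F k a x ≡ 𝟎

    extend : ∀ k (a : Fin (suc k) → Fin q) p y → y ∈ A → Solution k (a ∘ fsuc) (p ⊞ a fzero ⊡ y) → Solution (suc k) a p
    extend k a p y y∈ (x , x∈ , e) = (λ { fzero → y ; (fsuc i) → x i }) , (λ { fzero → y∈ ; (fsuc i) → x∈ i }) , trans (sym (⊞-assoc p _ _)) e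

    reps-solution : ∀ k (a : Fin k → Fin q) p → 1 ≤ reps f atZero (tabulate a) p → Solution k a p
    reps-solution zero a p h with p ≟ᵛ 𝟎
    ... | yes e = (λ ()) , (λ ()) , trans (⊞-identityʳ p) e
    reps-solution (suc k) a p h with ∑-positive xs _ h
    ... | y , _ , pos with member? y
    ...   | yes y∈ = extend k a p y y∈ (reps-solution k (a ∘ fsuc) _ (≤-trans pos (≤-reflexive (*-identityˡ _))))

    -- If every solution is constantly z, then in each variable only z can be followed by a nonzero
    -- count.
    reps≤1 : ∀ k (a : Fin k → Fin q) p z → (∀ (s : Solution k a p) i → proj₁ s i ≡ z) → reps f atZero (tabulate a) p ≤ 1
    reps≤1 zero a p z h = iv≤1 (p ≟ᵛ 𝟎)
    reps≤1 (suc k) a p z h = ≤-trans (∑-mono xs bound) (≤-reflexive (∑-point1 (Gs n) z))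
      where
      bound : ∀ y → f y * reps f atZero (tabulate (a ∘ fsuc)) (p ⊞ a fzero ⊡ y) ≤ iv (y ≟ᵛ z)
      bound y with member? y
      ... | no _ = z≤n
      ... | yes y∈ with y ≟ᵛ z
      ...   | yes refl = ≤-trans (≤-reflexive (*-identityˡ _)) (reps≤1 k (a ∘ fsuc) _ z (λ s i → h (extend k a p y y∈ s) (fsuc i)))
      ...   | no y≢z with reps f atZero (tabulate (a ∘ fsuc)) (p ⊞ a fzero ⊡ y) in e
      ...     | zero = z≤n
      ...     | suc _ = contradiction (h (extend k a p y y∈ (reps-solution k (a ∘ fsuc) _ (≤-trans (s≤s z≤n) (≤-reflexive (sym e))))) fzero) y≢z

    -- The first variable determines the solution: without nontrivial ones, the rest must repeat it.
    reps≤size : ∀ k (a : Fin (suc k) → Fin q) → ¬ HasNontrivialSolution F (suc k) a A → reps f atZero (tabulate a) 𝟎 ≤ ΣG f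
    reps≤size k a none = ∑-mono xs bound
      where
      bound : ∀ y → f y * reps f atZero (tabulate (a ∘ fsuc)) (𝟎 ⊞ a fzero ⊡ y) ≤ f y
      bound y with member? y
      ... | no _ = z≤n
      ... | yes y∈ = ≤-trans (≤-reflexive (*-identityˡ _)) (reps≤1 k (a ∘ fsuc) _ y same)
        where
        same : ∀ (s : Solution k (a ∘ fsuc) (𝟎 ⊞ a fzero ⊡ y)) i → proj₁ s i ≡ y
        same s i with proj₁ s i ≟ᵛ y
        ... | yes e = e
        ... | no ne = contradiction (proj₁ s' , proj₁ (proj₂ s') , trans (sym (⊞-identityˡ _)) (proj₂ (proj₂ s')) , fsuc i , fzero , ne) none
          where s' = extend k a 𝟎 y y∈ s

-- The hypothesis raised to the power sv, so that no roots occur. Rounding n/s down costs `N≤`, a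
-- factor q^s in M^s; and n < 2^(v(l+1)) trades 2^(lsv) for n^s up to the constant 2^(vs).
density⇒bound : ∀ q n s₁ v l a → 1 ≤ q → let s = suc s₁ in 2 ^ l * (a * q ^ (n / s)) ≤ q ^ n → n < 2 ^ (v * suc l) →
  a ^ (s * v) * n ^ s ≤ (2 ^ v) ^ s * q ^ (s * v) * q ^ (n * (s₁ * v))
density⇒bound q n s₁ v l a 1≤q dense n< = begin
  a ^ (s * v) * n ^ s ≤⟨ *-monoʳ-≤ (a ^ (s * v)) (^-monoˡ-≤ s (<⇒≤ n<)) ⟩
  a ^ (s * v) * (2 ^ (v * suc l)) ^ s ≡⟨ cong (λ w → a ^ (s * v) * w ^ s) (trans (cong (2 ^_) (*-suc v l)) (^-distribˡ-+-* 2 v (v * l))) ⟩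
  a ^ (s * v) * (2 ^ v * 2 ^ (v * l)) ^ s ≡⟨ cong (a ^ (s * v) *_) (*-^ (2 ^ v) (2 ^ (v * l)) s) ⟩
  a ^ (s * v) * ((2 ^ v) ^ s * (2 ^ (v * l)) ^ s) ≡⟨ lem₁ (a ^ (s * v)) ((2 ^ v) ^ s) _ ⟩
  (2 ^ v) ^ s * ((2 ^ (v * l)) ^ s * a ^ (s * v)) ≡⟨ cong ((2 ^ v) ^ s *_) regroup ⟩
  (2 ^ v) ^ s * ((2 ^ l * a) ^ s) ^ v ≤⟨ *-monoʳ-≤ ((2 ^ v) ^ s) (^-monoˡ-≤ v base) ⟩
  (2 ^ v) ^ s * (q ^ s * (q ^ n) ^ s₁) ^ v ≡⟨ cong ((2 ^ v) ^ s *_) (trans (*-^ (q ^ s) _ v) (cong₂ _*_ (^-*-assoc q s v) (trans (^-*-assoc (q ^ n) s₁ v) (^-*-assoc q n (s₁ * v))))) ⟩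
  (2 ^ v) ^ s * (q ^ (s * v) * q ^ (n * (s₁ * v))) ≡⟨ sym (*-assoc ((2 ^ v) ^ s) _ _) ⟩
  (2 ^ v) ^ s * q ^ (s * v) * q ^ (n * (s₁ * v)) ∎
  where
  open ≤-Reasoning
  s = suc s₁
  M = q ^ (n / s)
  lem₁ : ∀ a b c → a * (b * c) ≡ b * (c * a)
  lem₁ = solve-∀
  lem₂ : ∀ v l s → v * l * s ≡ l * (s * v)
  lem₂ = solve-∀
  regroup : (2 ^ (v * l)) ^ s * a ^ (s * v) ≡ ((2 ^ l * a) ^ s) ^ v
  regroup = trans (cong (_* a ^ (s * v)) (trans (^-*-assoc 2 (v * l) s) (trans (cong (2 ^_) (lem₂ v l s)) (sym (^-*-assoc 2 l (s * v))))))
    (trans (sym (*-^ (2 ^ l) a (s * v))) (sym (^-*-assoc (2 ^ l * a) s v)))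
  N≤ : q ^ n ≤ q ^ s * M ^ s
  N≤ = ≤-trans (^-monoʳ-≤ q {{>-nonZero 1≤q}} (≤-trans (≤-reflexive (m≡m%n+[m/n]*n n s)) (+-monoˡ-≤ (n / s * s) (<⇒≤ (m%n<n n s)))))
    (≤-reflexive (trans (^-distribˡ-+-* q s (n / s * s)) (cong (q ^ s *_) (sym (^-*-assoc q (n / s) s)))))
  base : (2 ^ l * a) ^ s ≤ q ^ s * (q ^ n) ^ s₁
  base = *-cancelʳ-≤ _ _ (q ^ n) {{>-nonZero (1≤^ q n 1≤q)}} (begin
    (2 ^ l * a) ^ s * q ^ n ≤⟨ *-monoʳ-≤ ((2 ^ l * a) ^ s) N≤ ⟩
    (2 ^ l * a) ^ s * (q ^ s * M ^ s) ≡⟨ lem₃ ((2 ^ l * a) ^ s) (q ^ s) (M ^ s) ⟩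
    q ^ s * ((2 ^ l * a) ^ s * M ^ s) ≡⟨ cong (q ^ s *_) (trans (sym (*-^ (2 ^ l * a) M s)) (cong (_^ s) (*-assoc (2 ^ l) a M))) ⟩
    q ^ s * (2 ^ l * (a * M)) ^ s ≤⟨ *-monoʳ-≤ (q ^ s) (^-monoˡ-≤ s dense) ⟩
    q ^ s * (q ^ n * (q ^ n) ^ s₁) ≡⟨ lem₄ (q ^ s) (q ^ n) _ ⟩
    q ^ s * (q ^ n) ^ s₁ * q ^ n ∎)
    where
    lem₃ : ∀ a b c → a * (b * c) ≡ b * (a * c)
    lem₃ = solve-∀
    lem₄ : ∀ a b c → a * (b * c) ≡ a * c * b
    lem₄ = solve-∀

module FinalBound {q : ℕ} (F : FiniteField q) (s' t k' : ℕ) (a : Fin (5 + k') → Fin q) where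
  open Geometry F
  open GroupSums F
  open FromLists F
  open Supersaturation F using (super)

  private
    s k : ℕ
    s = suc (suc s')
    k = 5 + k'

    1≤q : 1 ≤ q
    1≤q = ≤-trans (s≤s z≤n) 2≤q

  SparseAbove : ℕ → Set
  SparseAbove v = ∀ n l → 1 ≤ l → 2 ^ (v * l) ≤ n → (A : List (Pt F n)) → KstFree F s t A → ¬ HasNontrivialSolution F k a A →
    2 ^ l * (ΣG (λ x → iv (member? A x)) * q ^ (n / s)) ≤ q ^ n

  sparse : 1 ≤ t → ¬ (2 ∣ q) → (∀ i → a i ≢ 0ᶠ) → fsum F k a ≡ 0ᶠ → ∃ λ v → 1 ≤ v × SparseAbove v
  sparse 1≤t odd a≢0 Σa≡0 = D.threshold 1≤t (length-tabulate a) cs≢0 supersat , D.1≤threshold 1≤t (length-tabulate a) cs≢0 supersat ,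
    λ n l 1≤l large A free none → D.density-bound 1≤t (length-tabulate a) cs≢0 supersat n l 1≤l large (member? A) free (reps≤size A _ a none)
    where
    module D = DensityBound F s' t k' (tabulate a)
    cs≢0 : All (_≢ 0ᶠ) (tabulate a)
    cs≢0 = All.tabulate⁺ a≢0
    supersat = super (odd⇒2≢0 odd) _ _ _ cs≢0 (trans (sum-tabulate k a) Σa≡0)

  Bound : ℕ → ℕ → Set
  Bound v C = ∀ n → 1 ≤ n → (A : List (Vec (Fin q) n)) → Unique A → KstFree F s t A → ¬ HasNontrivialSolution F k a A →
    length A ^ (s * v) * n ^ s ≤ C * q ^ (n * ((s ∸ 1) * v))

  sparse⇒bound : ∀ v → 1 ≤ v → SparseAbove v → ∃ λ C → 1 ≤ C × Bound v C
  sparse⇒bound v 1≤v above = C₁ + C₂ , ≤-trans (*-mono-≤ (1≤q^ (2 ^ v * (s * v))) (1≤^ (2 ^ v) s (1≤^ 2 v (s≤s z≤n)))) (m≤m+n C₁ C₂) , bound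
    where
    -- `C₁` covers n ≤ 2^v, where no l ≥ 1 is available and |A| ≤ N is enough; `C₂` is the constant
    -- of `density⇒bound`.
    C₁ C₂ : ℕ
    C₁ = q ^ (2 ^ v * (s * v)) * (2 ^ v) ^ s
    C₂ = (2 ^ v) ^ s * q ^ (s * v)
    bound : Bound v (C₁ + C₂)
    bound n 1≤n A unique free none with log-bracket v n 1≤v 1≤n
    ... | zero , _ , n< = begin
        length A ^ (s * v) * n ^ s ≤⟨ *-mono-≤ (^-monoˡ-≤ (s * v) (≤-trans (length≤ A unique) (ΣG-iv≤ (member? A)))) (^-monoˡ-≤ s n≤) ⟩
        (q ^ n) ^ (s * v) * (2 ^ v) ^ s ≡⟨ cong (_* (2 ^ v) ^ s) (^-*-assoc q n (s * v)) ⟩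
        q ^ (n * (s * v)) * (2 ^ v) ^ s ≤⟨ *-monoˡ-≤ ((2 ^ v) ^ s) (^-monoʳ-≤ q {{>-nonZero 1≤q}} (*-monoˡ-≤ (s * v) n≤)) ⟩
        C₁ ≤⟨ m≤m+n C₁ C₂ ⟩
        C₁ + C₂ ≤⟨ m≤m*n (C₁ + C₂) (q ^ (n * ((s ∸ 1) * v))) {{>-nonZero (1≤q^ (n * ((s ∸ 1) * v)))}} ⟩
        (C₁ + C₂) * q ^ (n * ((s ∸ 1) * v)) ∎
      where
      open ≤-Reasoning
      n≤ : n ≤ 2 ^ v
      n≤ = ≤-trans (<⇒≤ n<) (≤-reflexive (cong (2 ^_) (*-identityʳ v)))
    ... | suc l , large , n< = begin
        length A ^ (s * v) * n ^ s ≤⟨ *-monoˡ-≤ (n ^ s) (^-monoˡ-≤ (s * v) (length≤ A unique)) ⟩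
        ΣG (λ x → iv (member? A x)) ^ (s * v) * n ^ s ≤⟨ density⇒bound q n (suc s') v (suc l) _ 1≤q (above n (suc l) (s≤s z≤n) large A free none) n< ⟩
        C₂ * q ^ (n * ((s ∸ 1) * v)) ≤⟨ *-monoˡ-≤ (q ^ (n * ((s ∸ 1) * v))) (m≤n+m C₂ C₁) ⟩
        (C₁ + C₂) * q ^ (n * ((s ∸ 1) * v)) ∎
      where open ≤-Reasoning

-- Taking the root of order sv, the last line reads |A| ≤ C^(1/(sv)) N^(1-1/s) n^(-1/v), so c = 1/v,
-- and n differs from log N by the constant factor log q. The v constructed here depends only on q,
-- k, s and t: the exponent in `Super` obeys the same recursion in every branch of `super`, whatever
-- the coefficients.
theorem1p2 : ∀ {q} (F : FiniteField q) → ¬ (2 ∣ q) →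
    (s t k : ℕ) → 2 ≤ s → s ≤ t → 5 ≤ k →
    (a : Fin k → Fin q) → (∀ i → a i ≢ FiniteField.0# F) → fsum F k a ≡ FiniteField.0# F →
    ∃[ v ] (1 ≤ v × ∃[ C ] (1 ≤ C ×
    (∀ n → 1 ≤ n → (A : List (Vec (Fin q) n)) → Unique A →
    KstFree F s t A → ¬ HasNontrivialSolution F k a A →
    length A ^ (s * v) * n ^ s ≤ C * q ^ (n * ((s ∸ 1) * v)))))
theorem1p2 F odd (suc (suc s')) t (suc (suc (suc (suc (suc k'))))) (s≤s (s≤s z≤n)) s≤t (s≤s (s≤s (s≤s (s≤s (s≤s z≤n))))) a a≢0 Σa≡0 =
  let open FinalBound F s' t k' a
      v , 1≤v , above = sparse (≤-trans (s≤s z≤n) s≤t) odd a≢0 Σa≡0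
  in v , 1≤v , sparse⇒bound v 1≤v above
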